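{- Let $G$ be a finite simple connected graph on $n$ vertices with adjacency matrix $A$, and let $\mu_{\max}(A)=\mu_1\ge \mu_2\ge\cdots\ge\mu_n$ be the eigenvalues of $A$. For $i\in[n]$ write $\mu_i^\uparrow(A)=\mu_{n+1-i}$ for the $i$-th smallest eigenvalue. Let $\kappa$ be the smallest integer such that \[ 0\ \ge\ \mu_{\max}(A)+\sum_{i=1}^{\kappa}\mu_i^\uparrow(A). \] Then the quantum chromatic number of $G$ satisfies $\chi_q(G)\ge 1+\kappa$.
   Context: A quantum $c$-coloring of a graph $G=(V,E)$ is a collection of orthogonal projectors $\{P_{v,k}: v\in V, k\in[c]\}$ in $\mathbb{C}^{d\times d}$, for some integer $d>0$, such that $\sum_{k\in[c]}P_{v,k}=I_d$ for every vertex $v\in V$, and $P_{v,k}P_{w,k}=0_d$ for every edge $vw\in E$ and every $k\in[c]$. The quantum chromatic number $\chi_q(G)$ is the smallest $c$ for which $G$ admits a quantum $c$-coloring in some dimension $d>0$. -}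

module Defs where

open import Level using (0ℓ; _⊔_)
open import Data.Bool.Base using (if_then_else_)
open import Data.Product.Base using (Σ-syntax; ∃-syntax; _×_; _,_)
open import Data.Nat.Base as ℕ using (ℕ; zero; suc)
import Data.Nat.Properties as ℕ
open import Data.Fin.Base as Fin using (Fin; zero; suc; toℕ; inject≤; opposite)
import Data.Fin.Properties as Fin
open import Data.Rational.Base as ℚ using (ℚ; 0ℚ; 1ℚ; ½)
import Data.Rational.Properties as ℚ
import Data.Rational.Solver as ℚ-Solver
open import Data.Vec.Functional using (Vector; removeAt)
open import Relation.Nullary.Decidable.Core using (does)
open import Relation.Binary.Core using (Rel)
open import Relation.Binary.Definitions using (Decidable; Irreflexive; Symmetric)
open import Relation.Binary.Structures using (IsEquivalence)
open import Relation.Binary.PropositionalEquality using (_≡_; refl; sym; trans; cong; subst)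
open import Relation.Binary.Construct.Closure.ReflexiveTransitive using (Star)
open import Relation.Unary using (Pred)
open import Algebra.Bundles using (CommutativeRing)

IsLeast : ∀ {p} → Pred ℕ p → Pred ℕ p
IsLeast P m = P m × (∀ k → P k → m ℕ.≤ k)

-- ℝ is the setoid of Cauchy sequences of rationals. The operations are defined
-- by copatterns on a record without eta, so that they do not unfold during
-- unification.
module Real where

  open import Data.Rational.Base using (_+_; _*_; _-_; -_; ∣_∣; _<_; _≤_)

  Eventually : Pred ℕ 0ℓ → Set
  Eventually P = ∃[ N ] (∀ n → N ℕ.≤ n → P n)

  record ℝ : Set where
    no-eta-equality
    constructor mkℝ
    field
      seq    : ℕ → ℚ
      cauchy : ∀ ε → 0ℚ < ε →
               ∃[ N ] (∀ m n → N ℕ.≤ m → N ℕ.≤ n → ∣ seq m - seq n ∣ < ε)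

  open ℝ public

  infix 4 _≈ᵣ_ _≤ᵣ_

  record _≈ᵣ_ (x y : ℝ) : Set where
    constructor mk≈
    field
      close : ∀ ε → 0ℚ < ε → Eventually (λ n → ∣ seq x n - seq y n ∣ < ε)

  record _≤ᵣ_ (x y : ℝ) : Set where
    constructor mk≤
    field
      below : ∀ ε → 0ℚ < ε → Eventually (λ n → seq x n < seq y n + ε)

  open _≈ᵣ_ public
  open _≤ᵣ_ public

  half : ℚ → ℚ
  half ε = ½ * ε

  half-pos : ∀ {ε} → 0ℚ < ε → 0ℚ < half ε
  half-pos {ε} 0<ε = subst (_< ½ * ε) (ℚ.*-zeroʳ ½) (ℚ.*-monoʳ-<-pos ½ 0<ε)

  half+half : ∀ ε → half ε + half ε ≡ ε
  half+half ε = trans (sym (ℚ.*-distribʳ-+ ε ½ ½)) (ℚ.*-identityˡ ε)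

  close-refl : ∀ p {ε} → 0ℚ < ε → ∣ p - p ∣ < ε
  close-refl p {ε} 0<ε = subst (λ q → ∣ q ∣ < ε) (sym (ℚ.+-inverseʳ p)) 0<ε

  close-sym : ∀ p q {ε} → ∣ p - q ∣ < ε → ∣ q - p ∣ < ε
  close-sym p q {ε} = subst (_< ε) (trans (sym (ℚ.∣-p∣≡∣p∣ (p - q))) (cong ∣_∣ lemma))
    where
    open ℚ-Solver.+-*-Solver
    lemma : - (p - q) ≡ q - p
    lemma = solve 2 (λ p q → :- (p :- q) := q :- p) refl p q

  ∣+∣-< : ∀ p q {ε} → ∣ p ∣ < half ε → ∣ q ∣ < half ε → ∣ p + q ∣ < ε
  ∣+∣-< p q {ε} p< q< =
    subst (∣ p + q ∣ <_) (half+half ε)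
      (ℚ.≤-<-trans (ℚ.∣p+q∣≤∣p∣+∣q∣ p q) (ℚ.+-mono-< p< q<))

  close-trans : ∀ p q r {ε} → ∣ p - q ∣ < half ε → ∣ q - r ∣ < half ε → ∣ p - r ∣ < ε
  close-trans p q r {ε} pq qr = subst (λ s → ∣ s ∣ < ε) lemma (∣+∣-< (p - q) (q - r) pq qr)
    where
    open ℚ-Solver.+-*-Solver
    lemma : (p - q) + (q - r) ≡ p - r
    lemma = solve 3 (λ p q r → (p :- q) :+ (q :- r) := p :- r) refl p q r

  close-+ : ∀ p q r s {ε} → ∣ p - q ∣ < half ε → ∣ r - s ∣ < half ε → ∣ (p + r) - (q + s) ∣ < ε
  close-+ p q r s {ε} pq rs = subst (λ t → ∣ t ∣ < ε) lemma (∣+∣-< (p - q) (r - s) pq rs)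
    where
    open ℚ-Solver.+-*-Solver
    lemma : (p - q) + (r - s) ≡ (p + r) - (q + s)
    lemma = solve 4 (λ p q r s → (p :- q) :+ (r :- s) := (p :+ r) :- (q :+ s)) refl p q r s

  close-neg : ∀ p q {ε} → ∣ p - q ∣ < ε → ∣ (- p) - (- q) ∣ < ε
  close-neg p q {ε} = subst (_< ε) (trans (sym (ℚ.∣-p∣≡∣p∣ (p - q))) (cong ∣_∣ lemma))
    where
    open ℚ-Solver.+-*-Solver
    lemma : - (p - q) ≡ (- p) - (- q)
    lemma = solve 2 (λ p q → :- (p :- q) := (:- p) :- (:- q)) refl p q

  quotient : ∀ ε B → 0ℚ < ε → 0ℚ < B → ∃[ δ ] (0ℚ < δ × δ * B ≡ ε)
  quotient ε B 0<ε 0<B = ε * 1/B , pos , eq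
    where
    instance
      B-pos : ℚ.Positive B
      B-pos = ℚ.positive 0<B
      B-nz : ℚ.NonZero B
      B-nz = ℚ.pos⇒nonZero B
    1/B : ℚ
    1/B = ℚ.1/ B
    instance
      1/B-pos : ℚ.Positive 1/B
      1/B-pos = ℚ.1/pos⇒pos B
    pos : 0ℚ < ε * 1/B
    pos = subst (_< ε * 1/B) (ℚ.*-zeroˡ 1/B) (ℚ.*-monoˡ-<-pos 1/B 0<ε)
    eq : ε * 1/B * B ≡ ε
    eq = trans (ℚ.*-assoc ε 1/B B)
           (trans (cong (ε *_) (ℚ.*-inverseˡ B)) (ℚ.*-identityʳ ε))

  ∣*∣-< : ∀ p q {δ B ε} → 0ℚ < B → δ * B ≡ ε → ∣ p ∣ < δ → ∣ q ∣ ≤ B → ∣ p * q ∣ < ε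
  ∣*∣-< p q {δ} {B} {ε} 0<B δB p< q≤ = begin-strict
    ∣ p * q ∣      ≡⟨ ℚ.∣p*q∣≡∣p∣*∣q∣ p q ⟩
    ∣ p ∣ * ∣ q ∣  ≤⟨ ℚ.*-monoˡ-≤-nonNeg ∣ p ∣ q≤ ⟩
    ∣ p ∣ * B      <⟨ ℚ.*-monoˡ-<-pos B p< ⟩
    δ * B          ≡⟨ δB ⟩
    ε              ∎
    where
    open ℚ.≤-Reasoning
    instance
      B-pos : ℚ.Positive B
      B-pos = ℚ.positive 0<B
      p-nn : ℚ.NonNegative ∣ p ∣
      p-nn = ℚ.∣-∣-nonNeg p

  bounded : (x : ℝ) → ∃[ B ] (0ℚ < B × Eventually (λ n → ∣ seq x n ∣ ≤ B))
  bounded x with cauchy x 1ℚ (ℚ.positive⁻¹ 1ℚ)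
  ... | N , close = ∣ xs N ∣ + 1ℚ , 0<B , N , bound
    where
    xs : ℕ → ℚ
    xs = seq x
    0<B : 0ℚ < ∣ xs N ∣ + 1ℚ
    0<B = ℚ.+-mono-≤-< (ℚ.0≤∣p∣ (xs N)) (ℚ.positive⁻¹ 1ℚ)
    lemma : ∀ n → xs N + (xs n - xs N) ≡ xs n
    lemma n = solve 2 (λ a b → a :+ (b :- a) := b) refl (xs N) (xs n)
      where open ℚ-Solver.+-*-Solver
    bound : ∀ n → N ℕ.≤ n → ∣ xs n ∣ ≤ ∣ xs N ∣ + 1ℚ
    bound n N≤n = subst (λ q → ∣ q ∣ ≤ ∣ xs N ∣ + 1ℚ) (lemma n)
      (ℚ.≤-trans (ℚ.∣p+q∣≤∣p∣+∣q∣ (xs N) (xs n - xs N))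
        (ℚ.+-monoʳ-≤ ∣ xs N ∣ (ℚ.<⇒≤ (close n N N≤n ℕ.≤-refl))))

  close-* : ∀ p q r s {ε A D α β} → 0ℚ < A → 0ℚ < D → α * D ≡ half ε → β * A ≡ half ε →
            ∣ p ∣ ≤ A → ∣ s ∣ ≤ D → ∣ p - q ∣ < α → ∣ r - s ∣ < β →
            ∣ p * r - q * s ∣ < ε
  close-* p q r s {ε} 0<A 0<D αD βA p≤ s≤ pq rs =
    subst (λ t → ∣ t ∣ < ε) lemma
      (∣+∣-< ((r - s) * p) ((p - q) * s) (∣*∣-< (r - s) p 0<A βA rs p≤) (∣*∣-< (p - q) s 0<D αD pq s≤))
    where
    open ℚ-Solver.+-*-Solver
    lemma : (r - s) * p + (p - q) * s ≡ p * r - q * s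
    lemma = solve 4 (λ p q r s → (r :- s) :* p :+ (p :- q) :* s := p :* r :- q :* s) refl p q r s

  infixr 4 _⊔≤_
  _⊔≤_ : ∀ {P Q R : Pred ℕ 0ℓ} → Eventually P × Eventually Q →
         (∀ n → P n → Q n → R n) → Eventually R
  ((M , p) , (N , q)) ⊔≤ f =
    M ℕ.⊔ N , λ n MN≤n → f n (p n (ℕ.m⊔n≤o⇒m≤o M N MN≤n)) (q n (ℕ.m⊔n≤o⇒n≤o M N MN≤n))

  ≡⇒≈ : ∀ {x y} → (∀ n → seq x n ≡ seq y n) → x ≈ᵣ y
  ≡⇒≈ {x} {y} eq = mk≈ λ ε 0<ε → 0 , λ n _ →
    subst (λ q → ∣ seq x n - q ∣ < ε) (eq n) (close-refl (seq x n) 0<ε)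

  fromℚ : ℚ → ℝ
  seq    (fromℚ q) _ = q
  cauchy (fromℚ q) ε 0<ε = 0 , λ _ _ _ _ → close-refl q 0<ε

  0ᵣ 1ᵣ : ℝ
  0ᵣ = fromℚ 0ℚ
  1ᵣ = fromℚ 1ℚ

  infixl 6 _+ᵣ_
  infixl 7 _*ᵣ_
  infix  8 -ᵣ_

  _+ᵣ_ : ℝ → ℝ → ℝ
  seq    (x +ᵣ y) n = seq x n + seq y n
  cauchy (x +ᵣ y) ε 0<ε =
    let M , p = cauchy x (half ε) (half-pos 0<ε)
        N , q = cauchy y (half ε) (half-pos 0<ε)
    in  M ℕ.⊔ N , λ m n a b →
        close-+ (seq x m) (seq x n) (seq y m) (seq y n)
          (p m n (ℕ.m⊔n≤o⇒m≤o M N a) (ℕ.m⊔n≤o⇒m≤o M N b))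
          (q m n (ℕ.m⊔n≤o⇒n≤o M N a) (ℕ.m⊔n≤o⇒n≤o M N b))

  -ᵣ_ : ℝ → ℝ
  seq    (-ᵣ x) n = - seq x n
  cauchy (-ᵣ x) ε 0<ε =
    let N , p = cauchy x ε 0<ε
    in  N , λ m n a b → close-neg (seq x m) (seq x n) (p m n a b)

  _*ᵣ_ : ℝ → ℝ → ℝ
  seq    (x *ᵣ y) n = seq x n * seq y n
  cauchy (x *ᵣ y) ε 0<ε =
    let A , 0<A , K , x≤ = bounded x
        D , 0<D , L , y≤ = bounded y
        α , 0<α , αD     = quotient (half ε) D (half-pos 0<ε) 0<D
        β , 0<β , βA     = quotient (half ε) A (half-pos 0<ε) 0<A
        M , p            = cauchy x α 0<α
        N , q            = cauchy y β 0<β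
    in  (K ℕ.⊔ L) ℕ.⊔ (M ℕ.⊔ N) , λ m n a b →
        close-* (seq x m) (seq x n) (seq y m) (seq y n) 0<A 0<D αD βA
          (x≤ m (ℕ.m⊔n≤o⇒m≤o K L (ℕ.m⊔n≤o⇒m≤o (K ℕ.⊔ L) (M ℕ.⊔ N) a)))
          (y≤ n (ℕ.m⊔n≤o⇒n≤o K L (ℕ.m⊔n≤o⇒m≤o (K ℕ.⊔ L) (M ℕ.⊔ N) b)))
          (p m n (ℕ.m⊔n≤o⇒m≤o M N (ℕ.m⊔n≤o⇒n≤o (K ℕ.⊔ L) (M ℕ.⊔ N) a)) (ℕ.m⊔n≤o⇒m≤o M N (ℕ.m⊔n≤o⇒n≤o (K ℕ.⊔ L) (M ℕ.⊔ N) b)))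
          (q m n (ℕ.m⊔n≤o⇒n≤o M N (ℕ.m⊔n≤o⇒n≤o (K ℕ.⊔ L) (M ℕ.⊔ N) a)) (ℕ.m⊔n≤o⇒n≤o M N (ℕ.m⊔n≤o⇒n≤o (K ℕ.⊔ L) (M ℕ.⊔ N) b)))

  ≈ᵣ-isEquivalence : IsEquivalence _≈ᵣ_
  ≈ᵣ-isEquivalence = record
    { refl  = ≡⇒≈ λ _ → refl
    ; sym   = λ {x} {y} x≈y → mk≈ λ ε 0<ε →
                let N , p = close x≈y ε 0<ε in N , λ n a → close-sym (seq x n) (seq y n) (p n a)
    ; trans = λ {x} {y} {z} x≈y y≈z → mk≈ λ ε 0<ε →
                (close x≈y (half ε) (half-pos 0<ε) , close y≈z (half ε) (half-pos 0<ε)) ⊔≤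
                λ n → close-trans (seq x n) (seq y n) (seq z n)
    }

  +ᵣ-cong : ∀ {x y u v} → x ≈ᵣ y → u ≈ᵣ v → (x +ᵣ u) ≈ᵣ (y +ᵣ v)
  +ᵣ-cong {x} {y} {u} {v} x≈y u≈v = mk≈ λ ε 0<ε →
    (close x≈y (half ε) (half-pos 0<ε) , close u≈v (half ε) (half-pos 0<ε)) ⊔≤
    λ n → close-+ (seq x n) (seq y n) (seq u n) (seq v n)

  -ᵣ-cong : ∀ {x y} → x ≈ᵣ y → (-ᵣ x) ≈ᵣ (-ᵣ y)
  -ᵣ-cong {x} {y} x≈y = mk≈ λ ε 0<ε →
    let N , p = close x≈y ε 0<ε in N , λ n a → close-neg (seq x n) (seq y n) (p n a)

  *ᵣ-cong : ∀ {x y u v} → x ≈ᵣ y → u ≈ᵣ v → (x *ᵣ u) ≈ᵣ (y *ᵣ v)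
  *ᵣ-cong {x} {y} {u} {v} x≈y u≈v = mk≈ go
    where
    go : ∀ ε → 0ℚ < ε → Eventually (λ n → ∣ seq x n * seq u n - seq y n * seq v n ∣ < ε)
    go ε 0<ε =
      let A , 0<A , x≤ = bounded x
          D , 0<D , v≤ = bounded v
          α , 0<α , αD = quotient (half ε) D (half-pos 0<ε) 0<D
          β , 0<β , βA = quotient (half ε) A (half-pos 0<ε) 0<A
      in  (((x≤ , v≤) ⊔≤ λ _ → _,_) , ((close x≈y α 0<α , close u≈v β 0<β) ⊔≤ λ _ → _,_)) ⊔≤
          λ n (p , q) (r , s) →
            close-* (seq x n) (seq y n) (seq u n) (seq v n) 0<A 0<D αD βA p q r s

  +ᵣ-assoc : ∀ x y z → (x +ᵣ y) +ᵣ z ≈ᵣ x +ᵣ (y +ᵣ z)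
  +ᵣ-assoc x y z = ≡⇒≈ λ n → ℚ.+-assoc (seq x n) (seq y n) (seq z n)

  +ᵣ-comm : ∀ x y → x +ᵣ y ≈ᵣ y +ᵣ x
  +ᵣ-comm x y = ≡⇒≈ λ n → ℚ.+-comm (seq x n) (seq y n)

  +ᵣ-identityˡ : ∀ x → 0ᵣ +ᵣ x ≈ᵣ x
  +ᵣ-identityˡ x = ≡⇒≈ λ n → ℚ.+-identityˡ (seq x n)

  +ᵣ-identityʳ : ∀ x → x +ᵣ 0ᵣ ≈ᵣ x
  +ᵣ-identityʳ x = ≡⇒≈ λ n → ℚ.+-identityʳ (seq x n)

  -ᵣ-inverseˡ : ∀ x → (-ᵣ x) +ᵣ x ≈ᵣ 0ᵣ
  -ᵣ-inverseˡ x = ≡⇒≈ λ n → ℚ.+-inverseˡ (seq x n)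

  -ᵣ-inverseʳ : ∀ x → x +ᵣ (-ᵣ x) ≈ᵣ 0ᵣ
  -ᵣ-inverseʳ x = ≡⇒≈ λ n → ℚ.+-inverseʳ (seq x n)

  *ᵣ-assoc : ∀ x y z → (x *ᵣ y) *ᵣ z ≈ᵣ x *ᵣ (y *ᵣ z)
  *ᵣ-assoc x y z = ≡⇒≈ λ n → ℚ.*-assoc (seq x n) (seq y n) (seq z n)

  *ᵣ-comm : ∀ x y → x *ᵣ y ≈ᵣ y *ᵣ x
  *ᵣ-comm x y = ≡⇒≈ λ n → ℚ.*-comm (seq x n) (seq y n)

  *ᵣ-identityˡ : ∀ x → 1ᵣ *ᵣ x ≈ᵣ x
  *ᵣ-identityˡ x = ≡⇒≈ λ n → ℚ.*-identityˡ (seq x n)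

  *ᵣ-identityʳ : ∀ x → x *ᵣ 1ᵣ ≈ᵣ x
  *ᵣ-identityʳ x = ≡⇒≈ λ n → ℚ.*-identityʳ (seq x n)

  *ᵣ-distribˡ-+ᵣ : ∀ x y z → x *ᵣ (y +ᵣ z) ≈ᵣ x *ᵣ y +ᵣ x *ᵣ z
  *ᵣ-distribˡ-+ᵣ x y z = ≡⇒≈ λ n → ℚ.*-distribˡ-+ (seq x n) (seq y n) (seq z n)

  *ᵣ-distribʳ-+ᵣ : ∀ x y z → (y +ᵣ z) *ᵣ x ≈ᵣ y *ᵣ x +ᵣ z *ᵣ x
  *ᵣ-distribʳ-+ᵣ x y z = ≡⇒≈ λ n → ℚ.*-distribʳ-+ (seq x n) (seq y n) (seq z n)

  ℝ-commutativeRing : CommutativeRing 0ℓ 0ℓ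
  ℝ-commutativeRing = record
    { Carrier = ℝ
    ; _≈_ = _≈ᵣ_
    ; _+_ = _+ᵣ_
    ; _*_ = _*ᵣ_
    ; -_ = -ᵣ_
    ; 0# = 0ᵣ
    ; 1# = 1ᵣ
    ; isCommutativeRing = record
      { isRing = record
        { +-isAbelianGroup = record
          { isGroup = record
            { isMonoid = record
              { isSemigroup = record
                { isMagma = record { isEquivalence = ≈ᵣ-isEquivalence ; ∙-cong = +ᵣ-cong }
                ; assoc = +ᵣ-assoc
                }
              ; identity = +ᵣ-identityˡ , +ᵣ-identityʳ
              }
            ; inverse = -ᵣ-inverseˡ , -ᵣ-inverseʳ
            ; ⁻¹-cong = -ᵣ-cong
            }
          ; comm = +ᵣ-comm
          }
        ; *-cong = *ᵣ-cong
        ; *-assoc = *ᵣ-assoc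
        ; *-identity = *ᵣ-identityˡ , *ᵣ-identityʳ
        ; distrib = *ᵣ-distribˡ-+ᵣ , *ᵣ-distribʳ-+ᵣ
        }
      ; *-comm = *ᵣ-comm
      }
    }

open Real public using (ℝ; _≤ᵣ_; ℝ-commutativeRing)

module Complexification {r ℓ} (R : CommutativeRing r ℓ) where

  open CommutativeRing R renaming (refl to ≈-refl; sym to ≈-sym; trans to ≈-trans)
  open import Algebra.Properties.Ring ring using (-0#≈0#; x[y-z]≈xy-xz; [y-z]x≈yx-zx)
  open import Algebra.Properties.AbelianGroup +-abelianGroup using (⁻¹-∙-comm)
  open import Algebra.Properties.CommutativeSemigroup +-commutativeSemigroup using (interchange)
  open import Relation.Binary.Reasoning.Setoid setoid

  infix 4 _≈ᶜ_
  infixl 6 _+ᶜ_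
  infixl 7 _*ᶜ_
  infix  8 -ᶜ_

  record Complex : Set r where
    constructor _+i_
    field
      re im : Carrier

  open Complex public

  _≈ᶜ_ : Rel Complex ℓ
  z ≈ᶜ w = re z ≈ re w × im z ≈ im w

  _+ᶜ_ _*ᶜ_ : Complex → Complex → Complex
  z +ᶜ w = (re z + re w) +i (im z + im w)
  z *ᶜ w = (re z * re w - im z * im w) +i (re z * im w + im z * re w)

  -ᶜ_ conj : Complex → Complex
  -ᶜ z = (- re z) +i (- im z)
  conj z = re z +i (- im z)

  0ᶜ 1ᶜ : Complex
  0ᶜ = 0# +i 0#
  1ᶜ = 1# +i 0#

  *ᶜ-comm : ∀ z w → z *ᶜ w ≈ᶜ w *ᶜ z
  *ᶜ-comm (a +i b) (c +i d) =
      +-cong (*-comm a c) (-‿cong (*-comm b d))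
    , ≈-trans (+-cong (*-comm a d) (*-comm b c)) (+-comm (d * a) (c * b))

  *ᶜ-identityˡ : ∀ z → 1ᶜ *ᶜ z ≈ᶜ z
  *ᶜ-identityˡ (a +i b) =
      ≈-trans (+-cong (*-identityˡ a) (≈-trans (-‿cong (zeroˡ b)) -0#≈0#)) (+-identityʳ a)
    , ≈-trans (+-cong (*-identityˡ b) (zeroˡ a)) (+-identityʳ b)

  *ᶜ-assoc : ∀ z w v → (z *ᶜ w) *ᶜ v ≈ᶜ z *ᶜ (w *ᶜ v)
  *ᶜ-assoc (a +i b) (c +i d) (e +i f) = re-assoc , im-assoc
    where
    rotate : ∀ p q s t → (p + q) + (s + t) ≈ (p + s) + (t + q)
    rotate p q s t = ≈-trans (interchange p q s t) (+-congˡ (+-comm q t))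

    re-assoc : (a * c - b * d) * e - (a * d + b * c) * f ≈ a * (c * e - d * f) - b * (c * f + d * e)
    re-assoc = begin
      (a * c - b * d) * e - (a * d + b * c) * f
        ≈⟨ +-cong ([y-z]x≈yx-zx e (a * c) (b * d)) (-‿cong (distribʳ f (a * d) (b * c))) ⟩
      (a * c * e - b * d * e) - (a * d * f + b * c * f)
        ≈⟨ +-congˡ (⁻¹-∙-comm _ _) ⟨
      (a * c * e - b * d * e) + (- (a * d * f) - b * c * f)
        ≈⟨ rotate _ _ _ _ ⟩
      (a * c * e - a * d * f) + (- (b * c * f) - b * d * e)
        ≈⟨ +-cong (+-cong (*-assoc a c e) (-‿cong (*-assoc a d f)))
                  (+-cong (-‿cong (*-assoc b c f)) (-‿cong (*-assoc b d e))) ⟩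
      (a * (c * e) - a * (d * f)) + (- (b * (c * f)) - b * (d * e))
        ≈⟨ +-cong (≈-sym (x[y-z]≈xy-xz a (c * e) (d * f))) (⁻¹-∙-comm _ _) ⟩
      a * (c * e - d * f) - (b * (c * f) + b * (d * e))
        ≈⟨ +-congˡ (-‿cong (distribˡ b (c * f) (d * e))) ⟨
      a * (c * e - d * f) - b * (c * f + d * e) ∎

    im-assoc : (a * c - b * d) * f + (a * d + b * c) * e ≈ a * (c * f + d * e) + b * (c * e - d * f)
    im-assoc = begin
      (a * c - b * d) * f + (a * d + b * c) * e
        ≈⟨ +-cong ([y-z]x≈yx-zx f (a * c) (b * d)) (distribʳ e (a * d) (b * c)) ⟩
      (a * c * f - b * d * f) + (a * d * e + b * c * e)
        ≈⟨ rotate _ _ _ _ ⟩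
      (a * c * f + a * d * e) + (b * c * e - b * d * f)
        ≈⟨ +-cong (+-cong (*-assoc a c f) (*-assoc a d e))
                  (+-cong (*-assoc b c e) (-‿cong (*-assoc b d f))) ⟩
      (a * (c * f) + a * (d * e)) + (b * (c * e) - b * (d * f))
        ≈⟨ +-cong (distribˡ a (c * f) (d * e)) (x[y-z]≈xy-xz b (c * e) (d * f)) ⟨
      a * (c * f + d * e) + b * (c * e - d * f) ∎

  *ᶜ-distribˡ : ∀ z w v → z *ᶜ (w +ᶜ v) ≈ᶜ z *ᶜ w +ᶜ z *ᶜ v
  *ᶜ-distribˡ (a +i b) (c +i d) (e +i f) =
      ≈-trans (+-cong (distribˡ a c e) (≈-trans (-‿cong (distribˡ b d f)) (≈-sym (⁻¹-∙-comm _ _))))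
              (interchange _ _ _ _)
    , ≈-trans (+-cong (distribˡ a d f) (distribˡ b c e)) (interchange _ _ _ _)

  +ᶜ-cong : ∀ {z z′ w w′} → z ≈ᶜ z′ → w ≈ᶜ w′ → z +ᶜ w ≈ᶜ z′ +ᶜ w′
  +ᶜ-cong (p , q) (s , t) = +-cong p s , +-cong q t

  *ᶜ-cong : ∀ {z z′ w w′} → z ≈ᶜ z′ → w ≈ᶜ w′ → z *ᶜ w ≈ᶜ z′ *ᶜ w′
  *ᶜ-cong (p , q) (s , t) =
    +-cong (*-cong p s) (-‿cong (*-cong q t)) , +-cong (*-cong p t) (*-cong q s)

  ≈ᶜ-isEquivalence : IsEquivalence _≈ᶜ_
  ≈ᶜ-isEquivalence = record
    { refl  = ≈-refl , ≈-refl
    ; sym   = λ (p , q) → ≈-sym p , ≈-sym q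
    ; trans = λ (p , q) (s , t) → ≈-trans p s , ≈-trans q t
    }

  open IsEquivalence ≈ᶜ-isEquivalence using () renaming (trans to ≈ᶜ-trans)

  complexRing : CommutativeRing r ℓ
  complexRing = record
    { Carrier = Complex
    ; _≈_ = _≈ᶜ_
    ; _+_ = _+ᶜ_
    ; _*_ = _*ᶜ_
    ; -_ = -ᶜ_
    ; 0# = 0ᶜ
    ; 1# = 1ᶜ
    ; isCommutativeRing = record
      { isRing = record
        { +-isAbelianGroup = record
          { isGroup = record
            { isMonoid = record
              { isSemigroup = record
                { isMagma = record { isEquivalence = ≈ᶜ-isEquivalence ; ∙-cong = +ᶜ-cong }
                ; assoc = λ z w v → +-assoc (re z) (re w) (re v) , +-assoc (im z) (im w) (im v)
                }
              ; identity = (λ z → +-identityˡ (re z) , +-identityˡ (im z))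
                         , (λ z → +-identityʳ (re z) , +-identityʳ (im z))
              }
            ; inverse = (λ z → -‿inverseˡ (re z) , -‿inverseˡ (im z))
                      , (λ z → -‿inverseʳ (re z) , -‿inverseʳ (im z))
            ; ⁻¹-cong = λ (p , q) → -‿cong p , -‿cong q
            }
          ; comm = λ z w → +-comm (re z) (re w) , +-comm (im z) (im w)
          }
        ; *-cong = *ᶜ-cong
        ; *-assoc = *ᶜ-assoc
        ; *-identity = *ᶜ-identityˡ , λ z → ≈ᶜ-trans (*ᶜ-comm z 1ᶜ) (*ᶜ-identityˡ z)
        ; distrib = *ᶜ-distribˡ
                  , λ z w v → ≈ᶜ-trans (*ᶜ-comm (w +ᶜ v) z)
                      (≈ᶜ-trans (*ᶜ-distribˡ z w v) (+ᶜ-cong (*ᶜ-comm z w) (*ᶜ-comm z v)))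
        }
      ; *-comm = *ᶜ-comm
      }
    }

open Complexification ℝ-commutativeRing public using (conj) renaming (Complex to ℂ; complexRing to ℂ-commutativeRing)

module Matrices {r ℓ} (R : CommutativeRing r ℓ) where

  open CommutativeRing R using (Carrier; _≈_; _+_; _*_; _-_; -_; 0#; 1#; semiring; *-commutativeMonoid)
  open import Algebra.Properties.Semiring.Sum semiring using (sum-syntax)
  open import Algebra.Properties.Semiring.Exp semiring using (_^_)
  open import Algebra.Properties.CommutativeMonoid.Sum *-commutativeMonoid using () renaming (sum to product)

  Matrix : ℕ → ℕ → Set r
  Matrix m n = Vector (Vector Carrier n) m

  infix  4 _≈ₘ_
  infixl 6 _-ₘ_
  infixl 7 _*ₘ_ _∙ₘ_

  _≈ₘ_ : ∀ {m n} → Rel (Matrix m n) ℓ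
  M ≈ₘ N = ∀ i j → M i j ≈ N i j

  0ₘ : ∀ {m n} → Matrix m n
  0ₘ _ _ = 0#

  1ₘ : ∀ {n} → Matrix n n
  1ₘ i j = if does (i Fin.≟ j) then 1# else 0#

  _-ₘ_ : ∀ {m n} → Matrix m n → Matrix m n → Matrix m n
  (M -ₘ N) i j = M i j - N i j

  _∙ₘ_ : ∀ {m n} → Carrier → Matrix m n → Matrix m n
  (x ∙ₘ M) i j = x * M i j

  _*ₘ_ : ∀ {l m n} → Matrix l m → Matrix m n → Matrix l n
  _*ₘ_ {m = m} M N i k = ∑[ j < m ] (M i j * N j k)

  sumₘ : ∀ {m n c} → Vector (Matrix m n) c → Matrix m n
  sumₘ {c = c} Ms i j = ∑[ k < c ] Ms k i j

  -- Laplace expansion along the first row.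
  det : ∀ {n} → Matrix n n → Carrier
  det {zero}  M = 1#
  det {suc n} M = ∑[ j < suc n ] (((- 1#) ^ toℕ j * M zero j) * det (λ i → removeAt (M (suc i)) j))

  charPoly : ∀ {n} → Matrix n n → Carrier → Carrier
  charPoly M x = det (x ∙ₘ 1ₘ -ₘ M)

  -- λs lists the roots of the characteristic polynomial with multiplicity.
  -- Both sides are compared as functions of x, which over an infinite field
  -- is the same as comparing coefficients.
  IsEigenvalueList : ∀ {n} → Matrix n n → Vector Carrier n → Set (r ⊔ ℓ)
  IsEigenvalueList M λs = ∀ x → charPoly M x ≈ product (λ i → x - λs i)

module ℝ-Matrices = Matrices ℝ-commutativeRing
module ℂ-Matrices = Matrices ℂ-commutativeRing

record SimpleGraph (n : ℕ) : Set₁ where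
  field
    Adj         : Rel (Fin n) 0ℓ
    symmetric   : Symmetric Adj
    irreflexive : Irreflexive _≡_ Adj
    adj?        : Decidable Adj

-- Non-emptiness of the vertex set is not included.
Connected : ∀ {n} → SimpleGraph n → Set
Connected G = ∀ v w → Star Adj v w
  where open SimpleGraph G

adjacencyMatrix : ∀ {n} → SimpleGraph n → ℝ-Matrices.Matrix n n
adjacencyMatrix G v w = if does (adj? v w) then 1# else 0#
  where
  open SimpleGraph G
  open CommutativeRing ℝ-commutativeRing using (0#; 1#)

-- μ zero is the largest eigenvalue μ₁.
IsSpectrum : ∀ {n} → ℝ-Matrices.Matrix n n → Vector ℝ n → Set
IsSpectrum A μ = ℝ-Matrices.IsEigenvalueList A μ × (∀ i j → i Fin.≤ j → μ j ≤ᵣ μ i)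

ascending : ∀ {n} → Vector ℝ n → Vector ℝ n
ascending μ i = μ (opposite i)

-- k is at most the number n = suc m of eigenvalues, so that the sum of the
-- k smallest ones makes sense.
SpectralCondition : ∀ {m} → Vector ℝ (suc m) → Pred ℕ 0ℓ
SpectralCondition {m} μ k =
  Σ[ k≤n ∈ k ℕ.≤ suc m ] μ zero + ∑[ i < k ] ascending μ (inject≤ i k≤n) ≤ᵣ 0#
  where
  open CommutativeRing ℝ-commutativeRing using (_+_; 0#; semiring)
  open import Algebra.Properties.Semiring.Sum semiring using (sum-syntax)

_† : ∀ {m n} → ℂ-Matrices.Matrix m n → ℂ-Matrices.Matrix n m
(M †) i j = conj (M j i)

record IsOrthogonalProjector {d} (P : ℂ-Matrices.Matrix d d) : Set where
  open ℂ-Matrices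
  field
    idempotent : P *ₘ P ≈ₘ P
    hermitian  : P † ≈ₘ P

record QuantumColoring {n} (G : SimpleGraph n) (c d : ℕ) : Set where
  open ℂ-Matrices
  open SimpleGraph G
  field
    P          : Fin n → Fin c → Matrix d d
    projector  : ∀ v k → IsOrthogonalProjector (P v k)
    complete   : ∀ v → sumₘ (P v) ≈ₘ 1ₘ
    orthogonal : ∀ {v w} → Adj v w → ∀ k → P v k *ₘ P w k ≈ₘ 0ₘ

QuantumColorable : ∀ {n} → SimpleGraph n → Pred ℕ 0ℓ
QuantumColorable G c = ∃[ d ] (0 ℕ.< d × QuantumColoring G c d)

IsQuantumChromaticNumber : ∀ {n} → SimpleGraph n → Pred ℕ 0ℓ
IsQuantumChromaticNumber G = IsLeast (QuantumColorable G)

{-# OPTIONS --safe #-}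

-- For a c-colouring put D k = ∑ᵥ eᵥeᵥᵀ ⊗ P v k. The D k are orthogonal projections
-- with sum I, and D k (A ⊗ I) D k = 0 because adjacent vertices have orthogonal
-- projectors of the same colour. Let x be an eigenvector for μ₁ and let W be the
-- sum over k of the spaces D k (x ⊗ Cᵈ). Then A ⊗ I has trace 0 on W; dim W ≤ c d;
-- and W contains x ⊗ Cᵈ, which contributes d μ₁ to the trace. On the rest of W,
-- of dimension at most (c − 1) d, the trace is a combination of the remaining
-- eigenvalues with weights in [0, d] and total weight at most (c − 1) d, so it is
-- at least d times the sum of the q smallest eigenvalues for some q ≤ c − 1.
-- Hence μ₁ + (sum of the q smallest) ≤ 0 and κ ≤ q ≤ c − 1.
--
-- The inequality κ ≤ c − 1 is decidable and ≤ᵣ is stable under double negation,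
-- so one may argue in the double negation monad, where ℝ is a discrete totally
-- ordered field.

module Submission where

open import Defs
open import Data.Nat.Base using (ℕ; suc)
open import Data.Vec.Functional as Vector using (Vector; removeAt; insertAt)
open import Level using (0ℓ; _⊔_)
open import Algebra.Bundles using (CommutativeRing)
open import Algebra.Solver.Ring.AlmostCommutativeRing using (fromCommutativeRing; _-Raw-AlmostCommutative⟶_)
open import Data.Fin.Base as Fin
  using (Fin; zero; suc; toℕ; punchIn; punchOut; inject≤; opposite; fromℕ<; splitAt; join; _↑ˡ_; _↑ʳ_)
import Data.Fin.Permutation as Perm
import Data.Fin.Properties as Fin
open import Data.Integer.Base as ℤ using (ℤ; -[1+_])
import Data.Integer.Properties as ℤ
open import Data.Maybe.Base using (Maybe; map)
open import Data.Nat.Base as ℕ using (zero; s≤s⁻¹)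
import Data.Nat.Properties as ℕ
open import Data.Product.Base using (_,_; _×_; proj₁; proj₂; Σ-syntax; ∃-syntax)
open import Data.Rational.Base as ℚ using (ℚ; 0ℚ; 1ℚ)
import Data.Rational.Properties as ℚ
import Data.Rational.Solver as ℚ-Solver
import Data.Sign.Base as Sign
open import Data.Sum.Base as Sum using (_⊎_; inj₁; inj₂; [_,_]′)
open import Data.Unit.Polymorphic.Base using (⊤; tt)
import Data.Vec.Functional.Properties as VectorProperties
open import Function.Base using (_∘_)
open import Relation.Binary.Core using (Rel)
open import Relation.Binary.PropositionalEquality as ≡ using (_≡_; _≢_; _≗_)
open import Relation.Nullary.Decidable.Core using (yes; no; decidable-stable; dec⇒maybe)
open import Relation.Nullary.Negation.Core using (¬_; contradiction)

-- The spectrum is given only as a factorisation of the characteristic polynomial, read as a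
-- function, so an orthogonal eigenbasis has to be extracted from it. A listed root makes a
-- determinant vanish, a vanishing determinant yields a kernel vector, and the orthogonal complement
-- inherits the remaining roots. This last step divides by `x - μ₁`, which says nothing at `x = μ₁`
-- itself; hence the work with polynomial functions. Bases are orthogonal rather than orthonormal
-- and carry inverse squared norms as weights, which avoids square roots. The order arguments need a
-- real field, so each complex projector becomes a real symmetric one of twice the size. The
-- dimension is a common factor of both sides of the final inequality and cancels. The number `q`
-- can fall short of `c - 1`: once the next eigenvalue in ascending order is nonnegative, placing
-- weight on it no longer lowers the sum. If `c - 1` exceeds `n` there are not that many
-- eigenvalues, but then `κ ≤ n` already gives the bound.

-- Normalisation of ring identities with integer coefficients.

module IntegerSolver {r ℓ} (R : CommutativeRing r ℓ) where
  open CommutativeRing R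
  open import Algebra.Properties.Ring ring using (-0#≈0#; -‿distribˡ-*; -‿distribʳ-*; -‿involutive)
  open import Algebra.Properties.AbelianGroup +-abelianGroup using (⁻¹-∙-comm)
  open import Algebra.Properties.Semiring.Mult.TCOptimised semiring using (×-homo-+; ×1-homo-*; 1+×) renaming (_×_ to _·_)
  open import Relation.Binary.Reasoning.Setoid setoid

  fromℕ : ℕ → Carrier
  fromℕ n = n · 1#

  fromℤ : ℤ → Carrier
  fromℤ (ℤ.+ n)  = fromℕ n
  fromℤ -[1+ n ] = - fromℕ (suc n)

  fromℤ-⊖ : ∀ m n → fromℤ (m ℤ.⊖ n) ≈ fromℕ m - fromℕ n
  fromℤ-⊖ m zero = sym (trans (+-congˡ -0#≈0#) (+-identityʳ _))
  fromℤ-⊖ zero (suc n) = sym (+-identityˡ _)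
  fromℤ-⊖ (suc m) (suc n) = begin
    fromℤ (suc m ℤ.⊖ suc n)                   ≡⟨ ≡.cong fromℤ (ℤ.[1+m]⊖[1+n]≡m⊖n m n) ⟩
    fromℤ (m ℤ.⊖ n)                           ≈⟨ fromℤ-⊖ m n ⟩
    fromℕ m - fromℕ n                         ≈⟨ +-congʳ (+-identityʳ _) ⟨
    fromℕ m + 0# - fromℕ n                    ≈⟨ +-congʳ (+-congˡ (-‿inverseʳ 1#)) ⟨
    fromℕ m + (1# - 1#) - fromℕ n             ≈⟨ +-congʳ (+-assoc _ _ _) ⟨
    fromℕ m + 1# - 1# - fromℕ n               ≈⟨ +-assoc _ _ _ ⟩
    fromℕ m + 1# + (- 1# - fromℕ n)           ≈⟨ +-cong (trans (+-comm _ _) (sym (1+× m 1#))) (⁻¹-∙-comm _ _) ⟩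
    fromℕ (suc m) - (1# + fromℕ n)            ≈⟨ +-congˡ (-‿cong (1+× n 1#)) ⟨
    fromℕ (suc m) - fromℕ (suc n)             ∎

  fromℤ-+ : ∀ i j → fromℤ (i ℤ.+ j) ≈ fromℤ i + fromℤ j
  fromℤ-+ (ℤ.+ m)  (ℤ.+ n)  = ×-homo-+ 1# m n
  fromℤ-+ (ℤ.+ m)  -[1+ n ] = fromℤ-⊖ m (suc n)
  fromℤ-+ -[1+ m ] (ℤ.+ n)  = trans (fromℤ-⊖ n (suc m)) (+-comm _ _)
  fromℤ-+ -[1+ m ] -[1+ n ] = begin
    - fromℕ (suc (suc (m ℕ.+ n)))     ≡⟨ ≡.cong (λ k → - fromℕ (suc k)) (ℕ.+-suc m n) ⟨
    - fromℕ (suc m ℕ.+ suc n)         ≈⟨ -‿cong (×-homo-+ 1# (suc m) (suc n)) ⟩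
    - (fromℕ (suc m) + fromℕ (suc n)) ≈⟨ ⁻¹-∙-comm _ _ ⟨
    - fromℕ (suc m) - fromℕ (suc n)   ∎

  fromℤ-neg : ∀ i → fromℤ (ℤ.- i) ≈ - fromℤ i
  fromℤ-neg (ℤ.+ zero)    = sym -0#≈0#
  fromℤ-neg (ℤ.+ (suc n)) = refl
  fromℤ-neg -[1+ n ]      = sym (-‿involutive _)

  fromℤ-* : ∀ i j → fromℤ (i ℤ.* j) ≈ fromℤ i * fromℤ j
  fromℤ-* (ℤ.+ m) (ℤ.+ n) = trans (reflexive (≡.cong fromℤ (ℤ.+◃n≡+n (m ℕ.* n)))) (×1-homo-* m n)
  fromℤ-* (ℤ.+ m) -[1+ n ] = begin
    fromℤ (Sign.- ℤ.◃ m ℕ.* suc n)    ≡⟨ ≡.cong fromℤ (ℤ.-◃n≡-n (m ℕ.* suc n)) ⟩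
    fromℤ (ℤ.- (ℤ.+ (m ℕ.* suc n)))   ≈⟨ fromℤ-neg (ℤ.+ (m ℕ.* suc n)) ⟩
    - fromℕ (m ℕ.* suc n)             ≈⟨ -‿cong (×1-homo-* m (suc n)) ⟩
    - (fromℕ m * fromℕ (suc n))       ≈⟨ -‿distribʳ-* _ _ ⟩
    fromℕ m * - fromℕ (suc n)         ∎
  fromℤ-* -[1+ m ] (ℤ.+ n) = begin
    fromℤ (Sign.- ℤ.◃ suc m ℕ.* n)    ≡⟨ ≡.cong fromℤ (ℤ.-◃n≡-n (suc m ℕ.* n)) ⟩
    fromℤ (ℤ.- (ℤ.+ (suc m ℕ.* n)))   ≈⟨ fromℤ-neg (ℤ.+ (suc m ℕ.* n)) ⟩
    - fromℕ (suc m ℕ.* n)             ≈⟨ -‿cong (×1-homo-* (suc m) n) ⟩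
    - (fromℕ (suc m) * fromℕ n)       ≈⟨ -‿distribˡ-* _ _ ⟩
    - fromℕ (suc m) * fromℕ n         ∎
  fromℤ-* -[1+ m ] -[1+ n ] = begin
    fromℕ (suc m ℕ.* suc n)           ≈⟨ ×1-homo-* (suc m) (suc n) ⟩
    fromℕ (suc m) * fromℕ (suc n)     ≈⟨ -‿involutive _ ⟨
    - - (fromℕ (suc m) * fromℕ (suc n)) ≈⟨ -‿cong (-‿distribˡ-* _ _) ⟩
    - (- fromℕ (suc m) * fromℕ (suc n)) ≈⟨ -‿distribʳ-* _ _ ⟩
    - fromℕ (suc m) * - fromℕ (suc n) ∎

  fromℤ-homomorphism : ℤ.+-*-rawRing -Raw-AlmostCommutative⟶ fromCommutativeRing R
  fromℤ-homomorphism = record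
    { ⟦_⟧ = fromℤ ; +-homo = fromℤ-+ ; *-homo = fromℤ-* ; -‿homo = fromℤ-neg ; 0-homo = refl ; 1-homo = refl }

  -- To cancel terms the solver must recognise equal coefficients. With integer coefficients this is
  -- decidable even where equality in `R` is not.
  fromℤ-≟ : ∀ i j → Maybe (fromℤ i ≈ fromℤ j)
  fromℤ-≟ i j = map (λ eq → reflexive (≡.cong fromℤ eq)) (dec⇒maybe (i ℤ.≟ j))

  open import Algebra.Solver.Ring ℤ.+-*-rawRing (fromCommutativeRing R) fromℤ-homomorphism fromℤ-≟ public
    using (solve; _:=_; _:+_; _:*_; _:-_; :-_; con)

punchIn-cases : ∀ {p n} {P : Fin (suc n) → Set p} (j : Fin (suc n)) →
                P j → (∀ i → P (punchIn j i)) → ∀ k → P k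
punchIn-cases {P = P} j pj pi k with j Fin.≟ k
... | yes j≡k = ≡.subst P j≡k pj
... | no  j≢k = ≡.subst P (Fin.punchIn-punchOut j≢k) (pi (punchOut j≢k))

-- Finite sums and entries of the identity matrix.

module Sums {r ℓ} (R : CommutativeRing r ℓ) where
  open CommutativeRing R hiding (zero)
  open Matrices R using (1ₘ)
  open import Algebra.Properties.Semiring.Sum semiring public
  open import Relation.Binary.Reasoning.Setoid setoid
  open import Algebra.Properties.Ring ring using (-0#≈0#)
  open import Algebra.Properties.AbelianGroup +-abelianGroup using (⁻¹-∙-comm)

  ∑-cong : ∀ {n} {f g : Vector Carrier n} → (∀ i → f i ≈ g i) → ∑[ i < n ] f i ≈ ∑[ i < n ] g i
  ∑-cong = sum-cong-≋

  ∑-0 : ∀ {n} {f : Vector Carrier n} → (∀ i → f i ≈ 0#) → ∑[ i < n ] f i ≈ 0#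
  ∑-0 {n} f≈0 = trans (∑-cong f≈0) (sum-replicate-zero n)

  ∑-neg : ∀ {n} (f : Vector Carrier n) → ∑[ i < n ] (- f i) ≈ - (∑[ i < n ] f i)
  ∑-neg {zero}  f = sym -0#≈0#
  ∑-neg {suc n} f = trans (+-congˡ (∑-neg (f ∘ suc))) (⁻¹-∙-comm _ _)

  1ₘ-diagonal : ∀ {n} (i : Fin n) → 1ₘ i i ≈ 1#
  1ₘ-diagonal i with i Fin.≟ i
  ... | yes _   = refl
  ... | no  i≢i = contradiction ≡.refl i≢i

  1ₘ-off-diagonal : ∀ {n} {i j : Fin n} → i ≢ j → 1ₘ i j ≈ 0#
  1ₘ-off-diagonal {i = i} {j} i≢j with i Fin.≟ j
  ... | yes i≡j = contradiction i≡j i≢j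
  ... | no  _   = refl

  1ₘ-sym : ∀ {n} (i j : Fin n) → 1ₘ i j ≈ 1ₘ j i
  1ₘ-sym i j with i Fin.≟ j
  ... | yes ≡.refl = sym (1ₘ-diagonal i)
  ... | no  i≢j    = sym (1ₘ-off-diagonal (i≢j ∘ ≡.sym))

  1ₘ-punchIn : ∀ {n} (k : Fin (suc n)) (i j : Fin n) → 1ₘ (punchIn k i) (punchIn k j) ≈ 1ₘ i j
  1ₘ-punchIn k i j with i Fin.≟ j
  ... | yes ≡.refl = 1ₘ-diagonal (punchIn k i)
  ... | no  i≢j    = 1ₘ-off-diagonal (i≢j ∘ Fin.punchIn-injective k i j)

  ∑-1ₘʳ : ∀ {n} (f : Vector Carrier n) k → ∑[ j < n ] (f j * 1ₘ j k) ≈ f k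
  ∑-1ₘʳ {suc n} f zero =
    trans (+-cong (*-identityʳ _) (∑-0 λ j → zeroʳ (f (suc j)))) (+-identityʳ _)
  ∑-1ₘʳ {suc n} f (suc k) =
    trans (+-cong (zeroʳ _) (∑-1ₘʳ (f ∘ suc) k)) (+-identityˡ _)

  ∑-1ₘˡ : ∀ {n} (f : Vector Carrier n) k → ∑[ j < n ] (1ₘ k j * f j) ≈ f k
  ∑-1ₘˡ f k = trans (∑-cong λ j → trans (*-comm _ _) (*-congˡ (1ₘ-sym k j))) (∑-1ₘʳ f k)

-- Determinants: alternating forms, their uniqueness, and multiplicativity.

module Determinant {r ℓ} (R : CommutativeRing r ℓ) where
  open Vector using (_∷_)
  open CommutativeRing R hiding (zero)
  open Matrices R
  open Sums R
  open IntegerSolver R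
  open import Algebra.Properties.Semiring.Exp semiring using (_^_)
  open import Relation.Binary.Reasoning.Setoid setoid

  Congruent : ∀ {m n} → (Matrix m n → Carrier) → Set (r ⊔ ℓ)
  Congruent F = ∀ M N → M ≈ₘ N → F M ≈ F N

  HeadLinear : ∀ {m n} → (Matrix (suc m) n → Carrier) → Set (r ⊔ ℓ)
  HeadLinear F = ∀ a v w M → F ((λ j → a * v j + w j) ∷ M) ≈ a * F (v ∷ M) + F (w ∷ M)

  HeadAlternating : ∀ {m n} → (Matrix (suc m) n → Carrier) → Set (r ⊔ ℓ)
  HeadAlternating {zero}  F = ⊤
  HeadAlternating {suc m} F = ∀ v M → F (v ∷ v ∷ M) ≈ 0#

  -- Multilinear in the rows, and zero when two adjacent rows agree.
  data Alternating {n} : ∀ {m} → (Matrix m n → Carrier) → Set (r ⊔ ℓ) where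
    nullary : {F : Matrix 0 n → Carrier} → Congruent F → Alternating F
    step    : ∀ {m} {F : Matrix (suc m) n → Carrier} → Congruent F → HeadLinear F → HeadAlternating F →
              (∀ v → Alternating (λ M → F (v ∷ M))) → Alternating F

  ∷-cong : ∀ {m n} {v w : Vector Carrier n} {M N : Matrix m n} →
           (∀ j → v j ≈ w j) → M ≈ₘ N → (v ∷ M) ≈ₘ (w ∷ N)
  ∷-cong v≈w M≈N zero    = v≈w
  ∷-cong v≈w M≈N (suc i) = M≈N i

  ∷-η : ∀ {m n} (M : Matrix (suc m) n) → M ≈ₘ (M zero ∷ M ∘ suc)
  ∷-η M zero    j = refl
  ∷-η M (suc i) j = refl

  congruent : ∀ {m n} {F : Matrix m n → Carrier} → Alternating F → Congruent F
  congruent (nullary cong)    = cong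
  congruent (step cong _ _ _) = cong

  alternating-≈ : ∀ {m n} {F G : Matrix m n → Carrier} → (∀ M → F M ≈ G M) → Alternating F → Alternating G
  alternating-≈ F≈G (nullary cong) = nullary λ M N M≈N → trans (sym (F≈G M)) (trans (cong M N M≈N) (F≈G N))
  alternating-≈ {suc m} {F = F} {G} F≈G (step cong lin alt rest) =
    step (λ M N M≈N → trans (sym (F≈G M)) (trans (cong M N M≈N) (F≈G N)))
         (λ a v w M → trans (sym (F≈G _)) (trans (lin a v w M) (+-cong (*-congˡ (F≈G _)) (F≈G _))))
         (head m F≈G alt)
         (λ v → alternating-≈ (λ M → F≈G (v ∷ M)) (rest v))
    where
    head : ∀ m {F G : Matrix (suc m) _ → Carrier} → (∀ M → F M ≈ G M) → HeadAlternating F → HeadAlternating G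
    head zero    _   _   = tt
    head (suc m) F≈G alt = λ v M → trans (sym (F≈G _)) (alt v M)

  alternating-∑ : ∀ {k m n} (c : Vector Carrier k) (F : Fin k → Matrix m n → Carrier) →
                  (∀ j → Alternating (F j)) → Alternating (λ M → ∑[ j < k ] (c j * F j M))
  alternating-∑ {m = zero} c F alt = nullary λ M N M≈N → ∑-cong λ j → *-congˡ (congruent (alt j) M N M≈N)
  alternating-∑ {k} {suc m} {n} c F alt =
    step (λ M N M≈N → ∑-cong λ j → *-congˡ (congruent (alt j) M N M≈N))
         linear
         (head m F alt)
         (λ v → alternating-∑ c (λ j M → F j (v ∷ M)) (λ j → rest (alt j) v))
    where
    rest : ∀ {m} {F : Matrix (suc m) n → Carrier} → Alternating F → ∀ v → Alternating (λ M → F (v ∷ M))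
    rest (step _ _ _ r) = r
    lin : ∀ {m} {F : Matrix (suc m) n → Carrier} → Alternating F → HeadLinear F
    lin (step _ l _ _) = l
    linear : HeadLinear (λ M → ∑[ j < k ] (c j * F j M))
    linear a v w M = begin
      ∑[ j < k ] (c j * F j ((λ i → a * v i + w i) ∷ M))
        ≈⟨ ∑-cong (λ j → trans (*-congˡ (lin (alt j) a v w M))
             (solve 4 (λ a c x y → c :* (a :* x :+ y) := a :* (c :* x) :+ c :* y) refl a (c j) _ _)) ⟩
      ∑[ j < k ] (a * (c j * F j (v ∷ M)) + c j * F j (w ∷ M))
        ≈⟨ ∑-distrib-+ (λ j → a * (c j * F j (v ∷ M))) (λ j → c j * F j (w ∷ M)) ⟩
      ∑[ j < k ] (a * (c j * F j (v ∷ M))) + ∑[ j < k ] (c j * F j (w ∷ M))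
        ≈⟨ +-congʳ (sym (*-distribˡ-sum a (λ j → c j * F j (v ∷ M)))) ⟩
      a * (∑[ j < k ] (c j * F j (v ∷ M))) + ∑[ j < k ] (c j * F j (w ∷ M)) ∎
    head : ∀ m (F : Fin k → Matrix (suc m) n → Carrier) → (∀ j → Alternating (F j)) →
           HeadAlternating (λ M → ∑[ j < k ] (c j * F j M))
    head zero    F alt = tt
    head (suc m) F alt v M = ∑-0 λ j → trans (*-congˡ (zeroOn (alt j))) (zeroʳ _)
      where
      zeroOn : ∀ {F} → Alternating F → F (v ∷ v ∷ M) ≈ 0#
      zeroOn (step _ _ a _) = a v M

  record Linear {m n} (L : Vector Carrier m → Vector Carrier n) : Set (r ⊔ ℓ) where
    field
      resp   : ∀ {v w} → (∀ j → v j ≈ w j) → ∀ j → L v j ≈ L w j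
      linear : ∀ a v w j → L (λ j → a * v j + w j) j ≈ a * L v j + L w j

  -- Applied to three maps of rows: deletion of a column in the Laplace expansion, insertion of a
  -- zero column in the uniqueness proof, and right multiplication by a matrix.
  alternating-∘ : ∀ {k m n} {L : Vector Carrier m → Vector Carrier n} → Linear L →
                  {F : Matrix k n → Carrier} → Alternating F → Alternating (λ M → F (λ i → L (M i)))
  alternating-∘ lin (nullary cong) = nullary λ M N M≈N → cong _ _ λ i → Linear.resp lin (M≈N i)
  alternating-∘ {suc k} {m} {n} {L} lin {F} (step cong hlin alt rest) =
    step (λ M N M≈N → cong _ _ λ i → Linear.resp lin (M≈N i))
         (λ a v w M → trans
           (trans (cong _ _ (λ { zero → Linear.linear lin a v w ; (suc i) j → refl }))
             (hlin a (L v) (L w) (λ i → L (M i))))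
           (+-cong (*-congˡ (sym (push v M))) (sym (push w M))))
         (head k cong alt)
         (λ v → alternating-≈ (λ M → sym (push v M)) (alternating-∘ lin (rest (L v))))
    where
    push : ∀ v M → F (λ i → L ((v ∷ M) i)) ≈ F (L v ∷ λ i → L (M i))
    push v M = cong _ _ λ { zero j → refl ; (suc i) j → refl }
    head : ∀ k {F : Matrix (suc k) n → Carrier} → Congruent F → HeadAlternating F →
           HeadAlternating {n = m} (λ M → F (λ i → L (M i)))
    head zero    cong alt = tt
    head (suc k) cong alt v M =
      trans (cong _ _ λ { zero j → refl ; (suc zero) j → refl ; (suc (suc i)) j → refl })
            (alt (L v) (λ i → L (M i)))

  module _ {m n} {F : Matrix (suc m) n → Carrier} (lin : HeadLinear F) (cong : Congruent F) where

    head-0 : ∀ M → F ((λ _ → 0#) ∷ M) ≈ 0#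
    head-0 M = begin
      F ((λ _ → 0#) ∷ M)
        ≈⟨ cong _ _ (∷-cong (λ j → solve 0 (con ℤ.0ℤ := :- con ℤ.1ℤ :* con ℤ.0ℤ :+ con ℤ.0ℤ) refl) (λ _ _ → refl)) ⟩
      F ((λ _ → - 1# * 0# + 0#) ∷ M)
        ≈⟨ lin (- 1#) (λ _ → 0#) (λ _ → 0#) M ⟩
      - 1# * F ((λ _ → 0#) ∷ M) + F ((λ _ → 0#) ∷ M)
        ≈⟨ solve 1 (λ x → :- con ℤ.1ℤ :* x :+ x := con ℤ.0ℤ) refl _ ⟩
      0# ∎

    head-∑ : ∀ {k} (c : Vector Carrier k) (B : Matrix k n) M →
             F ((λ j → ∑[ i < k ] (c i * B i j)) ∷ M) ≈ ∑[ i < k ] (c i * F (B i ∷ M))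
    head-∑ {zero}  c B M = head-0 M
    head-∑ {suc k} c B M = trans (lin _ _ _ M) (+-congˡ (head-∑ (c ∘ suc) (B ∘ suc) M))

    head-+ : ∀ v w M → F ((λ j → v j + w j) ∷ M) ≈ F (v ∷ M) + F (w ∷ M)
    head-+ v w M =
      trans (cong _ _ (∷-cong (λ j → +-congʳ (sym (*-identityˡ _))) λ _ _ → refl))
        (trans (lin 1# v w M) (+-congʳ (*-identityˡ _)))

  module _ {m n} {F : Matrix (suc (suc m)) n → Carrier} where

    -- Polarisation: `F` vanishes when both head rows are `v+w`, and expanding this leaves the two
    -- mixed terms, since `F` also vanishes on `v ∷ v` and `w ∷ w`.
    swap : Alternating F → ∀ v w M → F (v ∷ w ∷ M) ≈ - F (w ∷ v ∷ M)
    swap (step cong lin alt rest) v w M = begin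
      F (v ∷ w ∷ M)
        ≈⟨ solve 2 (λ x y → x := con ℤ.0ℤ :+ x :+ (y :+ con ℤ.0ℤ) :- y) refl _ _ ⟩
      0# + F (v ∷ w ∷ M) + (F (w ∷ v ∷ M) + 0#) - F (w ∷ v ∷ M)
        ≈⟨ +-congʳ (+-cong (+-congʳ (alt v M)) (+-congˡ (alt w M))) ⟨
      F (v ∷ v ∷ M) + F (v ∷ w ∷ M) + (F (w ∷ v ∷ M) + F (w ∷ w ∷ M)) - F (w ∷ v ∷ M)
        ≈⟨ +-congʳ (+-cong (tail-+ v) (tail-+ w)) ⟨
      F (v ∷ v+w ∷ M) + F (w ∷ v+w ∷ M) - F (w ∷ v ∷ M)
        ≈⟨ +-congʳ (head-+ lin cong v w (v+w ∷ M)) ⟨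
      F (v+w ∷ v+w ∷ M) - F (w ∷ v ∷ M)
        ≈⟨ trans (+-congʳ (alt v+w M)) (+-identityˡ _) ⟩
      - F (w ∷ v ∷ M) ∎
      where
      v+w : Vector Carrier n
      v+w j = v j + w j
      tail-+ : ∀ u → F (u ∷ v+w ∷ M) ≈ F (u ∷ v ∷ M) + F (u ∷ w ∷ M)
      tail-+ u with rest u
      ... | step cong′ lin′ _ _ = head-+ lin′ cong′ v w M

  tail-alternating : ∀ {m n} {F : Matrix (suc m) n → Carrier} → Alternating F →
                     ∀ v → Alternating (λ M → F (v ∷ M))
  tail-alternating (step _ _ _ rest) = rest

  -- Swapping `v` past the row below it costs a sign and brings the two copies one step closer; the
  -- row that moves to the top is then frozen and the induction continues in the tail.
  head-repeated : ∀ {m n} {F : Matrix (suc m) n → Carrier} → Alternating F →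
                  ∀ v (M : Matrix m n) i → (∀ j → M i j ≈ v j) → F (v ∷ M) ≈ 0#
  head-repeated {suc m} {F = F} (step cong lin alt rest) v M zero M₀≈v =
    trans (cong _ (v ∷ v ∷ M ∘ suc) λ { zero j → refl ; (suc zero) → M₀≈v ; (suc (suc i)) j → refl }) (alt v _)
  head-repeated {suc m} {F = F} alt@(step cong _ _ rest) v M (suc i) Mᵢ≈v = begin
    F (v ∷ M)                     ≈⟨ cong _ _ (∷-cong (λ _ → refl) (∷-η M)) ⟩
    F (v ∷ M zero ∷ M ∘ suc)      ≈⟨ swap alt v (M zero) (M ∘ suc) ⟩
    - F (M zero ∷ v ∷ M ∘ suc)    ≈⟨ -‿cong (head-repeated (rest (M zero)) v (M ∘ suc) i Mᵢ≈v) ⟩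
    - 0#                          ≈⟨ solve 0 (:- con ℤ.0ℤ := con ℤ.0ℤ) refl ⟩
    0#                            ∎

  -- Row operations with a vector `v` that need not be a row of the matrix: in the application it is
  -- an already frozen head, and `head-repeated` supplies the vanishing hypothesis. In this form the
  -- hypothesis passes to the tail in the recursion.
  add-multiples : ∀ {m n} {F : Matrix m n → Carrier} → Alternating F → ∀ (v : Vector Carrier n) →
                  (∀ (M : Matrix m n) i → (∀ j → M i j ≈ v j) → F M ≈ 0#) →
                  ∀ (a : Vector Carrier m) M → F (λ i j → a i * v j + M i j) ≈ F M
  add-multiples (nullary cong) v vanish a M = cong _ _ λ ()
  add-multiples {suc m} {F = F} (step cong lin _ rest) v vanish a M = begin
    F (λ i j → a i * v j + M i j)                            ≈⟨ cong _ _ (∷-η _) ⟩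
    F ((λ j → a zero * v j + M zero j) ∷ M′)                 ≈⟨ lin (a zero) v (M zero) M′ ⟩
    a zero * F (v ∷ M′) + F (M zero ∷ M′)
      ≈⟨ +-cong (trans (*-congˡ (vanish (v ∷ M′) zero λ _ → refl)) (zeroʳ _))
                (add-multiples (rest (M zero)) v (λ N i → vanish (M zero ∷ N) (suc i)) (a ∘ suc) (M ∘ suc)) ⟩
    0# + F (M zero ∷ M ∘ suc)                                ≈⟨ trans (+-identityˡ _) (cong _ _ (λ i j → sym (∷-η M i j))) ⟩
    F M                                                      ∎
    where
    M′ : Matrix m _
    M′ i j = a (suc i) * v j + M (suc i) j

  -- Row `j` reaches the top after `toℕ j` adjacent swaps; this is the origin of the Laplace signs.
  cycle : ∀ {m n} {F : Matrix (suc m) n → Carrier} → Alternating F → ∀ (B : Matrix (suc m) n) j →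
          F (B j ∷ removeAt B j) ≈ (- 1#) ^ toℕ j * F B
  cycle alt B zero = trans (congruent alt _ _ λ i j → sym (∷-η B i j)) (sym (*-identityˡ _))
  cycle {suc m} {F = F} alt B (suc j) = begin
    F (B (suc j) ∷ removeAt B (suc j))
      ≈⟨ congruent alt _ _ (∷-cong (λ _ → refl) (∷-η _)) ⟩
    F (B (suc j) ∷ B zero ∷ removeAt (B ∘ suc) j)
      ≈⟨ swap alt _ _ _ ⟩
    - F (B zero ∷ B (suc j) ∷ removeAt (B ∘ suc) j)
      ≈⟨ -‿cong (cycle (tail-alternating alt (B zero)) (B ∘ suc) j) ⟩
    - ((- 1#) ^ toℕ j * F (B zero ∷ B ∘ suc))
      ≈⟨ -‿cong (*-congˡ (congruent alt _ _ λ i j → sym (∷-η B i j))) ⟩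
    - ((- 1#) ^ toℕ j * F B)
      ≈⟨ solve 2 (λ s x → :- (s :* x) := (:- con ℤ.1ℤ :* s) :* x) refl _ _ ⟩
    - 1# * (- 1#) ^ toℕ j * F B ∎

  sign : ∀ {n} → Fin n → Carrier
  sign j = (- 1#) ^ toℕ j

  det-cong : ∀ {n} → Congruent (det {n})
  det-cong {zero}  M N M≈N = refl
  det-cong {suc n} M N M≈N = ∑-cong λ j →
    *-cong (*-congˡ {x = sign j} (M≈N zero j)) (det-cong {n} _ _ λ i k → M≈N (suc i) (punchIn j k))

  -- D j k stands for a minor without the columns j and punchIn j k; it does not
  -- depend on which of the two is named first.
  Symmetric₂ : ∀ n → (Fin (suc n) → Fin n → Carrier) → Set ℓ
  Symmetric₂ zero    D = ⊤
  Symmetric₂ (suc n) D = (∀ k → D zero k ≈ D (suc k) zero) × Symmetric₂ n (λ j k → D (suc j) (suc k))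

  -- A minor is seen as a function `E` of its column selection. Raising both `j` and `k` by one
  -- turns the selection into its `Fin.lift 1`, so the induction replaces `E` by `E ∘ Fin.lift 1`.
  minors-symmetric : ∀ n (E : (Fin n → Fin (suc (suc n))) → Carrier) → (∀ f g → f ≗ g → E f ≈ E g) →
                     Symmetric₂ (suc n) (λ j k → E (punchIn j ∘ punchIn k))
  minors-symmetric zero    E resp = (λ k → resp _ _ λ ()) , tt
  minors-symmetric (suc n) E resp = (λ k → resp (punchIn zero ∘ punchIn k) (punchIn (suc k) ∘ punchIn zero) λ _ → ≡.refl) ,
    symmetric₂-≈ (suc n) (λ j k → resp (Fin.lift 1 (punchIn j ∘ punchIn k)) (punchIn (suc j) ∘ punchIn (suc k))
                                    λ { zero → ≡.refl ; (suc i) → ≡.refl })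
      (minors-symmetric n (E ∘ Fin.lift 1)
        (λ f g f≗g → resp (Fin.lift 1 f) (Fin.lift 1 g) λ { zero → ≡.refl ; (suc i) → ≡.cong suc (f≗g i) }))
    where
    symmetric₂-≈ : ∀ n {D E : Fin (suc n) → Fin n → Carrier} → (∀ j k → D j k ≈ E j k) →
                   Symmetric₂ n D → Symmetric₂ n E
    symmetric₂-≈ zero    D≈E s       = tt
    symmetric₂-≈ (suc n) D≈E (s , t) =
      (λ k → trans (sym (D≈E zero k)) (trans (s k) (D≈E (suc k) zero))) ,
      symmetric₂-≈ n (λ j k → D≈E (suc j) (suc k)) t

  -- This is the double Laplace expansion with both first rows equal to `v`. Terms naming the same
  -- two columns in opposite order cancel. The pairs involving column zero are split off; in the
  -- other terms both signs flip, so what remains is the same sum in one column fewer.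
  cancellation : ∀ n (v : Vector Carrier (suc n)) D → Symmetric₂ n D →
    ∑[ j < suc n ] ∑[ k < n ] (sign j * v j * (sign k * v (punchIn j k) * D j k)) ≈ 0#
  cancellation zero    v D _       = ∑-0 {1} λ _ → refl
  cancellation (suc n) v D (s , t) = begin
    ∑[ k < suc n ] top k + ∑[ j < suc n ] (left j + ∑[ k < n ] inner j k)
      ≈⟨ +-congˡ (∑-distrib-+ left (λ j → ∑[ k < n ] inner j k)) ⟩
    ∑[ k < suc n ] top k + (∑[ j < suc n ] left j + ∑[ j < suc n ] ∑[ k < n ] inner j k)
      ≈⟨ +-assoc _ _ _ ⟨
    ∑[ k < suc n ] top k + ∑[ j < suc n ] left j + ∑[ j < suc n ] ∑[ k < n ] inner j k
      ≈⟨ +-cong (trans (sym (∑-distrib-+ top left)) (∑-0 top+left)) (∑-cong λ j → ∑-cong λ k → unsign j k) ⟩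
    0# + ∑[ j < suc n ] ∑[ k < n ] inner′ j k
      ≈⟨ trans (+-identityˡ _) (cancellation n (v ∘ suc) (λ j k → D (suc j) (suc k)) t) ⟩
    0# ∎
    where
    top left : Fin (suc n) → Carrier
    top k  = 1# * v zero * (sign k * v (suc k) * D zero k)
    left j = - 1# * sign j * v (suc j) * (1# * v zero * D (suc j) zero)
    inner inner′ : Fin (suc n) → Fin n → Carrier
    inner j k  = - 1# * sign j * v (suc j) * (- 1# * sign k * v (suc (punchIn j k)) * D (suc j) (suc k))
    inner′ j k = sign j * v (suc j) * (sign k * v (suc (punchIn j k)) * D (suc j) (suc k))
    top+left : ∀ k → top k + left k ≈ 0#
    top+left k = trans (+-congʳ (*-congˡ (*-congˡ (s k))))
      (solve 4 (λ a b σ d → con ℤ.1ℤ :* a :* (σ :* b :* d) :+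
                            :- con ℤ.1ℤ :* σ :* b :* (con ℤ.1ℤ :* a :* d) := con ℤ.0ℤ) refl (v zero) (v (suc k)) (sign k) _)
    unsign : ∀ j k → inner j k ≈ inner′ j k
    unsign j k = solve 5 (λ σ τ a b d → :- con ℤ.1ℤ :* σ :* a :* (:- con ℤ.1ℤ :* τ :* b :* d) :=
                                        σ :* a :* (τ :* b :* d)) refl (sign j) (sign k) _ _ _

  removeAt-linear : ∀ {n} (j : Fin (suc n)) → Linear (λ v → removeAt v j)
  removeAt-linear j = record { resp = λ v≈w k → v≈w (punchIn j k) ; linear = λ a v w k → refl }

  det-alternating : ∀ n → Alternating (det {n})
  det-alternating zero    = nullary det-cong
  det-alternating (suc n) = step det-cong linear (alternating n) λ v →
    alternating-∑ (λ j → sign j * v j) (λ j M → det (λ i → removeAt (M i) j))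
      (λ j → alternating-∘ (removeAt-linear j) (det-alternating n))
    where
    linear : HeadLinear (det {suc n})
    linear a v w M = begin
      ∑[ j < suc n ] (sign j * (a * v j + w j) * minor j)
        ≈⟨ ∑-cong (λ j → solve 5 (λ σ a x y d → σ :* (a :* x :+ y) :* d := a :* (σ :* x :* d) :+ σ :* y :* d) refl
                           (sign j) a (v j) (w j) (minor j)) ⟩
      ∑[ j < suc n ] (a * (sign j * v j * minor j) + sign j * w j * minor j)
        ≈⟨ ∑-distrib-+ (λ j → a * (sign j * v j * minor j)) (λ j → sign j * w j * minor j) ⟩
      ∑[ j < suc n ] (a * (sign j * v j * minor j)) + ∑[ j < suc n ] (sign j * w j * minor j)
        ≈⟨ +-congʳ (*-distribˡ-sum a (λ j → sign j * v j * minor j)) ⟨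
      a * (∑[ j < suc n ] (sign j * v j * minor j)) + ∑[ j < suc n ] (sign j * w j * minor j) ∎
      where
      minor : Fin (suc n) → Carrier
      minor j = det (λ i → removeAt (M i) j)

    alternating : ∀ n → HeadAlternating (det {suc n})
    alternating zero    = tt
    alternating (suc n) v M = begin
      ∑[ j < suc (suc n) ] (sign j * v j * (∑[ k < suc n ] (sign k * v (punchIn j k) * D j k)))
        ≈⟨ ∑-cong (λ j → *-distribˡ-sum (sign j * v j) (λ k → sign k * v (punchIn j k) * D j k)) ⟩
      ∑[ j < suc (suc n) ] ∑[ k < suc n ] (sign j * v j * (sign k * v (punchIn j k) * D j k))
        ≈⟨ cancellation (suc n) v D (minors-symmetric n (λ f → det (λ i → M i ∘ f))
             (λ f g f≗g → det-cong _ _ λ i l → reflexive (≡.cong (M i) (f≗g l)))) ⟩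
      0# ∎
      where
      D : Fin (suc (suc n)) → Fin (suc n) → Carrier
      D j k = det (λ i → M i ∘ (punchIn j ∘ punchIn k))

  insert0-linear : ∀ {n} (j : Fin (suc n)) → Linear (λ v → insertAt v j 0#)
  insert0-linear j = record
    { resp   = λ {v} {w} v≈w → punchIn-cases j
        (reflexive (≡.trans (VectorProperties.insertAt-lookup v j 0#) (≡.sym (VectorProperties.insertAt-lookup w j 0#))))
        (λ i → trans (reflexive (VectorProperties.insertAt-punchIn v j 0# i))
                 (trans (v≈w i) (reflexive (≡.sym (VectorProperties.insertAt-punchIn w j 0# i)))))
    ; linear = λ a v w → punchIn-cases j
        (trans (reflexive (VectorProperties.insertAt-lookup _ j 0#))
          (trans (solve 1 (λ a → con ℤ.0ℤ := a :* con ℤ.0ℤ :+ con ℤ.0ℤ) refl a)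
            (sym (+-cong (*-congˡ (reflexive (VectorProperties.insertAt-lookup v j 0#)))
                         (reflexive (VectorProperties.insertAt-lookup w j 0#))))))
        (λ i → trans (reflexive (VectorProperties.insertAt-punchIn _ j 0# i))
          (sym (+-cong (*-congˡ (reflexive (VectorProperties.insertAt-punchIn v j 0# i)))
                       (reflexive (VectorProperties.insertAt-punchIn w j 0# i)))))
    }

  -- Expand the first row in the unit vectors. With `1ₘ j` on top, row operations clear column `j`
  -- below it, so `F` becomes an alternating function of the minor without that column. By induction
  -- it is the determinant of the minor times a value at unit rows, which `cycle` identifies as a
  -- sign times `F 1ₘ`.
  alternating-unique : ∀ {n} {F : Matrix n n → Carrier} → Alternating F → ∀ M → F M ≈ det M * F 1ₘ
  alternating-unique {zero} (nullary cong) M = trans (cong _ _ λ ()) (sym (*-identityˡ _))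
  alternating-unique {suc n} {F} alt@(step cong lin _ rest) M = begin
    F M
      ≈⟨ cong _ _ (∷-η M) ⟩
    F (M zero ∷ M ∘ suc)
      ≈⟨ cong _ _ (∷-cong (λ k → sym (∑-1ₘʳ (M zero) k)) λ _ _ → refl) ⟩
    F ((λ k → ∑[ j < suc n ] (M zero j * 1ₘ j k)) ∷ M ∘ suc)
      ≈⟨ head-∑ lin cong (M zero) 1ₘ (M ∘ suc) ⟩
    ∑[ j < suc n ] (M zero j * F (1ₘ j ∷ M ∘ suc))
      ≈⟨ ∑-cong (λ j → trans (*-congˡ (expand j))
           (solve 4 (λ σ a d e → a :* (d :* (σ :* e)) := σ :* a :* d :* e) refl (sign j) (M zero j) (minor j) (F 1ₘ))) ⟩
    ∑[ j < suc n ] (sign j * M zero j * minor j * F 1ₘ)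
      ≈⟨ *-distribʳ-sum (F 1ₘ) (λ j → sign j * M zero j * minor j) ⟨
    det M * F 1ₘ ∎
    where
    minor : Fin (suc n) → Carrier
    minor j = det (λ i → removeAt (M (suc i)) j)
    clear : ∀ j i k → - M (suc i) j * 1ₘ j k + M (suc i) k ≈ insertAt (removeAt (M (suc i)) j) j 0# k
    clear j i = punchIn-cases j
      (trans (trans (+-congʳ (*-congˡ (1ₘ-diagonal j))) (solve 1 (λ x → :- x :* con ℤ.1ℤ :+ x := con ℤ.0ℤ) refl _))
             (sym (reflexive (VectorProperties.insertAt-lookup _ j 0#))))
      (λ k → trans (trans (+-congʳ (trans (*-congˡ (1ₘ-off-diagonal (Fin.punchInᵢ≢i j k ∘ ≡.sym))) (zeroʳ _))) (+-identityˡ _))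
                   (sym (reflexive (VectorProperties.insertAt-punchIn _ j 0# k))))
    insert-1ₘ : ∀ j i k → insertAt (1ₘ i) j 0# k ≈ 1ₘ (punchIn j i) k
    insert-1ₘ j i = punchIn-cases j
      (trans (reflexive (VectorProperties.insertAt-lookup _ j 0#)) (sym (1ₘ-off-diagonal (Fin.punchInᵢ≢i j i))))
      (λ k → trans (reflexive (VectorProperties.insertAt-punchIn _ j 0# k)) (sym (1ₘ-punchIn j i k)))
    expand : ∀ j → F (1ₘ j ∷ M ∘ suc) ≈ minor j * (sign j * F 1ₘ)
    expand j = begin
      F (1ₘ j ∷ M ∘ suc)
        ≈⟨ add-multiples (rest (1ₘ j)) (1ₘ j) (head-repeated alt (1ₘ j)) (λ i → - M (suc i) j) (M ∘ suc) ⟨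
      F (1ₘ j ∷ λ i k → - M (suc i) j * 1ₘ j k + M (suc i) k)
        ≈⟨ cong _ _ (∷-cong (λ _ → refl) (clear j)) ⟩
      F (1ₘ j ∷ λ i → insertAt (removeAt (M (suc i)) j) j 0#)
        ≈⟨ alternating-unique (alternating-∘ (insert0-linear j) (rest (1ₘ j))) (λ i → removeAt (M (suc i)) j) ⟩
      minor j * F (1ₘ j ∷ λ i → insertAt (1ₘ i) j 0#)
        ≈⟨ *-congˡ (trans (cong _ _ (∷-cong (λ _ → refl) (insert-1ₘ j))) (cycle alt 1ₘ j)) ⟩
      minor j * (sign j * F 1ₘ) ∎

  *ₘ-linear : ∀ {m n} (N : Matrix m n) → Linear (λ v k → ∑[ j < m ] (v j * N j k))
  *ₘ-linear {m} N = record
    { resp   = λ v≈w k → ∑-cong λ j → *-congʳ (v≈w j)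
    ; linear = λ a v w k → trans (∑-cong {m} λ j → trans (distribʳ (N j k) (a * v j) (w j)) (+-congʳ (*-assoc a (v j) (N j k))))
        (trans (∑-distrib-+ (λ j → a * (v j * N j k)) (λ j → w j * N j k))
          (+-congʳ (sym (*-distribˡ-sum a (λ j → v j * N j k)))))
    }

  -- For fixed `N`, the determinant of the product is alternating in the rows of `M`, and its value
  -- at `1ₘ` is `det N`.
  det-*ₘ : ∀ {n} (M N : Matrix n n) → det (M *ₘ N) ≈ det M * det N
  det-*ₘ {n} M N = trans (alternating-unique (alternating-∘ (*ₘ-linear N) (det-alternating n)) M)
    (*-congˡ (det-cong _ _ λ i k → ∑-1ₘˡ (λ j → N j k) i))

  det-first-row : ∀ {n} (M : Matrix (suc n) (suc n)) → (∀ j → M zero (suc j) ≈ 0#) →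
                  det M ≈ M zero zero * det (λ i j → M (suc i) (suc j))
  det-first-row M row = trans
    (+-cong (*-congʳ (*-identityˡ _)) (∑-0 λ j → trans (*-congʳ (trans (*-congˡ (row j)) (zeroʳ _))) (zeroˡ _)))
    (+-identityʳ _)

  det-1ₘ : ∀ n → det (1ₘ {n}) ≈ 1#
  det-1ₘ zero    = refl
  det-1ₘ (suc n) = trans (det-first-row (1ₘ {suc n}) (λ _ → refl)) (trans (*-identityˡ _) (det-1ₘ n))

-- Reasoning under double negation, and the axioms of a weakly ordered field.

module DoubleNegation where

  infixl 1 _>>=_

  pure : ∀ {a} {A : Set a} → A → ¬ ¬ A
  pure x ¬x = ¬x x

  _>>=_ : ∀ {a b} {A : Set a} {B : Set b} → ¬ ¬ A → (A → ¬ ¬ B) → ¬ ¬ B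
  (¬¬x >>= f) ¬y = ¬¬x λ x → f x ¬y

  -- Induction on the number of instances; it makes finitely many undecided choices available at
  -- once.
  ¬¬-∀ : ∀ {a n} {P : Fin n → Set a} → (∀ i → ¬ ¬ P i) → ¬ ¬ (∀ i → P i)
  ¬¬-∀ {n = zero}  _ = pure λ ()
  ¬¬-∀ {n = suc n} p = p zero >>= λ p₀ → ¬¬-∀ (p ∘ suc) >>= λ ps → pure λ { zero → p₀ ; (suc i) → ps i }

-- Totality and invertibility are the axioms that make a choice. For Cauchy reals no algorithm makes
-- it, so they are doubly negated; `≤-stable` lets an inequality proved by such cases lose the
-- double negation.
record IsWeakOrderedField (R : CommutativeRing 0ℓ 0ℓ) (_≤_ : Rel (CommutativeRing.Carrier R) 0ℓ) : Set where
  open CommutativeRing R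
  field
    ≤-reflexive : ∀ {x y} → x ≈ y → x ≤ y
    ≤-trans     : ∀ {x y z} → x ≤ y → y ≤ z → x ≤ z
    ≤-antisym   : ∀ {x y} → x ≤ y → y ≤ x → x ≈ y
    ≤-stable    : ∀ {x y} → ¬ ¬ (x ≤ y) → x ≤ y
    ≤-total     : ∀ x y → ¬ ¬ (x ≤ y ⊎ y ≤ x)
    +-mono-≤    : ∀ {x y u v} → x ≤ y → u ≤ v → (x + u) ≤ (y + v)
    *-nonneg    : ∀ {x y} → 0# ≤ x → 0# ≤ y → 0# ≤ (x * y)
    invertible  : ∀ x → ¬ ¬ (x ≈ 0# ⊎ ∃[ y ] x * y ≈ 1#)
    1≉0         : ¬ 1# ≈ 0#

-- Sums over a fixed ring, kept from unfolding.

module Summation (R : CommutativeRing 0ℓ 0ℓ) where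
  open CommutativeRing R hiding (zero)
  open Matrices R using (1ₘ)
  private module Σ = Sums R

  -- Opaque, so that the summand and the length are recovered by unification.
  opaque
    ∑ : ∀ {n} → Vector Carrier n → Carrier
    ∑ = Σ.sum

  syntax ∑ (λ i → x) = ∑[ i ] x
  infixl 10 ∑

  opaque
    unfolding ∑

    ∑≡sum : ∀ {n} (f : Vector Carrier n) → ∑ f ≡ Σ.sum f
    ∑≡sum f = ≡.refl

    ∑-suc : ∀ {n} (f : Vector Carrier (suc n)) → ∑ f ≈ f zero + ∑[ i ] f (suc i)
    ∑-suc f = refl

    ∑-empty : (f : Vector Carrier 0) → ∑ f ≈ 0#
    ∑-empty f = refl

    ∑-cong : ∀ {n} {f g : Vector Carrier n} → (∀ i → f i ≈ g i) → ∑ f ≈ ∑ g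
    ∑-cong = Σ.∑-cong

    ∑-0 : ∀ {n} {f : Vector Carrier n} → (∀ i → f i ≈ 0#) → ∑ f ≈ 0#
    ∑-0 = Σ.∑-0

    ∑-+ : ∀ {n} {f g : Vector Carrier n} → ∑[ i ] (f i + g i) ≈ ∑ f + ∑ g
    ∑-+ {f = f} {g} = Σ.∑-distrib-+ f g

    ∑-neg : ∀ {n} {f : Vector Carrier n} → ∑[ i ] (- f i) ≈ - ∑ f
    ∑-neg {f = f} = Σ.∑-neg f

    ∑-*ˡ : ∀ {n} {a} {f : Vector Carrier n} → ∑[ i ] (a * f i) ≈ a * ∑ f
    ∑-*ˡ {a = a} {f} = sym (Σ.*-distribˡ-sum a f)

    ∑-*ʳ : ∀ {n} {a} {f : Vector Carrier n} → ∑[ i ] (f i * a) ≈ ∑ f * a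
    ∑-*ʳ {a = a} {f} = sym (Σ.*-distribʳ-sum a f)

    ∑-swap : ∀ {m n} {f : Fin m → Fin n → Carrier} → ∑[ i ] ∑[ j ] f i j ≈ ∑[ j ] ∑[ i ] f i j
    ∑-swap {f = f} = Σ.∑-comm f

    ∑-1ₘʳ : ∀ {n} {f : Vector Carrier n} {k} → ∑[ j ] (f j * 1ₘ j k) ≈ f k
    ∑-1ₘʳ {f = f} {k} = Σ.∑-1ₘʳ f k

    ∑-1ₘˡ : ∀ {n} {f : Vector Carrier n} {k} → ∑[ j ] (1ₘ k j * f j) ≈ f k
    ∑-1ₘˡ {f = f} {k} = Σ.∑-1ₘˡ f k

    ∑-opposite : ∀ {n} {f : Vector Carrier n} → ∑[ i ] f (opposite i) ≈ ∑ f
    ∑-opposite {f = f} = sym (Σ.sum-permute f Perm.reverse)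

    ∑-remove : ∀ {n} k {f : Vector Carrier (suc n)} → ∑ f ≈ f k + ∑[ i ] f (punchIn k i)
    ∑-remove k {f} = Σ.sum-remove {i = k} f

  ∑-- : ∀ {n} {f g : Vector Carrier n} → ∑[ i ] (f i - g i) ≈ ∑ f - ∑ g
  ∑-- = trans ∑-+ (+-congˡ ∑-neg)

  ∑-concentrated : ∀ {n} k {f : Vector Carrier n} → (∀ i → i ≢ k → f i ≈ 0#) → ∑ f ≈ f k
  ∑-concentrated {suc n} k f≈0 =
    trans (∑-remove k) (trans (+-congˡ (∑-0 λ i → f≈0 _ (Fin.punchInᵢ≢i k i))) (+-identityʳ _))

-- Ordered fields, inner products and Gram-Schmidt orthogonalisation.

module OrderedField (R : CommutativeRing 0ℓ 0ℓ) (_≤_ : Rel (CommutativeRing.Carrier R) 0ℓ)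
                    (F : IsWeakOrderedField R _≤_) where
  open Vector using (_∷_)
  open CommutativeRing R hiding (zero) public
  open IsWeakOrderedField F public
  open Matrices R public
  open Sums R using (1ₘ-diagonal; 1ₘ-off-diagonal; 1ₘ-sym; 1ₘ-punchIn) public
  open Summation R public
  open IntegerSolver R using (solve; _:=_; _:+_; _:*_; _:-_; :-_; con) public
  open DoubleNegation public
  open import Relation.Binary.Reasoning.Setoid setoid

  ≤-refl : ∀ {x} → x ≤ x
  ≤-refl = ≤-reflexive refl

  ≤-resp : ∀ {x x′ y y′} → x ≈ x′ → y ≈ y′ → x ≤ y → x′ ≤ y′
  ≤-resp x≈x′ y≈y′ x≤y = ≤-trans (≤-reflexive (sym x≈x′)) (≤-trans x≤y (≤-reflexive y≈y′))

  ≈-stable : ∀ {x y} → ¬ ¬ (x ≈ y) → x ≈ y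
  ≈-stable ¬¬x≈y = ≤-antisym (≤-stable λ k → ¬¬x≈y (k ∘ ≤-reflexive)) (≤-stable λ k → ¬¬x≈y (k ∘ ≤-reflexive ∘ sym))

  x≤y⇒0≤y-x : ∀ {x y} → x ≤ y → 0# ≤ (y - x)
  x≤y⇒0≤y-x {x} x≤y = ≤-resp (-‿inverseʳ x) refl (+-mono-≤ x≤y (≤-refl {x = - x}))

  0≤y-x⇒x≤y : ∀ {x y} → 0# ≤ (y - x) → x ≤ y
  0≤y-x⇒x≤y {x} {y} 0≤ =
    ≤-resp (+-identityˡ x) (solve 2 (λ x y → y :- x :+ x := y) refl x y) (+-mono-≤ 0≤ (≤-refl {x}))

  *-monoˡ-≤ : ∀ {a x y} → 0# ≤ a → x ≤ y → (a * x) ≤ (a * y)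
  *-monoˡ-≤ {a} {x} {y} 0≤a x≤y =
    0≤y-x⇒x≤y (≤-resp refl (solve 3 (λ a x y → a :* (y :- x) := a :* y :- a :* x) refl a x y)
      (*-nonneg 0≤a (x≤y⇒0≤y-x x≤y)))

  *-nonpos : ∀ {x y} → x ≤ 0# → y ≤ 0# → 0# ≤ (x * y)
  *-nonpos {x} {y} x≤0 y≤0 =
    ≤-resp refl (solve 2 (λ x y → (con ℤ.0ℤ :- x) :* (con ℤ.0ℤ :- y) := x :* y) refl x y)
      (*-nonneg (x≤y⇒0≤y-x x≤0) (x≤y⇒0≤y-x y≤0))

  square-nonneg : ∀ x → 0# ≤ (x * x)
  square-nonneg x = ≤-stable (≤-total 0# x >>= λ
    { (inj₁ 0≤x) → pure (*-nonneg 0≤x 0≤x) ; (inj₂ x≤0) → pure (*-nonpos x≤0 x≤0) })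

  0≤1 : 0# ≤ 1#
  0≤1 = ≤-resp refl (*-identityˡ 1#) (square-nonneg 1#)

  -- Because `y = y² x`, a product of nonnegative elements.
  inverse-nonneg : ∀ {x y} → y * x ≈ 1# → 0# ≤ x → 0# ≤ y
  inverse-nonneg {x} {y} yx≈1 0≤x =
    ≤-resp refl (trans (*-assoc y y x) (trans (*-congˡ yx≈1) (*-identityʳ y))) (*-nonneg (square-nonneg y) 0≤x)

  cancel-invertible : ∀ {x y z} → x * y ≈ 1# → x * z ≈ 0# → z ≈ 0#
  cancel-invertible {x} {y} {z} xy≈1 xz≈0 = begin
    z             ≈⟨ *-identityˡ z ⟨
    1# * z        ≈⟨ *-congʳ xy≈1 ⟨
    x * y * z     ≈⟨ solve 3 (λ x y z → x :* y :* z := y :* (x :* z)) refl x y z ⟩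
    y * (x * z)   ≈⟨ *-congˡ xz≈0 ⟩
    y * 0#        ≈⟨ zeroʳ y ⟩
    0#            ∎

  cancel-nonzero : ∀ {x z} → ¬ x ≈ 0# → x * z ≈ 0# → z ≈ 0#
  cancel-nonzero {x} x≉0 xz≈0 = ≈-stable (invertible x >>= λ
    { (inj₁ x≈0) → contradiction x≈0 x≉0 ; (inj₂ (y , xy≈1)) → pure (cancel-invertible xy≈1 xz≈0) })

  square-zero : ∀ {x} → x * x ≈ 0# → x ≈ 0#
  square-zero {x} xx≈0 = ≈-stable (invertible x >>= λ
    { (inj₁ x≈0) → pure x≈0 ; (inj₂ (y , xy≈1)) → pure (cancel-invertible xy≈1 xx≈0) })

  ∑-nonneg : ∀ {n} {f : Vector Carrier n} → (∀ i → 0# ≤ f i) → 0# ≤ ∑ f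
  ∑-nonneg {zero}  0≤f = ≤-reflexive (sym (∑-empty _))
  ∑-nonneg {suc n} 0≤f = ≤-resp (+-identityˡ 0#) (sym (∑-suc _)) (+-mono-≤ (0≤f zero) (∑-nonneg (0≤f ∘ suc)))

  ∑-mono-≤ : ∀ {n} {f g : Vector Carrier n} → (∀ i → f i ≤ g i) → ∑ f ≤ ∑ g
  ∑-mono-≤ f≤g = 0≤y-x⇒x≤y (≤-resp refl ∑-- (∑-nonneg (x≤y⇒0≤y-x ∘ f≤g)))

  term≤∑ : ∀ {n} {f : Vector Carrier n} → (∀ i → 0# ≤ f i) → ∀ i → f i ≤ ∑ f
  term≤∑ {suc n} 0≤f i = ≤-resp (+-identityʳ _) (sym (∑-remove i)) (+-mono-≤ ≤-refl (∑-nonneg (0≤f ∘ punchIn i)))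

  ∑-zero-terms : ∀ {n} {f : Vector Carrier n} → (∀ i → 0# ≤ f i) → ∑ f ≤ 0# → ∀ i → f i ≈ 0#
  ∑-zero-terms 0≤f ∑f≤0 i = ≤-antisym (≤-trans (term≤∑ 0≤f i) ∑f≤0) (0≤f i)

  -- The index type is arbitrary because orthogonalisation is applied both to weighted vectors over
  -- `Fin n` and to tensors over `Fin n × Fin e`.
  record InnerProduct (I : Set) : Set where
    field
      ⟨_,_⟩       : (I → Carrier) → (I → Carrier) → Carrier
      ip-cong     : ∀ {x y z w} → (∀ a → x a ≈ y a) → (∀ a → z a ≈ w a) → ⟨ x , z ⟩ ≈ ⟨ y , w ⟩
      ip-comm     : ∀ x y → ⟨ x , y ⟩ ≈ ⟨ y , x ⟩
      ip-linear   : ∀ c x y z → ⟨ (λ a → c * x a + y a) , z ⟩ ≈ c * ⟨ x , z ⟩ + ⟨ y , z ⟩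
      ip-nonneg   : ∀ x → 0# ≤ ⟨ x , x ⟩
      ip-definite : ∀ {x} → ⟨ x , x ⟩ ≈ 0# → ∀ a → x a ≈ 0#

    ip-congˡ : ∀ {x y} z → (∀ a → x a ≈ y a) → ⟨ x , z ⟩ ≈ ⟨ y , z ⟩
    ip-congˡ z x≈y = ip-cong x≈y λ _ → refl

    ip-congʳ : ∀ {x y} z → (∀ a → x a ≈ y a) → ⟨ z , x ⟩ ≈ ⟨ z , y ⟩
    ip-congʳ z x≈y = ip-cong (λ _ → refl) x≈y

    ip-0ˡ : ∀ z → ⟨ (λ _ → 0#) , z ⟩ ≈ 0#
    ip-0ˡ z = begin
      ⟨ (λ _ → 0#) , z ⟩
        ≈⟨ ip-congˡ z (λ _ → solve 0 (con ℤ.0ℤ := :- con ℤ.1ℤ :* con ℤ.0ℤ :+ con ℤ.0ℤ) refl) ⟩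
      ⟨ (λ _ → - 1# * 0# + 0#) , z ⟩
        ≈⟨ ip-linear (- 1#) _ _ z ⟩
      - 1# * ⟨ (λ _ → 0#) , z ⟩ + ⟨ (λ _ → 0#) , z ⟩
        ≈⟨ solve 1 (λ x → :- con ℤ.1ℤ :* x :+ x := con ℤ.0ℤ) refl _ ⟩
      0# ∎

    ip-∑ˡ : ∀ {m} (c : Vector Carrier m) (v : Fin m → I → Carrier) z →
            ⟨ (λ a → ∑[ k ] (c k * v k a)) , z ⟩ ≈ ∑[ k ] (c k * ⟨ v k , z ⟩)
    ip-∑ˡ {zero}  c v z = trans (ip-congˡ z λ a → ∑-empty _) (trans (ip-0ˡ z) (sym (∑-empty _)))
    ip-∑ˡ {suc m} c v z = begin
      ⟨ (λ a → ∑[ k ] (c k * v k a)) , z ⟩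
        ≈⟨ ip-congˡ z (λ a → ∑-suc _) ⟩
      ⟨ (λ a → c zero * v zero a + ∑[ k ] (c (suc k) * v (suc k) a)) , z ⟩
        ≈⟨ ip-linear _ _ _ z ⟩
      c zero * ⟨ v zero , z ⟩ + ⟨ (λ a → ∑[ k ] (c (suc k) * v (suc k) a)) , z ⟩
        ≈⟨ +-congˡ (ip-∑ˡ (c ∘ suc) (v ∘ suc) z) ⟩
      c zero * ⟨ v zero , z ⟩ + ∑[ k ] (c (suc k) * ⟨ v (suc k) , z ⟩)
        ≈⟨ ∑-suc _ ⟨
      ∑[ k ] (c k * ⟨ v k , z ⟩) ∎

    ip-∑ʳ : ∀ {m} (c : Vector Carrier m) (v : Fin m → I → Carrier) z →
            ⟨ z , (λ a → ∑[ k ] (c k * v k a)) ⟩ ≈ ∑[ k ] (c k * ⟨ z , v k ⟩)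
    ip-∑ʳ c v z = trans (ip-comm _ _) (trans (ip-∑ˡ c v z) (∑-cong λ k → *-congˡ (ip-comm _ _)))

  module Orthogonalization {I : Set} (ip : InnerProduct I) where
    open InnerProduct ip

    -- A zero u j carries the weight τ j = 0, so that the projection onto the
    -- span is ∑ τ j ⟨_, u j⟩ u j without discarding vectors.
    record OrthogonalSystem {m} (v : Fin m → I → Carrier) : Set where
      field
        u            : Fin m → I → Carrier
        τ            : Vector Carrier m
        coefficients : Matrix m m
        combination  : ∀ j a → u j a ≈ ∑[ k ] (coefficients j k * v k a)
        orthogonal   : ∀ {j k} → j ≢ k → ⟨ u j , u k ⟩ ≈ 0#
        normalized   : ∀ j → ((∀ a → u j a ≈ 0#) × τ j ≈ 0#) ⊎ τ j * ⟨ u j , u j ⟩ ≈ 1#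
        expansion    : ∀ k a → v k a ≈ ∑[ j ] (τ j * ⟨ v k , u j ⟩ * u j a)
        first        : ∀ j → toℕ j ≡ 0 → ∀ a → u j a ≈ v j a

      projection : (I → Carrier) → I → Carrier
      projection y a = ∑[ j ] (τ j * ⟨ y , u j ⟩ * u j a)

      -- Where the weight `τ j` is zero the vector `u j` is zero as well, so both sides vanish.
      ip-normalized : ∀ y j → τ j * ⟨ y , u j ⟩ * ⟨ u j , u j ⟩ ≈ ⟨ y , u j ⟩
      ip-normalized y j with normalized j
      ... | inj₁ (u≈0 , _) = begin
        τ j * ⟨ y , u j ⟩ * ⟨ u j , u j ⟩ ≈⟨ *-congʳ (trans (*-congˡ y⊥u) (zeroʳ _)) ⟩
        0# * ⟨ u j , u j ⟩                ≈⟨ zeroˡ _ ⟩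
        0#                                ≈⟨ y⊥u ⟨
        ⟨ y , u j ⟩                       ∎
        where
        y⊥u : ⟨ y , u j ⟩ ≈ 0#
        y⊥u = trans (ip-comm _ _) (trans (ip-congˡ y u≈0) (ip-0ˡ y))
      ... | inj₂ τu≈1 = begin
        τ j * ⟨ y , u j ⟩ * ⟨ u j , u j ⟩ ≈⟨ solve 3 (λ t y n → t :* y :* n := t :* n :* y) refl _ _ _ ⟩
        τ j * ⟨ u j , u j ⟩ * ⟨ y , u j ⟩ ≈⟨ *-congʳ τu≈1 ⟩
        1# * ⟨ y , u j ⟩                  ≈⟨ *-identityˡ _ ⟩
        ⟨ y , u j ⟩                       ∎

      τ-nonneg : ∀ j → 0# ≤ τ j
      τ-nonneg j with normalized j
      ... | inj₁ (_ , τ≈0) = ≤-reflexive (sym τ≈0)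
      ... | inj₂ τu≈1      = inverse-nonneg τu≈1 (ip-nonneg (u j))

      τ∥u∥²≤1 : ∀ j → (τ j * ⟨ u j , u j ⟩) ≤ 1#
      τ∥u∥²≤1 j with normalized j
      ... | inj₁ (_ , τ≈0) = ≤-resp (sym (trans (*-congʳ τ≈0) (zeroˡ _))) refl 0≤1
      ... | inj₂ τu≈1      = ≤-reflexive τu≈1

      ip-projection : ∀ y j → ⟨ projection y , u j ⟩ ≈ ⟨ y , u j ⟩
      ip-projection y j = begin
        ⟨ projection y , u j ⟩                      ≈⟨ ip-∑ˡ _ u (u j) ⟩
        ∑[ k ] (τ k * ⟨ y , u k ⟩ * ⟨ u k , u j ⟩)
          ≈⟨ ∑-concentrated j (λ k k≢j → trans (*-congˡ (orthogonal k≢j)) (zeroʳ _)) ⟩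
        τ j * ⟨ y , u j ⟩ * ⟨ u j , u j ⟩           ≈⟨ ip-normalized y j ⟩
        ⟨ y , u j ⟩                                 ∎

      ip-residual : ∀ y j → ⟨ (λ a → - 1# * projection y a + y a) , u j ⟩ ≈ 0#
      ip-residual y j = begin
        ⟨ (λ a → - 1# * projection y a + y a) , u j ⟩  ≈⟨ ip-linear _ _ _ _ ⟩
        - 1# * ⟨ projection y , u j ⟩ + ⟨ y , u j ⟩    ≈⟨ +-congʳ (*-congˡ (ip-projection y j)) ⟩
        - 1# * ⟨ y , u j ⟩ + ⟨ y , u j ⟩               ≈⟨ solve 1 (λ x → :- con ℤ.1ℤ :* x :+ x := con ℤ.0ℤ) refl _ ⟩
        0#                                             ∎

      -- The squared norm of `projection y`, equal to `⟨ y , projection y ⟩`.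
      bessel-sum : (I → Carrier) → Carrier
      bessel-sum y = ∑[ j ] (τ j * (⟨ y , u j ⟩ * ⟨ y , u j ⟩))

      ip-projectionʳ : ∀ x y → ⟨ x , projection y ⟩ ≈ ∑[ j ] (τ j * (⟨ x , u j ⟩ * ⟨ y , u j ⟩))
      ip-projectionʳ x y = trans (ip-∑ʳ _ u x)
        (∑-cong λ j → solve 3 (λ t a b → t :* b :* a := t :* (a :* b)) refl (τ j) _ _)

      -- The difference of the two sides is the squared norm of the residual `r`, because `r` is
      -- orthogonal to the projection.
      bessel : ∀ y → bessel-sum y ≤ ⟨ y , y ⟩
      bessel y = 0≤y-x⇒x≤y (≤-resp refl eq (ip-nonneg r))
        where
        r : I → Carrier
        r a = - 1# * projection y a + y a
        r⊥p : ⟨ projection y , r ⟩ ≈ 0#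
        r⊥p = trans (ip-comm _ _) (trans (ip-projectionʳ r y) (∑-0 λ j →
          trans (*-congˡ (trans (*-congʳ (ip-residual y j)) (zeroˡ _))) (zeroʳ _)))
        eq : ⟨ r , r ⟩ ≈ ⟨ y , y ⟩ - bessel-sum y
        eq = begin
          ⟨ r , r ⟩                                       ≈⟨ ip-linear _ _ _ r ⟩
          - 1# * ⟨ projection y , r ⟩ + ⟨ y , r ⟩         ≈⟨ +-cong (trans (*-congˡ r⊥p) (zeroʳ _)) (ip-comm y r) ⟩
          0# + ⟨ r , y ⟩                                  ≈⟨ +-identityˡ _ ⟩
          ⟨ r , y ⟩                                       ≈⟨ ip-linear _ _ _ y ⟩
          - 1# * ⟨ projection y , y ⟩ + ⟨ y , y ⟩
            ≈⟨ +-congʳ (*-congˡ (trans (ip-comm _ _) (ip-projectionʳ y y))) ⟩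
          - 1# * bessel-sum y + ⟨ y , y ⟩
            ≈⟨ solve 2 (λ b n → :- con ℤ.1ℤ :* b :+ n := n :- b) refl _ _ ⟩
          ⟨ y , y ⟩ - bessel-sum y                        ∎

      parseval : ∀ y → (∀ a → y a ≈ projection y a) → bessel-sum y ≈ ⟨ y , y ⟩
      parseval y y≈p = sym (trans (ip-congʳ y y≈p) (ip-projectionʳ y y))

    open OrthogonalSystem

    private
      -- The component along `v₀` is removed from all later vectors before they are orthogonalised
      -- among themselves. The vectors obtained from `v′` are combinations of `v′`, hence orthogonal
      -- to `v₀`, which can be put back in front unchanged.
      module Prepend {m} (v : Fin (suc m) → I → Carrier) (τ₀ : Carrier)
                     (norm₀ : ((∀ a → v zero a ≈ 0#) × τ₀ ≈ 0#) ⊎ τ₀ * ⟨ v zero , v zero ⟩ ≈ 1#) where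

        v₀ : I → Carrier
        v₀ = v zero

        coefficient : Vector Carrier m
        coefficient k = - (τ₀ * ⟨ v (suc k) , v₀ ⟩)

        v′ : Fin m → I → Carrier
        v′ k a = coefficient k * v₀ a + v (suc k) a

        module _ (S : OrthogonalSystem v′) where

          private module S = OrthogonalSystem S

          u⁺ : Fin (suc m) → I → Carrier
          u⁺ = v₀ ∷ S.u

          τ⁺ : Vector Carrier (suc m)
          τ⁺ = τ₀ ∷ S.τ

          ip-normalized₀ : ∀ y → τ₀ * ⟨ y , v₀ ⟩ * ⟨ v₀ , v₀ ⟩ ≈ ⟨ y , v₀ ⟩
          ip-normalized₀ y = [ vanishing , invertible-norm ]′ norm₀
            where
            y⊥v : (∀ a → v₀ a ≈ 0#) → ⟨ y , v₀ ⟩ ≈ 0#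
            y⊥v v₀≈0 = trans (ip-comm _ _) (trans (ip-congˡ y v₀≈0) (ip-0ˡ y))
            vanishing : ((∀ a → v₀ a ≈ 0#) × τ₀ ≈ 0#) → τ₀ * ⟨ y , v₀ ⟩ * ⟨ v₀ , v₀ ⟩ ≈ ⟨ y , v₀ ⟩
            vanishing (v₀≈0 , _) =
              trans (trans (*-congʳ (trans (*-congˡ (y⊥v v₀≈0)) (zeroʳ _))) (zeroˡ _)) (sym (y⊥v v₀≈0))
            invertible-norm : τ₀ * ⟨ v₀ , v₀ ⟩ ≈ 1# → τ₀ * ⟨ y , v₀ ⟩ * ⟨ v₀ , v₀ ⟩ ≈ ⟨ y , v₀ ⟩
            invertible-norm τv≈1 = trans (solve 3 (λ t y n → t :* y :* n := t :* n :* y) refl _ _ _)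
                                     (trans (*-congʳ τv≈1) (*-identityˡ _))

          v′⊥v₀ : ∀ k → ⟨ v′ k , v₀ ⟩ ≈ 0#
          v′⊥v₀ k = begin
            ⟨ v′ k , v₀ ⟩
              ≈⟨ ip-linear _ _ _ _ ⟩
            - (τ₀ * ⟨ v (suc k) , v₀ ⟩) * ⟨ v₀ , v₀ ⟩ + ⟨ v (suc k) , v₀ ⟩
              ≈⟨ solve 3 (λ c n x → :- c :* n :+ x := x :- c :* n) refl _ _ _ ⟩
            ⟨ v (suc k) , v₀ ⟩ - τ₀ * ⟨ v (suc k) , v₀ ⟩ * ⟨ v₀ , v₀ ⟩
              ≈⟨ +-congˡ (-‿cong (ip-normalized₀ _)) ⟩
            ⟨ v (suc k) , v₀ ⟩ - ⟨ v (suc k) , v₀ ⟩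
              ≈⟨ -‿inverseʳ _ ⟩
            0# ∎

          u⊥v₀ : ∀ j → ⟨ S.u j , v₀ ⟩ ≈ 0#
          u⊥v₀ j = begin
            ⟨ S.u j , v₀ ⟩                                        ≈⟨ ip-congˡ v₀ (S.combination j) ⟩
            ⟨ (λ a → ∑[ k ] (S.coefficients j k * v′ k a)) , v₀ ⟩ ≈⟨ ip-∑ˡ _ v′ v₀ ⟩
            ∑[ k ] (S.coefficients j k * ⟨ v′ k , v₀ ⟩)           ≈⟨ ∑-0 (λ k → trans (*-congˡ (v′⊥v₀ k)) (zeroʳ _)) ⟩
            0#                                                    ∎

          ip-v′ : ∀ k j → ⟨ v′ k , S.u j ⟩ ≈ ⟨ v (suc k) , S.u j ⟩
          ip-v′ k j = begin
            ⟨ v′ k , S.u j ⟩                                         ≈⟨ ip-linear _ _ _ _ ⟩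
            coefficient k * ⟨ v₀ , S.u j ⟩ + ⟨ v (suc k) , S.u j ⟩
              ≈⟨ +-congʳ (trans (*-congˡ (trans (ip-comm _ _) (u⊥v₀ j))) (zeroʳ _)) ⟩
            0# + ⟨ v (suc k) , S.u j ⟩                               ≈⟨ +-identityˡ _ ⟩
            ⟨ v (suc k) , S.u j ⟩                                    ∎

          coefficients⁺ : Matrix (suc m) (suc m)
          coefficients⁺ zero    k = 1ₘ zero k
          coefficients⁺ (suc j)   = ∑[ k ] (S.coefficients j k * coefficient k) ∷ S.coefficients j

          combination⁺ : ∀ j a → u⁺ j a ≈ ∑[ k ] (coefficients⁺ j k * v k a)
          combination⁺ zero    a = sym ∑-1ₘˡ
          combination⁺ (suc j) a = begin
            S.u j a
              ≈⟨ S.combination j a ⟩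
            ∑[ k ] (S.coefficients j k * (coefficient k * v₀ a + v (suc k) a))
              ≈⟨ ∑-cong (λ k → solve 4 (λ s c x y → s :* (c :* x :+ y) := s :* c :* x :+ s :* y) refl _ _ _ _) ⟩
            ∑[ k ] (S.coefficients j k * coefficient k * v₀ a + S.coefficients j k * v (suc k) a)
              ≈⟨ trans ∑-+ (+-congʳ ∑-*ʳ) ⟩
            (∑[ k ] (S.coefficients j k * coefficient k)) * v₀ a + ∑[ k ] (S.coefficients j k * v (suc k) a)
              ≈⟨ ∑-suc _ ⟨
            ∑[ k ] (coefficients⁺ (suc j) k * v k a) ∎

          orthogonal⁺ : ∀ {j k} → j ≢ k → ⟨ u⁺ j , u⁺ k ⟩ ≈ 0#
          orthogonal⁺ {zero}  {zero}  0≢0 = contradiction ≡.refl 0≢0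
          orthogonal⁺ {zero}  {suc k} _   = trans (ip-comm _ _) (u⊥v₀ k)
          orthogonal⁺ {suc j} {zero}  _   = u⊥v₀ j
          orthogonal⁺ {suc j} {suc k} j≢k = S.orthogonal (j≢k ∘ ≡.cong suc)

          normalized⁺ : ∀ j → ((∀ a → u⁺ j a ≈ 0#) × τ⁺ j ≈ 0#) ⊎ τ⁺ j * ⟨ u⁺ j , u⁺ j ⟩ ≈ 1#
          normalized⁺ zero    = norm₀
          normalized⁺ (suc j) = S.normalized j

          expansion⁺ : ∀ k a → v k a ≈ ∑[ j ] (τ⁺ j * ⟨ v k , u⁺ j ⟩ * u⁺ j a)
          expansion⁺ zero a = sym (trans (∑-suc _) (trans (+-cong own (∑-0 λ j →
              trans (*-congʳ (trans (*-congˡ (trans (ip-comm _ _) (u⊥v₀ j))) (zeroʳ _))) (zeroˡ _)))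
            (+-identityʳ _)))
            where
            own : τ₀ * ⟨ v₀ , v₀ ⟩ * v₀ a ≈ v₀ a
            own = [ (λ (v₀≈0 , _) → trans (*-congˡ (v₀≈0 a)) (trans (zeroʳ _) (sym (v₀≈0 a))))
                  , (λ τv≈1 → trans (*-congʳ τv≈1) (*-identityˡ _)) ]′ norm₀
          expansion⁺ (suc k) a = begin
            v (suc k) a
              ≈⟨ solve 3 (λ c x y → y := c :* x :+ (:- c :* x :+ y)) refl (τ₀ * ⟨ v (suc k) , v₀ ⟩) (v₀ a) _ ⟩
            τ₀ * ⟨ v (suc k) , v₀ ⟩ * v₀ a + v′ k a
              ≈⟨ +-congˡ (S.expansion k a) ⟩
            τ₀ * ⟨ v (suc k) , v₀ ⟩ * v₀ a + ∑[ j ] (S.τ j * ⟨ v′ k , S.u j ⟩ * S.u j a)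
              ≈⟨ +-congˡ (∑-cong λ j → *-congʳ (*-congˡ (ip-v′ k j))) ⟩
            τ₀ * ⟨ v (suc k) , v₀ ⟩ * v₀ a + ∑[ j ] (S.τ j * ⟨ v (suc k) , S.u j ⟩ * S.u j a)
              ≈⟨ ∑-suc _ ⟨
            ∑[ j ] (τ⁺ j * ⟨ v (suc k) , u⁺ j ⟩ * u⁺ j a) ∎

          system : OrthogonalSystem v
          system = record
            { u = u⁺ ; τ = τ⁺ ; coefficients = coefficients⁺ ; combination = combination⁺ ; orthogonal = orthogonal⁺
            ; normalized = normalized⁺ ; expansion = expansion⁺
            ; first = λ { zero _ a → refl }
            }

    -- The double negation comes from one question per vector: whether its squared norm is zero or
    -- invertible.
    gram-schmidt : ∀ {m} (v : Fin m → I → Carrier) → ¬ ¬ OrthogonalSystem v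
    gram-schmidt {zero} v = pure record
      { u = λ () ; τ = λ () ; coefficients = λ () ; combination = λ () ; orthogonal = λ { {()} }
      ; normalized = λ () ; expansion = λ () ; first = λ () }
    gram-schmidt {suc m} v = do
      τ₀ , norm₀ ← weight
      let open Prepend v τ₀ norm₀
      S ← gram-schmidt v′
      pure (system S)
      where
      weight : ¬ ¬ (Σ[ τ₀ ∈ Carrier ] (((∀ a → v zero a ≈ 0#) × τ₀ ≈ 0#) ⊎ τ₀ * ⟨ v zero , v zero ⟩ ≈ 1#))
      weight = invertible ⟨ v zero , v zero ⟩ >>= λ
        { (inj₁ vv≈0)        → pure (0# , inj₁ (ip-definite vv≈0 , refl))
        ; (inj₂ (t , vvt≈1)) → pure (t , inj₂ (trans (*-comm _ _) vvt≈1)) }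

-- The spectral theorem for symmetric matrices with given characteristic roots.

module SpectralTheorem (R : CommutativeRing 0ℓ 0ℓ) (_≤_ : Rel (CommutativeRing.Carrier R) 0ℓ)
                       (F : IsWeakOrderedField R _≤_) where
  open import Data.List.Base using ([]; _∷_)
  open import Data.List.Relation.Unary.All as All using (All; []; _∷_)
  open OrderedField R _≤_ F
  open Determinant R using (det-cong; det-*ₘ; det-first-row; det-1ₘ)
  open import Algebra.Properties.CommutativeMonoid.Sum *-commutativeMonoid using () renaming (sum to product)
  open import Algebra.Properties.Semiring.Exp semiring using (_^_)
  open import Algebra.Properties.Semiring.Sum semiring using (sum)
  open import Relation.Binary.Reasoning.Setoid setoid

  -- Polynomial functions, presented by their iterated difference quotients.
  data Polynomial : (Carrier → Carrier) → Set where
    vanishing : ∀ {f} → (∀ x → f x ≈ 0#) → Polynomial f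
    quotient  : ∀ {f} (g : Carrier → Carrier → Carrier) → (∀ a → Polynomial (g a)) →
                (∀ a x → f x ≈ f a + (x - a) * g a x) → Polynomial f

  polynomial-≈ : ∀ {f g} → (∀ x → f x ≈ g x) → Polynomial f → Polynomial g
  polynomial-≈ f≈g (vanishing f≈0)  = vanishing λ x → trans (sym (f≈g x)) (f≈0 x)
  polynomial-≈ f≈g (quotient q p e) =
    quotient q p λ a x → trans (sym (f≈g x)) (trans (e a x) (+-congʳ (f≈g a)))

  polynomial-const : ∀ c → Polynomial (λ _ → c)
  polynomial-const c = quotient (λ _ _ → 0#) (λ _ → vanishing λ _ → refl)
    λ a x → sym (trans (+-congˡ (zeroʳ _)) (+-identityʳ c))

  polynomial-id : Polynomial (λ x → x)
  polynomial-id = quotient (λ _ _ → 1#) (λ _ → polynomial-const 1#)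
    λ a x → solve 2 (λ a x → x := a :+ (x :- a) :* con ℤ.1ℤ) refl a x

  polynomial-+ : ∀ {f g} → Polynomial f → Polynomial g → Polynomial (λ x → f x + g x)
  polynomial-+ (vanishing f≈0) q = polynomial-≈ (λ x → sym (trans (+-congʳ (f≈0 x)) (+-identityˡ _))) q
  polynomial-+ p@(quotient _ _ _) (vanishing g≈0) =
    polynomial-≈ (λ x → sym (trans (+-congˡ (g≈0 x)) (+-identityʳ _))) p
  polynomial-+ (quotient h p d) (quotient k q e) =
    quotient (λ a x → h a x + k a x) (λ a → polynomial-+ (p a) (q a))
      λ a x → trans (+-cong (d a x) (e a x))
        (solve 5 (λ fa ga y hx kx → fa :+ y :* hx :+ (ga :+ y :* kx) := fa :+ ga :+ y :* (hx :+ kx)) refl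
          _ _ (x - a) (h a x) (k a x))

  polynomial-scale : ∀ c {f} → Polynomial f → Polynomial (λ x → c * f x)
  polynomial-scale c (vanishing f≈0)  = vanishing λ x → trans (*-congˡ (f≈0 x)) (zeroʳ c)
  polynomial-scale c (quotient h p e) = quotient (λ a x → c * h a x) (λ a → polynomial-scale c (p a))
    λ a x → trans (*-congˡ (e a x))
      (solve 4 (λ c fa y hx → c :* (fa :+ y :* hx) := c :* fa :+ y :* (c :* hx)) refl c _ (x - a) (h a x))

  polynomial-* : ∀ {f g} → Polynomial f → Polynomial g → Polynomial (λ x → f x * g x)
  polynomial-* (vanishing f≈0) q = vanishing λ x → trans (*-congʳ (f≈0 x)) (zeroˡ _)
  polynomial-* (quotient _ _ _) (vanishing g≈0) = vanishing λ x → trans (*-congˡ (g≈0 x)) (zeroʳ _)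
  polynomial-* {f} {g} (quotient h p d) q@(quotient k r e) =
    -- The Leibniz rule for difference quotients. Leaving `g x` undivided in the second summand
    -- makes the recursion descend on the first factor alone.
    quotient (λ a x → f a * k a x + h a x * g x)
      (λ a → polynomial-+ (polynomial-scale (f a) (r a)) (polynomial-* (p a) q))
      λ a x → begin
        f x * g x
          ≈⟨ *-congʳ (d a x) ⟩
        (f a + (x - a) * h a x) * g x
          ≈⟨ distribʳ _ _ _ ⟩
        f a * g x + (x - a) * h a x * g x
          ≈⟨ +-congʳ (*-congˡ (e a x)) ⟩
        f a * (g a + (x - a) * k a x) + (x - a) * h a x * g x
          ≈⟨ solve 6 (λ fa ga y hx kx gx → fa :* (ga :+ y :* kx) :+ y :* hx :* gx :=
                                           fa :* ga :+ y :* (fa :* kx :+ hx :* gx)) refl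
               (f a) (g a) (x - a) (h a x) (k a x) (g x) ⟩
        f a * g a + (x - a) * (f a * k a x + h a x * g x) ∎

  polynomial-sum : ∀ {n} {f : Fin n → Carrier → Carrier} → (∀ i → Polynomial (f i)) →
                   Polynomial (λ x → sum (λ i → f i x))
  polynomial-sum {zero}  p = polynomial-const 0#
  polynomial-sum {suc n} p = polynomial-+ (p zero) (polynomial-sum (p ∘ suc))

  polynomial-product : ∀ {n} {f : Fin n → Carrier → Carrier} → (∀ i → Polynomial (f i)) →
                       Polynomial (λ x → product (λ i → f i x))
  polynomial-product {zero}  p = polynomial-const 1#
  polynomial-product {suc n} p = polynomial-* (p zero) (polynomial-product (p ∘ suc))

  polynomial-det : ∀ {n} {M : Carrier → Matrix n n} → (∀ i j → Polynomial (λ x → M x i j)) →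
                   Polynomial (λ x → det (M x))
  polynomial-det {zero}  p = polynomial-const 1#
  polynomial-det {suc n} p = polynomial-sum λ j →
    polynomial-* (polynomial-scale ((- 1#) ^ toℕ j) (p zero j)) (polynomial-det λ i k → p (suc i) (punchIn j k))

  polynomial-shift : ∀ c → Polynomial (λ x → x - c)
  polynomial-shift c = polynomial-+ polynomial-id (polynomial-const (- c))

  polynomial-charPoly : ∀ {n} (A : Matrix n n) → Polynomial (charPoly A)
  polynomial-charPoly A = polynomial-det λ i j →
    polynomial-+ (polynomial-* polynomial-id (polynomial-const (1ₘ i j))) (polynomial-const (- A i j))

  -- One more than an upper bound of the list; the order is what makes the field infinite.
  fresh : ∀ xs → ¬ ¬ (∃[ a ] All (λ x → ¬ a ≈ x) xs)
  fresh xs = do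
    b , xs≤b ← bound xs
    pure (b + 1# , All.map (λ x≤b b+1≈x → 1≉0 (≤-antisym (1≤0 (≤-resp (sym b+1≈x) refl x≤b)) 0≤1)) xs≤b)
    where
    1≤0 : ∀ {b} → (b + 1#) ≤ b → 1# ≤ 0#
    1≤0 {b} b+1≤b = ≤-resp (solve 1 (λ b → b :+ con ℤ.1ℤ :- b := con ℤ.1ℤ) refl b) (-‿inverseʳ b)
      (+-mono-≤ b+1≤b (≤-refl {x = - b}))
    bound : ∀ xs → ¬ ¬ (∃[ b ] All (_≤ b) xs)
    bound []       = pure (0# , [])
    bound (x ∷ xs) = do
      b , xs≤b ← bound xs
      inj₁ x≤b ← ≤-total x b
        where inj₂ b≤x → pure (x , ≤-refl ∷ All.map (λ y≤b → ≤-trans y≤b b≤x) xs≤b)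
      pure (b , x≤b ∷ xs≤b)

  -- For a fresh `a` one has `f a = 0`, so `f x = (x - a) g a x`, and the quotient vanishes off the
  -- list extended by `a`. Each division thus adds one exceptional point and passes to a
  -- structurally smaller polynomial. The point may be chosen under double negation because equality
  -- is stable.
  polynomial-vanishes : ∀ {f} → Polynomial f → ∀ xs → (∀ x → All (λ y → ¬ x ≈ y) xs → f x ≈ 0#) → ∀ x → f x ≈ 0#
  polynomial-vanishes (vanishing f≈0) xs _ x = f≈0 x
  polynomial-vanishes {f} (quotient g p e) xs f≈0 x = ≈-stable do
    a , a∉xs ← fresh xs
    let gₐ≈0 = polynomial-vanishes (p a) (a ∷ xs) λ { y (y≉a ∷ y∉xs) →
                 cancel-nonzero (λ y-a≈0 → y≉a (x-y≈0⇒x≈y y-a≈0)) (begin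
                   (y - a) * g a y        ≈⟨ +-identityˡ _ ⟨
                   0# + (y - a) * g a y   ≈⟨ +-congʳ (f≈0 a a∉xs) ⟨
                   f a + (y - a) * g a y  ≈⟨ e a y ⟨
                   f y                    ≈⟨ f≈0 y y∉xs ⟩
                   0#                     ∎) }
    pure (begin
      f x                    ≈⟨ e a x ⟩
      f a + (x - a) * g a x  ≈⟨ +-cong (f≈0 a a∉xs) (trans (*-congˡ (gₐ≈0 x)) (zeroʳ _)) ⟩
      0# + 0#                ≈⟨ +-identityˡ 0# ⟩
      0#                     ∎)
    where
    x-y≈0⇒x≈y : ∀ {x y} → x - y ≈ 0# → x ≈ y
    x-y≈0⇒x≈y {x} {y} x-y≈0 =
      trans (solve 2 (λ x y → x := x :- y :+ y) refl x y) (trans (+-congʳ x-y≈0) (+-identityˡ y))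

  -- At `x = c` the hypothesis is empty; the equality there follows because the difference is a
  -- polynomial vanishing off a finite list. This divides a known root out of a characteristic
  -- polynomial.
  polynomial-cancel : ∀ c {f g} → Polynomial f → Polynomial g → (∀ x → (x - c) * f x ≈ (x - c) * g x) →
                      ∀ x → f x ≈ g x
  polynomial-cancel c {f} {g} p q eq x = begin
    f x                       ≈⟨ solve 2 (λ f g → f := f :+ :- con ℤ.1ℤ :* g :+ g) refl _ _ ⟩
    f x + - 1# * g x + g x    ≈⟨ +-congʳ (polynomial-vanishes difference (c ∷ []) off-c x) ⟩
    0# + g x                  ≈⟨ +-identityˡ _ ⟩
    g x                       ∎
    where
    difference : Polynomial (λ x → f x + - 1# * g x)
    difference = polynomial-+ p (polynomial-scale (- 1#) q)
    off-c : ∀ x → All (λ y → ¬ x ≈ y) (c ∷ []) → f x + - 1# * g x ≈ 0#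
    off-c x (x≉c ∷ []) = cancel-nonzero
      (λ x-c≈0 → x≉c (trans (solve 2 (λ x c → x := x :- c :+ c) refl x c) (trans (+-congʳ x-c≈0) (+-identityˡ c))))
      (trans (solve 3 (λ y f g → y :* (f :+ :- con ℤ.1ℤ :* g) := y :* f :- y :* g) refl _ _ _)
        (trans (+-congʳ (eq x)) (-‿inverseʳ _)))

  *ₘ-∑ : ∀ {l m n} (M : Matrix l m) (N : Matrix m n) i k → (M *ₘ N) i k ≈ ∑[ j ] (M i j * N j k)
  *ₘ-∑ M N i k = reflexive (≡.sym (∑≡sum _))

  Positive : ∀ {n} → Vector Carrier n → Set
  Positive w = ∀ i → 0# ≤ w i × ¬ w i ≈ 0#

  weighted : ∀ {n} (w : Vector Carrier n) → Positive w → InnerProduct (Fin n)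
  weighted w w>0 = record
    { ⟨_,_⟩       = λ x y → ∑[ a ] (w a * (x a * y a))
    ; ip-cong     = λ x≈y z≈w → ∑-cong λ a → *-congˡ (*-cong (x≈y a) (z≈w a))
    ; ip-comm     = λ x y → ∑-cong λ a → *-congˡ (*-comm _ _)
    ; ip-linear   = λ c x y z → trans
        (∑-cong λ a → solve 5 (λ w c x y z → w :* ((c :* x :+ y) :* z) := c :* (w :* (x :* z)) :+ w :* (y :* z)) refl
                        (w a) c (x a) (y a) (z a))
        (trans ∑-+ (+-congʳ ∑-*ˡ))
    ; ip-nonneg   = λ x → ∑-nonneg (nonneg x)
    ; ip-definite = λ {x} xx≈0 a → square-zero (cancel-nonzero (proj₂ (w>0 a))
        (∑-zero-terms (nonneg x) (≤-reflexive xx≈0) a))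
    }
    where
    nonneg : ∀ x a → 0# ≤ (w a * (x a * x a))
    nonneg x a = *-nonneg (proj₁ (w>0 a)) (square-nonneg (x a))

  ones : ∀ {n} → Vector Carrier n
  ones _ = 1#

  ones-positive : ∀ {n} → Positive (ones {n})
  ones-positive _ = 0≤1 , 1≉0

  euclidean : ∀ {n} → InnerProduct (Fin n)
  euclidean = weighted ones ones-positive

  module _ {n} (M : Matrix n n) where
    open InnerProduct (euclidean {n})
    open Orthogonalization (euclidean {n})

    -- Orthogonalising the rows gives a left inverse of M unless the residual of
    -- some basis vector is a nonzero vector orthogonal to all rows.
    singular⇒kernel : det M ≈ 0# →
      ¬ ¬ (Σ[ y ∈ Vector Carrier n ] Σ[ p ∈ Fin n ] ¬ y p ≈ 0# × (∀ i → ∑[ j ] (M i j * y j) ≈ 0#))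
    singular⇒kernel det≈0 no-kernel = gram-schmidt M λ S →
      let open OrthogonalSystem S
          residual : Fin n → Vector Carrier n
          residual i a = - 1# * projection (1ₘ i) a + 1ₘ i a
          M-residual : ∀ i k → ∑[ j ] (M k j * residual i j) ≈ 0#
          M-residual i k = begin
            ∑[ j ] (M k j * residual i j)
              ≈⟨ ∑-cong (λ j → *-identityˡ _) ⟨
            ⟨ M k , residual i ⟩
              ≈⟨ ip-congˡ _ (expansion k) ⟩
            ⟨ projection (M k) , residual i ⟩
              ≈⟨ ip-∑ˡ _ u _ ⟩
            ∑[ j ] (τ j * ⟨ M k , u j ⟩ * ⟨ u j , residual i ⟩)
              ≈⟨ ∑-0 (λ j → trans (*-congˡ (trans (ip-comm _ _) (ip-residual (1ₘ i) j))) (zeroʳ _)) ⟩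
            0# ∎
          residual≈0 : ∀ i a → residual i a ≈ 0#
          residual≈0 i a = ≈-stable λ r≉0 → no-kernel (residual i , a , r≉0 , M-residual i)
          L : Matrix n n
          L i k = ∑[ j ] (τ j * ⟨ 1ₘ i , u j ⟩ * coefficients j k)
          LM≈1 : (L *ₘ M) ≈ₘ 1ₘ
          LM≈1 i a = begin
            (L *ₘ M) i a
              ≈⟨ *ₘ-∑ L M i a ⟩
            ∑[ k ] (L i k * M k a)
              ≈⟨ ∑-cong (λ k → sym ∑-*ʳ) ⟩
            ∑[ k ] ∑[ j ] (τ j * ⟨ 1ₘ i , u j ⟩ * coefficients j k * M k a)
              ≈⟨ ∑-swap ⟩
            ∑[ j ] ∑[ k ] (τ j * ⟨ 1ₘ i , u j ⟩ * coefficients j k * M k a)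
              ≈⟨ ∑-cong (λ j → trans (∑-cong λ k → *-assoc _ _ _) ∑-*ˡ) ⟩
            ∑[ j ] (τ j * ⟨ 1ₘ i , u j ⟩ * ∑[ k ] (coefficients j k * M k a))
              ≈⟨ ∑-cong (λ j → *-congˡ (combination j a)) ⟨
            projection (1ₘ i) a
              ≈⟨ solve 2 (λ p e → p := e :- (:- con ℤ.1ℤ :* p :+ e)) refl _ (1ₘ i a) ⟩
            1ₘ i a - residual i a
              ≈⟨ trans (+-congˡ (-‿cong (residual≈0 i a))) (solve 1 (λ x → x :- con ℤ.0ℤ := x) refl _) ⟩
            1ₘ i a ∎
      in 1≉0 (begin
        1#             ≈⟨ det-1ₘ n ⟨
        det (1ₘ {n})   ≈⟨ det-cong _ _ LM≈1 ⟨
        det (L *ₘ M)   ≈⟨ det-*ₘ L M ⟩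
        det L * det M  ≈⟨ trans (*-congˡ det≈0) (zeroʳ _) ⟩
        0#             ∎)

  infixr 8 _·_
  _·_ : ∀ {n} → Matrix n n → Vector Carrier n → Vector Carrier n
  (A · x) a = ∑[ b ] (A a b * x b)

  ·-∑ : ∀ {m n} (A : Matrix n n) (c : Vector Carrier m) (v : Fin m → Vector Carrier n) a →
        (A · (λ b → ∑[ k ] (c k * v k b))) a ≈ ∑[ k ] (c k * (A · v k) a)
  ·-∑ A c v a = begin
    ∑[ b ] (A a b * ∑[ k ] (c k * v k b))      ≈⟨ ∑-cong (λ b → ∑-*ˡ) ⟨
    ∑[ b ] ∑[ k ] (A a b * (c k * v k b))      ≈⟨ ∑-swap ⟩
    ∑[ k ] ∑[ b ] (A a b * (c k * v k b))
      ≈⟨ ∑-cong (λ k → trans (∑-cong λ b → solve 3 (λ x c v → x :* (c :* v) := c :* (x :* v)) refl _ _ _) ∑-*ˡ) ⟩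
    ∑[ k ] (c k * (A · v k) a)                 ∎

  module _ {n} {w : Vector Carrier n} (w>0 : Positive w) {A : Matrix n n}
           (A-sym : ∀ a b → w a * A a b ≈ w b * A b a) where
    open InnerProduct (weighted w w>0)

    self-adjoint : ∀ x y → ⟨ x , A · y ⟩ ≈ ⟨ A · x , y ⟩
    self-adjoint x y = begin
      ∑[ a ] (w a * (x a * ∑[ b ] (A a b * y b)))
        ≈⟨ ∑-cong (λ a → trans (∑-*ˡ {a = w a}) (*-congˡ ∑-*ˡ)) ⟨
      ∑[ a ] ∑[ b ] (w a * (x a * (A a b * y b)))
        ≈⟨ ∑-cong (λ a → ∑-cong λ b → begin
             w a * (x a * (A a b * y b))
               ≈⟨ solve 4 (λ w x m y → w :* (x :* (m :* y)) := w :* m :* (x :* y)) refl _ _ _ _ ⟩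
             w a * A a b * (x a * y b)
               ≈⟨ *-congʳ (A-sym a b) ⟩
             w b * A b a * (x a * y b)
               ≈⟨ solve 4 (λ w x m y → w :* m :* (x :* y) := w :* (m :* x :* y)) refl _ _ _ _ ⟩
             w b * (A b a * x a * y b) ∎) ⟩
      ∑[ a ] ∑[ b ] (w b * (A b a * x a * y b))
        ≈⟨ ∑-swap ⟩
      ∑[ b ] ∑[ a ] (w b * (A b a * x a * y b))
        ≈⟨ ∑-cong (λ b → trans (∑-*ˡ {a = w b}) (*-congˡ ∑-*ʳ)) ⟩
      ∑[ b ] (w b * (∑[ a ] (A b a * x a) * y b)) ∎

  -- The weight `σ i` is the inverse squared norm of `z i`, in place of scaling `z i` to length one.
  record Eigenbasis {n} (w : Vector Carrier n) (w>0 : Positive w) (A : Matrix n n) (μ : Vector Carrier n) : Set where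
    open InnerProduct (weighted w w>0) public
    field
      z          : Fin n → Vector Carrier n
      σ          : Vector Carrier n
      eigen      : ∀ i a → (A · z i) a ≈ μ i * z i a
      orthogonal : ∀ {i j} → i ≢ j → ⟨ z i , z j ⟩ ≈ 0#
      normalized : ∀ i → σ i * ⟨ z i , z i ⟩ ≈ 1#
      complete   : ∀ y a → y a ≈ ∑[ i ] (σ i * ⟨ y , z i ⟩ * z i a)

  -- One step of deflation. In an orthogonal basis starting with an eigenvector
  -- for the first root, A is block diagonal; the other block is symmetric for
  -- the squared norms of the basis as new weights, so no square roots occur.
  module Deflation {n} {w : Vector Carrier (suc n)} (w>0 : Positive w) {A : Matrix (suc n) (suc n)}
                   (A-sym : ∀ a b → w a * A a b ≈ w b * A b a) {μ : Vector Carrier (suc n)}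
                   (spectrum : IsEigenvalueList A μ)
                   {z₀ : Vector Carrier (suc n)} {p : Fin (suc n)} (z₀p≉0 : ¬ z₀ p ≈ 0#)
                   (z₀-eigen : ∀ a → (A · z₀) a ≈ μ zero * z₀ a) where
    open InnerProduct (weighted w w>0)
    open Orthogonalization (weighted w w>0)

    -- The eigenvector stands first because orthogonalisation leaves the first vector unchanged. It
    -- replaces the unit vector at `p`, a coordinate where it is nonzero, so the family still spans.
    basis : Fin (suc n) → Vector Carrier (suc n)
    basis = z₀ Vector.∷ λ i → 1ₘ (punchIn p i)

    module _ (S : OrthogonalSystem basis) where
      open OrthogonalSystem S

      -- Pairing with the unit vectors clears every coordinate except `p`; the pairing with `z₀`
      -- then reduces to its term at `p`, where neither `z₀` nor the weight is zero.
      orthogonal-to-basis : ∀ r → (∀ j → ⟨ r , basis j ⟩ ≈ 0#) → ∀ a → r a ≈ 0#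
      orthogonal-to-basis r r⊥ = punchIn-cases p at-p off-p
        where
        off-p : ∀ i → r (punchIn p i) ≈ 0#
        off-p i = cancel-nonzero (proj₂ (w>0 (punchIn p i))) (begin
          w (punchIn p i) * r (punchIn p i)
            ≈⟨ ∑-1ₘˡ {f = λ a → w a * r a} ⟨
          ∑[ a ] (1ₘ (punchIn p i) a * (w a * r a))
            ≈⟨ ∑-cong (λ a → solve 3 (λ e w r → e :* (w :* r) := w :* (r :* e)) refl _ _ _) ⟩
          ⟨ r , 1ₘ (punchIn p i) ⟩
            ≈⟨ r⊥ (suc i) ⟩
          0# ∎)
        at-p : r p ≈ 0#
        at-p = cancel-nonzero z₀p≉0 (cancel-nonzero (proj₂ (w>0 p)) (begin
          w p * (z₀ p * r p)
            ≈⟨ *-congˡ (*-comm _ _) ⟩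
          w p * (r p * z₀ p)
            ≈⟨ ∑-concentrated p (punchIn-cases p (λ p≢p → contradiction ≡.refl p≢p) λ i _ →
                 trans (*-congˡ (trans (*-congʳ (off-p i)) (zeroˡ _))) (zeroʳ _)) ⟨
          ⟨ r , z₀ ⟩
            ≈⟨ r⊥ zero ⟩
          0# ∎))

      complete : ∀ y a → y a ≈ projection y a
      complete y a = begin
        y a
          ≈⟨ solve 2 (λ p y → y := :- con ℤ.1ℤ :* p :+ y :+ p) refl (projection y a) (y a) ⟩
        - 1# * projection y a + y a + projection y a
          ≈⟨ +-congʳ (orthogonal-to-basis (λ a → - 1# * projection y a + y a) (λ k → begin
               ⟨ (λ a → - 1# * projection y a + y a) , basis k ⟩
                 ≈⟨ ip-congʳ _ (expansion k) ⟩
               ⟨ (λ a → - 1# * projection y a + y a) , projection (basis k) ⟩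
                 ≈⟨ ip-∑ʳ _ u _ ⟩
               ∑[ j ] (τ j * ⟨ basis k , u j ⟩ * ⟨ (λ a → - 1# * projection y a + y a) , u j ⟩)
                 ≈⟨ ∑-0 (λ j → trans (*-congˡ (ip-residual y j)) (zeroʳ _)) ⟩
               0# ∎) a) ⟩
        0# + projection y a
          ≈⟨ +-identityˡ _ ⟩
        projection y a ∎

      -- The trace of the identity is both the dimension and ∑ τ j ∥u j∥².
      τ∥u∥²≈1 : ∀ j → τ j * ⟨ u j , u j ⟩ ≈ 1#
      τ∥u∥²≈1 j = begin
        τ j * ⟨ u j , u j ⟩
          ≈⟨ solve 1 (λ x → x := con ℤ.1ℤ :- (con ℤ.1ℤ :- x)) refl _ ⟩
        1# - (1# - τ j * ⟨ u j , u j ⟩)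
          ≈⟨ +-congˡ (-‿cong (∑-zero-terms {f = λ j → 1# - τ j * ⟨ u j , u j ⟩}
               (λ j → x≤y⇒0≤y-x (τ∥u∥²≤1 j)) (≤-reflexive deficit) j)) ⟩
        1# - 0#
          ≈⟨ solve 0 (con ℤ.1ℤ :- con ℤ.0ℤ := con ℤ.1ℤ) refl ⟩
        1# ∎
        where
        trace : ∑[ a ] 1ₘ {suc n} a a ≈ ∑[ j ] (τ j * ⟨ u j , u j ⟩)
        trace = begin
          ∑[ a ] 1ₘ {suc n} a a
            ≈⟨ ∑-cong (λ a → complete (1ₘ a) a) ⟩
          ∑[ a ] ∑[ j ] (τ j * ⟨ 1ₘ a , u j ⟩ * u j a)
            ≈⟨ ∑-swap ⟩
          ∑[ j ] ∑[ a ] (τ j * ⟨ 1ₘ a , u j ⟩ * u j a)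
            ≈⟨ ∑-cong (λ j → trans (∑-cong λ a → trans (*-congʳ (*-congˡ (begin
                 ∑[ b ] (w b * (1ₘ a b * u j b))
                   ≈⟨ ∑-cong (λ b → solve 3 (λ w e u → w :* (e :* u) := e :* (w :* u)) refl _ _ _) ⟩
                 ∑[ b ] (1ₘ a b * (w b * u j b))
                   ≈⟨ ∑-1ₘˡ ⟩
                 w a * u j a ∎)))
                 (solve 3 (λ t w u → t :* (w :* u) :* u := t :* (w :* (u :* u))) refl _ _ _)) ∑-*ˡ) ⟩
          ∑[ j ] (τ j * ⟨ u j , u j ⟩) ∎
        deficit : ∑[ j ] (1# - τ j * ⟨ u j , u j ⟩) ≈ 0#
        deficit = begin
          ∑[ j ] (1# - τ j * ⟨ u j , u j ⟩)                    ≈⟨ ∑-- ⟩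
          ∑[ j ] 1# - ∑[ j ] (τ j * ⟨ u j , u j ⟩)             ≈⟨ +-cong (∑-cong λ j → sym (1ₘ-diagonal j)) (-‿cong (sym trace)) ⟩
          ∑[ a ] 1ₘ {suc n} a a - ∑[ a ] 1ₘ {suc n} a a        ≈⟨ -‿inverseʳ _ ⟩
          0#                                                   ∎

      -- The matrix of `A` in the basis `u`.
      Ã : Matrix (suc n) (suc n)
      Ã j k = τ j * ⟨ u j , A · u k ⟩

      A·u : ∀ k a → (A · u k) a ≈ ∑[ j ] (u j a * Ã j k)
      A·u k a = trans (complete (A · u k) a)
        (∑-cong λ j → trans (*-congʳ (*-congˡ (ip-comm _ _))) (*-comm _ _))

      u₀-eigen : ∀ a → (A · u zero) a ≈ μ zero * u zero a
      u₀-eigen a = begin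
        (A · u zero) a     ≈⟨ ∑-cong (λ b → *-congˡ (first zero ≡.refl b)) ⟩
        (A · z₀) a         ≈⟨ z₀-eigen a ⟩
        μ zero * z₀ a      ≈⟨ *-congˡ (first zero ≡.refl a) ⟨
        μ zero * u zero a  ∎

      ip-A·u₀ : ∀ y → ⟨ A · u zero , y ⟩ ≈ μ zero * ⟨ u zero , y ⟩
      ip-A·u₀ y = begin
        ⟨ A · u zero , y ⟩                          ≈⟨ ip-congˡ y (λ a → trans (u₀-eigen a) (sym (+-identityʳ _))) ⟩
        ⟨ (λ a → μ zero * u zero a + 0#) , y ⟩      ≈⟨ ip-linear _ _ _ y ⟩
        μ zero * ⟨ u zero , y ⟩ + ⟨ (λ _ → 0#) , y ⟩ ≈⟨ trans (+-congˡ (ip-0ˡ y)) (+-identityʳ _) ⟩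
        μ zero * ⟨ u zero , y ⟩                     ∎

      Ã-first-row : ∀ k → Ã zero (suc k) ≈ 0#
      Ã-first-row k = begin
        τ zero * ⟨ u zero , A · u (suc k) ⟩         ≈⟨ *-congˡ (self-adjoint w>0 A-sym _ _) ⟩
        τ zero * ⟨ A · u zero , u (suc k) ⟩         ≈⟨ *-congˡ (ip-A·u₀ _) ⟩
        τ zero * (μ zero * ⟨ u zero , u (suc k) ⟩)  ≈⟨ *-congˡ (trans (*-congˡ (orthogonal λ ())) (zeroʳ _)) ⟩
        τ zero * 0#                                 ≈⟨ zeroʳ _ ⟩
        0#                                          ∎

      Ã-corner : Ã zero zero ≈ μ zero
      Ã-corner = begin
        τ zero * ⟨ u zero , A · u zero ⟩          ≈⟨ *-congˡ (trans (ip-comm _ _) (ip-A·u₀ _)) ⟩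
        τ zero * (μ zero * ⟨ u zero , u zero ⟩)   ≈⟨ solve 3 (λ t m n → t :* (m :* n) := m :* (t :* n)) refl _ _ _ ⟩
        μ zero * (τ zero * ⟨ u zero , u zero ⟩)   ≈⟨ *-congˡ (τ∥u∥²≈1 zero) ⟩
        μ zero * 1#                               ≈⟨ *-identityʳ _ ⟩
        μ zero                                    ∎

      U U⁻¹ : Matrix (suc n) (suc n)
      U a j = u j a
      U⁻¹ j a = τ j * (w a * u j a)

      U⁻¹U : (U⁻¹ *ₘ U) ≈ₘ 1ₘ
      U⁻¹U j k = begin
        (U⁻¹ *ₘ U) j k                          ≈⟨ *ₘ-∑ U⁻¹ U j k ⟩
        ∑[ a ] (τ j * (w a * u j a) * u k a)
          ≈⟨ trans (∑-cong λ a → solve 4 (λ t w u v → t :* (w :* u) :* v := t :* (w :* (u :* v))) refl _ _ _ _) ∑-*ˡ ⟩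
        τ j * ⟨ u j , u k ⟩                     ≈⟨ entry ⟩
        1ₘ j k                                  ∎
        where
        entry : τ j * ⟨ u j , u k ⟩ ≈ 1ₘ j k
        entry with j Fin.≟ k
        ... | yes ≡.refl = τ∥u∥²≈1 j
        ... | no  j≢k    = trans (*-congˡ (orthogonal j≢k)) (zeroʳ _)

      intertwine : ∀ x → ((x ∙ₘ 1ₘ -ₘ A) *ₘ U) ≈ₘ (U *ₘ (x ∙ₘ 1ₘ -ₘ Ã))
      intertwine x a k = begin
        ((x ∙ₘ 1ₘ -ₘ A) *ₘ U) a k
          ≈⟨ *ₘ-∑ (x ∙ₘ 1ₘ -ₘ A) U a k ⟩
        ∑[ b ] ((x * 1ₘ a b - A a b) * u k b)
          ≈⟨ ∑-cong (λ b → solve 4 (λ x e m u → (x :* e :- m) :* u := e :* (x :* u) :- m :* u) refl _ _ _ _) ⟩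
        ∑[ b ] (1ₘ a b * (x * u k b) - A a b * u k b)
          ≈⟨ trans ∑-- (+-cong ∑-1ₘˡ (-‿cong (A·u k a))) ⟩
        x * u k a - ∑[ j ] (u j a * Ã j k)
          ≈⟨ trans ∑-- (+-congʳ (∑-1ₘʳ {f = λ j → x * u j a})) ⟨
        ∑[ j ] (x * u j a * 1ₘ j k - u j a * Ã j k)
          ≈⟨ ∑-cong (λ j → solve 4 (λ x e m u → x :* u :* e :- u :* m := u :* (x :* e :- m)) refl _ _ _ _) ⟩
        ∑[ j ] (u j a * (x * 1ₘ j k - Ã j k))
          ≈⟨ *ₘ-∑ U (x ∙ₘ 1ₘ -ₘ Ã) a k ⟨
        (U *ₘ (x ∙ₘ 1ₘ -ₘ Ã)) a k ∎

      charPoly-similar : ∀ x → charPoly A x ≈ charPoly Ã x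
      charPoly-similar x = begin
        charPoly A x                            ≈⟨ *-identityʳ _ ⟨
        charPoly A x * 1#                       ≈⟨ *-congˡ unit ⟨
        charPoly A x * (det U⁻¹ * det U)        ≈⟨ solve 3 (λ c v u → c :* (v :* u) := v :* (c :* u)) refl _ _ _ ⟩
        det U⁻¹ * (charPoly A x * det U)        ≈⟨ *-congˡ commute ⟩
        det U⁻¹ * (det U * charPoly Ã x)        ≈⟨ *-assoc _ _ _ ⟨
        det U⁻¹ * det U * charPoly Ã x          ≈⟨ *-congʳ unit ⟩
        1# * charPoly Ã x                       ≈⟨ *-identityˡ _ ⟩
        charPoly Ã x                            ∎
        where
        unit : det U⁻¹ * det U ≈ 1#
        unit = trans (sym (det-*ₘ U⁻¹ U)) (trans (det-cong _ _ U⁻¹U) (det-1ₘ (suc n)))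
        commute : charPoly A x * det U ≈ det U * charPoly Ã x
        commute = trans (sym (det-*ₘ (x ∙ₘ 1ₘ -ₘ A) U))
          (trans (det-cong _ _ (intertwine x)) (det-*ₘ U (x ∙ₘ 1ₘ -ₘ Ã)))

      B : Matrix n n
      B i j = Ã (suc i) (suc j)

      charPoly-deflate : ∀ x → charPoly Ã x ≈ (x - μ zero) * charPoly B x
      charPoly-deflate x = trans
        (det-first-row (x ∙ₘ 1ₘ -ₘ Ã) (λ k →
          trans (+-congˡ (-‿cong (Ã-first-row k))) (solve 1 (λ x → x :* con ℤ.0ℤ :- con ℤ.0ℤ := con ℤ.0ℤ) refl x)))
        (*-congʳ (+-cong (*-identityʳ x) (-‿cong Ã-corner)))

      spectrum-B : IsEigenvalueList B (μ ∘ suc)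
      spectrum-B = polynomial-cancel (μ zero) (polynomial-charPoly B)
        (polynomial-product λ i → polynomial-shift (μ (suc i)))
        λ x → trans (sym (charPoly-deflate x)) (trans (sym (charPoly-similar x)) (spectrum x))

      w′ : Vector Carrier n
      w′ j = ⟨ u (suc j) , u (suc j) ⟩

      w′>0 : Positive w′
      w′>0 j = ip-nonneg _ , λ w′≈0 → 1≉0 (trans (sym (τ∥u∥²≈1 (suc j))) (trans (*-congˡ w′≈0) (zeroʳ _)))

      cancel-τ : ∀ j y → ⟨ u j , u j ⟩ * (τ j * y) ≈ y
      cancel-τ j y = begin
        ⟨ u j , u j ⟩ * (τ j * y)  ≈⟨ solve 3 (λ n t y → n :* (t :* y) := t :* n :* y) refl _ _ _ ⟩
        τ j * ⟨ u j , u j ⟩ * y    ≈⟨ trans (*-congʳ (τ∥u∥²≈1 j)) (*-identityˡ y) ⟩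
        y                          ∎

      B-sym : ∀ i j → w′ i * B i j ≈ w′ j * B j i
      B-sym i j = begin
        w′ i * B i j                        ≈⟨ cancel-τ (suc i) _ ⟩
        ⟨ u (suc i) , A · u (suc j) ⟩       ≈⟨ self-adjoint w>0 A-sym _ _ ⟩
        ⟨ A · u (suc i) , u (suc j) ⟩       ≈⟨ ip-comm _ _ ⟩
        ⟨ u (suc j) , A · u (suc i) ⟩       ≈⟨ cancel-τ (suc j) _ ⟨
        w′ j * B j i                        ∎

      module _ (E : Eigenbasis w′ w′>0 B (μ ∘ suc)) where
        private module E = Eigenbasis E

        -- Coordinates with weights `w′` are mapped isometrically into the orthogonal complement of
        -- `u zero`. The map intertwines `B` with `A`, so eigenvectors of `B` become eigenvectors of
        -- `A`.
        lift : Vector Carrier n → Vector Carrier (suc n)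
        lift y a = ∑[ j ] (y j * u (suc j) a)

        ip-lift : ∀ x y → ⟨ x , lift y ⟩ ≈ ∑[ j ] (y j * ⟨ x , u (suc j) ⟩)
        ip-lift x y = ip-∑ʳ y (u ∘ suc) x

        ip-u-lift : ∀ j y → ⟨ u (suc j) , lift y ⟩ ≈ w′ j * y j
        ip-u-lift j y = begin
          ⟨ u (suc j) , lift y ⟩                        ≈⟨ ip-lift _ y ⟩
          ∑[ k ] (y k * ⟨ u (suc j) , u (suc k) ⟩)
            ≈⟨ ∑-concentrated j (λ k k≢j →
                 trans (*-congˡ (orthogonal λ eq → k≢j (≡.sym (Fin.suc-injective eq)))) (zeroʳ _)) ⟩
          y j * w′ j                                    ≈⟨ *-comm _ _ ⟩
          w′ j * y j                                    ∎

        ip-lift-lift : ∀ x y → ⟨ lift x , lift y ⟩ ≈ E.⟨ x , y ⟩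
        ip-lift-lift x y = trans (ip-comm _ _) (trans (ip-lift (lift y) x) (∑-cong λ j →
          trans (*-congˡ (trans (ip-comm _ _) (ip-u-lift j y)))
            (solve 3 (λ x w y → x :* (w :* y) := w :* (x :* y)) refl _ _ _)))

        u₀⊥lift : ∀ y → ⟨ u zero , lift y ⟩ ≈ 0#
        u₀⊥lift y = trans (ip-lift (u zero) y) (∑-0 λ j → trans (*-congˡ (orthogonal λ ())) (zeroʳ _))

        A·lift : ∀ y a → (A · lift y) a ≈ lift (B · y) a
        A·lift y a = begin
          (A · lift y) a
            ≈⟨ ·-∑ A y (u ∘ suc) a ⟩
          ∑[ j ] (y j * (A · u (suc j)) a)
            ≈⟨ ∑-cong (λ j → trans (*-congˡ (A·u (suc j) a)) (sym ∑-*ˡ)) ⟩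
          ∑[ j ] ∑[ k ] (y j * (u k a * Ã k (suc j)))
            ≈⟨ ∑-cong (λ j → trans (∑-suc _) (trans (+-congʳ (first-row j)) (+-identityˡ _))) ⟩
          ∑[ j ] ∑[ k ] (y j * (u (suc k) a * B k j))
            ≈⟨ ∑-swap ⟩
          ∑[ k ] ∑[ j ] (y j * (u (suc k) a * B k j))
            ≈⟨ ∑-cong (λ k → trans (∑-cong λ j → solve 3 (λ y u b → y :* (u :* b) := b :* y :* u) refl _ _ _) ∑-*ʳ) ⟩
          lift (B · y) a ∎
          where
          first-row : ∀ j → y j * (u zero a * Ã zero (suc j)) ≈ 0#
          first-row j = trans (*-congˡ (trans (*-congˡ (Ã-first-row j)) (zeroʳ _))) (zeroʳ _)

        eigenbasis⁺ : Eigenbasis w w>0 A μ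
        eigenbasis⁺ = record
          { z          = z⁺
          ; σ          = τ zero Vector.∷ E.σ
          ; eigen      = λ { zero → u₀-eigen ; (suc i) a → trans (A·lift (E.z i) a)
                             (trans (∑-cong λ j → trans (*-congʳ (E.eigen i j)) (*-assoc _ _ _)) ∑-*ˡ) }
          ; orthogonal = orthogonal⁺
          ; normalized = λ { zero → τ∥u∥²≈1 zero ; (suc i) → trans (*-congˡ (ip-lift-lift _ _)) (E.normalized i) }
          ; complete   = complete⁺
          }
          where
          z⁺ : Fin (suc n) → Vector Carrier (suc n)
          z⁺ = u zero Vector.∷ lift ∘ E.z
          orthogonal⁺ : ∀ {i j} → i ≢ j → ⟨ z⁺ i , z⁺ j ⟩ ≈ 0#
          orthogonal⁺ {zero}  {zero}  0≢0 = contradiction ≡.refl 0≢0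
          orthogonal⁺ {zero}  {suc j} _   = u₀⊥lift _
          orthogonal⁺ {suc i} {zero}  _   = trans (ip-comm _ _) (u₀⊥lift _)
          orthogonal⁺ {suc i} {suc j} i≢j = trans (ip-lift-lift _ _) (E.orthogonal (i≢j ∘ ≡.cong suc))
          complete⁺ : ∀ y a → y a ≈ ∑[ i ] ((τ zero Vector.∷ E.σ) i * ⟨ y , z⁺ i ⟩ * z⁺ i a)
          complete⁺ y a = begin
            y a
              ≈⟨ trans (complete y a) (∑-suc _) ⟩
            τ zero * ⟨ y , u zero ⟩ * u zero a + ∑[ j ] (c j * u (suc j) a)
              ≈⟨ +-congˡ (∑-cong λ j → trans (*-congʳ (E.complete c j)) (sym ∑-*ʳ)) ⟩
            τ zero * ⟨ y , u zero ⟩ * u zero a + ∑[ j ] ∑[ i ] (E.σ i * E.⟨ c , E.z i ⟩ * E.z i j * u (suc j) a)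
              ≈⟨ +-congˡ (trans ∑-swap (∑-cong λ i → trans (∑-cong λ j → *-assoc _ _ _) ∑-*ˡ)) ⟩
            τ zero * ⟨ y , u zero ⟩ * u zero a + ∑[ i ] (E.σ i * E.⟨ c , E.z i ⟩ * lift (E.z i) a)
              ≈⟨ +-congˡ (∑-cong λ i → *-congʳ (*-congˡ (ip-c i))) ⟩
            τ zero * ⟨ y , u zero ⟩ * u zero a + ∑[ i ] (E.σ i * ⟨ y , lift (E.z i) ⟩ * lift (E.z i) a)
              ≈⟨ ∑-suc _ ⟨
            ∑[ i ] ((τ zero Vector.∷ E.σ) i * ⟨ y , z⁺ i ⟩ * z⁺ i a) ∎
            where
            c : Vector Carrier n
            c j = τ (suc j) * ⟨ y , u (suc j) ⟩
            ip-c : ∀ i → E.⟨ c , E.z i ⟩ ≈ ⟨ y , lift (E.z i) ⟩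
            ip-c i = trans (∑-cong λ j → begin
                w′ j * (c j * E.z i j)                        ≈⟨ *-assoc _ _ _ ⟨
                w′ j * c j * E.z i j                          ≈⟨ *-congʳ (cancel-τ (suc j) _) ⟩
                ⟨ y , u (suc j) ⟩ * E.z i j                   ≈⟨ *-comm _ _ ⟩
                E.z i j * ⟨ y , u (suc j) ⟩                   ∎)
              (sym (ip-lift y (E.z i)))

  -- Induction on the dimension. The weights vary in the statement because the deflated block is
  -- symmetric with respect to the new weights `w′`.
  eigenbasis : ∀ {n} {w : Vector Carrier n} (w>0 : Positive w) {A : Matrix n n} →
               (∀ a b → w a * A a b ≈ w b * A b a) → {μ : Vector Carrier n} → IsEigenvalueList A μ →
               ¬ ¬ Eigenbasis w w>0 A μ
  eigenbasis {zero} w>0 A-sym spectrum = pure record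
    { z = λ () ; σ = λ () ; eigen = λ () ; orthogonal = λ { {()} } ; normalized = λ () ; complete = λ _ () }
  eigenbasis {suc n} {w} w>0 {A} A-sym {μ} spectrum = do
    -- At `x = μ zero` the first factor of the product is zero, so this matrix is singular and its
    -- kernel vector is an eigenvector.
    z₀ , p , z₀p≉0 , kernel ← singular⇒kernel (μ zero ∙ₘ 1ₘ -ₘ A)
      (trans (spectrum (μ zero)) (trans (*-congʳ (-‿inverseʳ (μ zero))) (zeroˡ _)))
    let open Deflation w>0 A-sym {μ = μ} spectrum z₀p≉0 (eigenvector z₀ kernel)
    S ← Orthogonalization.gram-schmidt (weighted w w>0) basis
    E ← eigenbasis (w′>0 S) (B-sym S) (spectrum-B S)
    pure (eigenbasis⁺ S E)
    where
    eigenvector : ∀ z₀ → (∀ a → ∑[ b ] ((μ zero * 1ₘ a b - A a b) * z₀ b) ≈ 0#) → ∀ a → (A · z₀) a ≈ μ zero * z₀ a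
    eigenvector z₀ kernel a = begin
      (A · z₀) a
        ≈⟨ solve 2 (λ x y → x := y :- (y :- x)) refl _ _ ⟩
      μ zero * z₀ a - (μ zero * z₀ a - (A · z₀) a)
        ≈⟨ +-congˡ (-‿cong (trans ∑-- (+-congʳ (∑-1ₘˡ {f = λ b → μ zero * z₀ b})))) ⟨
      μ zero * z₀ a - ∑[ b ] (1ₘ a b * (μ zero * z₀ b) - A a b * z₀ b)
        ≈⟨ +-congˡ (-‿cong (∑-cong λ b →
             solve 4 (λ m e z x → e :* (m :* z) :- x :* z := (m :* e :- x) :* z) refl _ _ _ _)) ⟩
      μ zero * z₀ a - ∑[ b ] ((μ zero * 1ₘ a b - A a b) * z₀ b)
        ≈⟨ trans (+-congˡ (-‿cong (kernel a))) (solve 1 (λ x → x :- con ℤ.0ℤ := x) refl _) ⟩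
      μ zero * z₀ a ∎

-- The Cauchy reals as a weakly ordered field.

module RealOrderedField where
  open Real
  open import Data.Rational.Base using (_+_; _*_; _-_; -_; ∣_∣; _<_; _≤_)
  open ℚ-Solver.+-*-Solver

  p≤∣p∣ : ∀ p → p ≤ ∣ p ∣
  p≤∣p∣ p with ℚ.≤-total 0ℚ p
  ... | inj₁ 0≤p = ℚ.≤-reflexive (≡.sym (ℚ.0≤p⇒∣p∣≡p 0≤p))
  ... | inj₂ p≤0 = ℚ.≤-trans p≤0 (ℚ.0≤∣p∣ p)

  ∣p∣<q⇒p<q : ∀ p {q} → ∣ p ∣ < q → p < q
  ∣p∣<q⇒p<q p = ℚ.≤-<-trans (p≤∣p∣ p)

  ∣p∣<q⇒-p<q : ∀ p {q} → ∣ p ∣ < q → - p < q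
  ∣p∣<q⇒-p<q p {q} = ∣p∣<q⇒p<q (- p) ∘ ≡.subst (_< q) (≡.sym (ℚ.∣-p∣≡∣p∣ p))

  ∣p∣<q : ∀ p {q} → p < q → - p < q → ∣ p ∣ < q
  ∣p∣<q p {q} p<q -p<q with ℚ.∣p∣≡p∨∣p∣≡-p p
  ... | inj₁ eq = ≡.subst (_< q) (≡.sym eq) p<q
  ... | inj₂ eq = ≡.subst (_< q) (≡.sym eq) -p<q

  q+[p-q]≡p : ∀ p q → q + (p - q) ≡ p
  q+[p-q]≡p = solve 2 (λ p q → q :+ (p :- q) := p) ≡.refl

  q+r-q≡r : ∀ q r → q + r - q ≡ r
  q+r-q≡r = solve 2 (λ q r → q :+ r :- q := r) ≡.refl

  q-p≡-[p-q] : ∀ p q → q - p ≡ - (p - q)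
  q-p≡-[p-q] = solve 2 (λ p q → q :- p := :- (p :- q)) ≡.refl

  interchange : ∀ p q r → p + r + (q + r) ≡ p + q + (r + r)
  interchange = solve 3 (λ p q r → p :+ r :+ (q :+ r) := p :+ q :+ (r :+ r)) ≡.refl

  expand : ∀ a b c d → (b - a) * (c * d) ≡ b * d * c - a * c * d
  expand = solve 4 (λ a b c d → (b :- a) :* (c :* d) := b :* d :* c :- a :* c :* d) ≡.refl

  p-q<r⇒p<q+r : ∀ p q {r} → p - q < r → p < q + r
  p-q<r⇒p<q+r p q {r} p-q<r =
    ≡.subst (_< q + r) (q+[p-q]≡p p q) (ℚ.+-monoʳ-< q p-q<r)

  p<q+r⇒p-q<r : ∀ p q {r} → p < q + r → p - q < r
  p<q+r⇒p-q<r p q {r} p<q+r =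
    ≡.subst (p - q <_) (q+r-q≡r q r) (ℚ.+-monoˡ-< (- q) p<q+r)

  -- Sequences rather than reals: the index arithmetic of a combined real would
  -- otherwise be unfolded to numerators and denominators by the type checker.
  Cauchy : (ℕ → ℚ) → Set
  Cauchy z = ∀ ε → 0ℚ < ε → ∃[ N ] (∀ m n → N ℕ.≤ m → N ℕ.≤ n → ∣ z m - z n ∣ < ε)

  neg-cauchy : ∀ z → Cauchy z → Cauchy (λ n → - z n)
  neg-cauchy z c ε 0<ε with c ε 0<ε
  ... | N , close = N , λ m n a b → close-neg (z m) (z n) (close m n a b)

  difference-cauchy : ∀ z w → Cauchy z → Cauchy w → Cauchy (λ n → z n - w n)
  difference-cauchy z w c d ε 0<ε with c (half ε) (half-pos 0<ε) | d (half ε) (half-pos 0<ε)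
  ... | M , p | N , q = M ℕ.⊔ N , λ m n a b → close-+ (z m) (z n) (- w m) (- w n)
    (p m n (ℕ.m⊔n≤o⇒m≤o M N a) (ℕ.m⊔n≤o⇒m≤o M N b))
    (close-neg (w m) (w n) (q m n (ℕ.m⊔n≤o⇒n≤o M N a) (ℕ.m⊔n≤o⇒n≤o M N b)))

  -- The alternatives overlap, which makes the choice computable. Past `N` the sequence moves by
  -- less than `ε/2`, so comparing the rational `z N` with `ε/2` settles it; the gap is `z N - ε/2`.
  sign-split : ∀ z → Cauchy z → ∀ ε → 0ℚ < ε →
    Eventually (λ n → z n < ε) ⊎ (∃[ δ ] (0ℚ < δ × Eventually (λ n → δ < z n)))
  sign-split z c ε 0<ε with c (half ε) (half-pos 0<ε)
  ... | N , close with z N ℚ.≤? half ε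
  ... | yes z≤h = inj₁ (N , λ n N≤n → ≡.subst (z n <_) (half+half ε)
          (ℚ.<-≤-trans (p-q<r⇒p<q+r (z n) (z N) (∣p∣<q⇒p<q (z n - z N) (close n N N≤n ℕ.≤-refl)))
            (ℚ.+-monoˡ-≤ (half ε) z≤h)))
  ... | no  z≰h = inj₂ (z N - half ε
          , ≡.subst (_< z N - half ε) (ℚ.+-inverseʳ (half ε)) (ℚ.+-monoˡ-< (- half ε) (ℚ.≰⇒> z≰h))
          , N , λ n N≤n → p<q+r⇒p-q<r (z N) (half ε)
              (≡.subst (z N <_) (ℚ.+-comm (z n) (half ε))
                (p-q<r⇒p<q+r (z N) (z n) (∣p∣<q⇒p<q (z N - z n) (close N n ℕ.≤-refl N≤n)))))

  compare : ∀ x y ε → 0ℚ < ε →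
    Eventually (λ n → seq x n < seq y n + ε) ⊎ (∃[ δ ] (0ℚ < δ × Eventually (λ n → seq y n + δ < seq x n)))
  compare x y ε 0<ε = [ below-ε , above ]′
    (sign-split (λ n → seq x n - seq y n) (difference-cauchy (seq x) (seq y) (cauchy x) (cauchy y)) ε 0<ε)
    where
    Result : Set
    Result =
      Eventually (λ n → seq x n < seq y n + ε) ⊎ (∃[ δ ] (0ℚ < δ × Eventually (λ n → seq y n + δ < seq x n)))
    below-ε : Eventually (λ n → seq x n - seq y n < ε) → Result
    below-ε (N , lt) = inj₁ (N , λ n N≤n → p-q<r⇒p<q+r (seq x n) (seq y n) (lt n N≤n))
    above : ∃[ δ ] (0ℚ < δ × Eventually (λ n → δ < seq x n - seq y n)) → Result
    above (δ , 0<δ , N , lt) = inj₂ (δ , 0<δ , N , λ n N≤n →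
      ≡.subst (seq y n + δ <_) (q+[p-q]≡p (seq x n) (seq y n)) (ℚ.+-monoʳ-< (seq y n) (lt n N≤n)))

  <⇒≱ : ∀ {x y} → ∃[ δ ] (0ℚ < δ × Eventually (λ n → seq y n + δ < seq x n)) → ¬ x ≤ᵣ y
  <⇒≱ (δ , 0<δ , M , gt) x≤y =
    let N , lt = below x≤y δ 0<δ
    in  ℚ.<-asym (gt (M ℕ.⊔ N) (ℕ.m≤m⊔n M N)) (lt (M ℕ.⊔ N) (ℕ.m≤n⊔m M N))

  <⇒≤ : ∀ {x y} → ∃[ δ ] (0ℚ < δ × Eventually (λ n → seq y n + δ < seq x n)) → y ≤ᵣ x
  <⇒≤ {x} {y} (δ , 0<δ , N , gt) = mk≤ λ ε 0<ε → N , λ n N≤n →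
    ℚ.<-trans (≡.subst (_< seq y n + δ) (ℚ.+-identityʳ (seq y n)) (ℚ.+-monoʳ-< (seq y n) 0<δ))
      (ℚ.<-trans (gt n N≤n) (≡.subst (_< seq x n + ε) (ℚ.+-identityʳ (seq x n)) (ℚ.+-monoʳ-< (seq x n) 0<ε)))

  ≤ᵣ-reflexive : ∀ {x y} → x ≈ᵣ y → x ≤ᵣ y
  ≤ᵣ-reflexive {x} {y} x≈y = mk≤ λ ε 0<ε →
    let N , lt = close x≈y ε 0<ε in N , λ n N≤n → p-q<r⇒p<q+r (seq x n) (seq y n) (∣p∣<q⇒p<q (seq x n - seq y n) (lt n N≤n))

  ≤ᵣ-trans : ∀ {x y z} → x ≤ᵣ y → y ≤ᵣ z → x ≤ᵣ z
  ≤ᵣ-trans {x} {y} {z} x≤y y≤z = mk≤ λ ε 0<ε →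
    (below x≤y (half ε) (half-pos 0<ε) , below y≤z (half ε) (half-pos 0<ε)) ⊔≤ λ n x<y y<z →
      ℚ.<-trans x<y (≡.subst (seq y n + half ε <_)
        (≡.trans (ℚ.+-assoc (seq z n) (half ε) (half ε)) (≡.cong (seq z n +_) (half+half ε)))
        (ℚ.+-monoˡ-< (half ε) y<z))

  ≤ᵣ-antisym : ∀ {x y} → x ≤ᵣ y → y ≤ᵣ x → x ≈ᵣ y
  ≤ᵣ-antisym {x} {y} x≤y y≤x = mk≈ λ ε 0<ε → (below x≤y ε 0<ε , below y≤x ε 0<ε) ⊔≤ λ n x<y y<x →
    ∣p∣<q (seq x n - seq y n) (p<q+r⇒p-q<r (seq x n) (seq y n) x<y)
      (≡.subst (_< ε) (q-p≡-[p-q] (seq x n) (seq y n))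
        (p<q+r⇒p-q<r (seq y n) (seq x n) y<x))

  -- The inequality is a family of instances, one for each `ε`. For each, `compare` yields the
  -- instance or a definite gap, and a gap refutes the inequality.
  ≤ᵣ-stable : ∀ {x y} → ¬ ¬ (x ≤ᵣ y) → x ≤ᵣ y
  ≤ᵣ-stable {x} {y} ¬¬x≤y = mk≤ λ ε 0<ε →
    [ (λ x<y+ε → x<y+ε) , (λ y<x → contradiction (<⇒≱ y<x) ¬¬x≤y) ]′ (compare x y ε 0<ε)

  ≤ᵣ-total : ∀ x y → ¬ ¬ (x ≤ᵣ y ⊎ y ≤ᵣ x)
  ≤ᵣ-total x y k = k (inj₁ (mk≤ λ ε 0<ε →
    [ (λ x<y+ε → x<y+ε) , (λ y<x → contradiction (inj₂ (<⇒≤ y<x)) k) ]′ (compare x y ε 0<ε)))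

  +ᵣ-mono-≤ᵣ : ∀ {x y u v} → x ≤ᵣ y → u ≤ᵣ v → (x +ᵣ u) ≤ᵣ (y +ᵣ v)
  +ᵣ-mono-≤ᵣ {x} {y} {u} {v} x≤y u≤v = mk≤ λ ε 0<ε →
    (below x≤y (half ε) (half-pos 0<ε) , below u≤v (half ε) (half-pos 0<ε)) ⊔≤ λ n x<y u<v →
      ≡.subst (seq x n + seq u n <_)
        (≡.trans (interchange (seq y n) (seq v n) (half ε))
          (≡.cong (seq y n + seq v n +_) (half+half ε)))
        (ℚ.+-mono-< x<y u<v)

  near-zero : ∀ r {ε} → ∣ r ∣ < ε → 0ℚ < r + ε
  near-zero r {ε} ∣r∣<ε =
    p-q<r⇒p<q+r 0ℚ r (≡.subst (_< ε) (≡.sym (ℚ.+-identityˡ (- r))) (∣p∣<q⇒-p<q r ∣r∣<ε))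

  nonpositive-small : ∀ p {α} → p ≤ 0ℚ → 0ℚ < p + α → ∣ p ∣ < α
  nonpositive-small p {α} p≤0 0<p+α =
    ∣p∣<q p (ℚ.≤-<-trans p≤0 (ℚ.<-≤-trans 0<p+α (≡.subst (p + α ≤_) (ℚ.+-identityˡ α) (ℚ.+-monoˡ-≤ α p≤0))))
      (≡.subst (_< α) (ℚ.+-identityˡ (- p)) (p<q+r⇒p-q<r 0ℚ p 0<p+α))

  -- If both factors are nonnegative, so is the product. A nonpositive factor has absolute value
  -- below `α` or `β`, and the bound on the other factor then makes the product smaller than `ε`.
  product-bound : ∀ p q {α β A D ε} → 0ℚ < ε → 0ℚ < A → 0ℚ < D → α * D ≡ ε → β * A ≡ ε →
                  0ℚ < p + α → 0ℚ < q + β → ∣ p ∣ ≤ A → ∣ q ∣ ≤ D → 0ℚ < p * q + ε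
  product-bound p q {ε = ε} 0<ε 0<A 0<D αD βA 0<p+α 0<q+β p≤A q≤D = cases (ℚ.≤-total 0ℚ p) (ℚ.≤-total 0ℚ q)
    where
    cases : 0ℚ ≤ p ⊎ p ≤ 0ℚ → 0ℚ ≤ q ⊎ q ≤ 0ℚ → 0ℚ < p * q + ε
    cases (inj₁ 0≤p) (inj₁ 0≤q) = ℚ.+-mono-≤-< (ℚ.nonNegative⁻¹ (p * q)
      {{ℚ.nonNeg*nonNeg⇒nonNeg p {{ℚ.nonNegative 0≤p}} q {{ℚ.nonNegative 0≤q}}}}) 0<ε
    cases (inj₂ p≤0) _ = near-zero (p * q) (∣*∣-< p q 0<D αD (nonpositive-small p p≤0 0<p+α) q≤D)
    cases (inj₁ _) (inj₂ q≤0) = ≡.subst (λ r → 0ℚ < r + ε) (ℚ.*-comm q p)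
      (near-zero (q * p) (∣*∣-< q p 0<A βA (nonpositive-small q q≤0 0<q+β) p≤A))

  *ᵣ-nonneg : ∀ {x y} → 0ᵣ ≤ᵣ x → 0ᵣ ≤ᵣ y → 0ᵣ ≤ᵣ (x *ᵣ y)
  *ᵣ-nonneg {x} {y} 0≤x 0≤y = mk≤ go
    where
    go : ∀ ε → 0ℚ < ε → Eventually (λ n → 0ℚ < seq x n * seq y n + ε)
    go ε 0<ε =
      let A , 0<A , x≤A = bounded x
          D , 0<D , y≤D = bounded y
          α , 0<α , αD  = quotient ε D 0<ε 0<D
          β , 0<β , βA  = quotient ε A 0<ε 0<A
      in  (((below 0≤x α 0<α , below 0≤y β 0<β) ⊔≤ λ _ → _,_) , ((x≤A , y≤D) ⊔≤ λ _ → _,_)) ⊔≤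
          λ n (0<x+α , 0<y+β) (x≤ , y≤) →
            product-bound (seq x n) (seq y n) 0<ε 0<A 0<D αD βA 0<x+α 0<y+β x≤ y≤

  -- The value at zero is a filler: a sequence bounded away from zero from some index on may still
  -- take the value zero before it.
  reciprocal : ℚ → ℚ
  reciprocal q with q ℚ.≟ 0ℚ
  ... | yes _   = 0ℚ
  ... | no  q≢0 = ℚ.1/_ q {{ℚ.≢-nonZero q≢0}}

  *-reciprocal : ∀ {q} → q ≢ 0ℚ → q * reciprocal q ≡ 1ℚ
  *-reciprocal {q} q≢0 with q ℚ.≟ 0ℚ
  ... | yes q≡0 = contradiction q≡0 q≢0
  ... | no  q≢0 = ℚ.*-inverseʳ q {{ℚ.≢-nonZero q≢0}}

  module Inverse (x : ℝ) {δ B} (0<δ : 0ℚ < δ) (0<B : 0ℚ < B) (Bδ≡1 : B * δ ≡ 1ℚ)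
                 {N} (apart : ∀ n → N ℕ.≤ n → δ < ∣ seq x n ∣) where

    ys : ℕ → ℚ
    ys n = reciprocal (seq x n)

    xy≡1 : ∀ n → N ℕ.≤ n → seq x n * ys n ≡ 1ℚ
    xy≡1 n N≤n = *-reciprocal λ x≡0 →
      ℚ.<-asym 0<δ (≡.subst (δ <_) (≡.cong ∣_∣ x≡0) (apart n N≤n))

    ys-bound : ∀ n → N ℕ.≤ n → ∣ ys n ∣ ≤ B
    ys-bound n N≤n = begin
      ∣ ys n ∣                       ≡⟨ ℚ.*-identityˡ _ ⟨
      1ℚ * ∣ ys n ∣                  ≡⟨ ≡.cong (_* ∣ ys n ∣) Bδ≡1 ⟨
      B * δ * ∣ ys n ∣               ≤⟨ ℚ.*-monoʳ-≤-nonNeg ∣ ys n ∣ (ℚ.*-monoˡ-≤-nonNeg B (ℚ.<⇒≤ (apart n N≤n))) ⟩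
      B * ∣ seq x n ∣ * ∣ ys n ∣     ≡⟨ ℚ.*-assoc B _ _ ⟩
      B * (∣ seq x n ∣ * ∣ ys n ∣)   ≡⟨ ≡.cong (B *_) (ℚ.∣p*q∣≡∣p∣*∣q∣ (seq x n) (ys n)) ⟨
      B * ∣ seq x n * ys n ∣         ≡⟨ ≡.cong (λ r → B * ∣ r ∣) (xy≡1 n N≤n) ⟩
      B * 1ℚ                         ≡⟨ ℚ.*-identityʳ B ⟩
      B                              ∎
      where
      open ℚ.≤-Reasoning
      instance
        B-nonneg : ℚ.NonNegative B
        B-nonneg = ℚ.nonNegative (ℚ.<⇒≤ 0<B)
        y-nonneg : ℚ.NonNegative ∣ ys n ∣
        y-nonneg = ℚ.∣-∣-nonNeg (ys n)

    0<B*B : 0ℚ < B * B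
    0<B*B = ℚ.positive⁻¹ (B * B) {{ℚ.pos*pos⇒pos B {{ℚ.positive 0<B}} B {{ℚ.positive 0<B}}}}

    ys-product-bound : ∀ m n → N ℕ.≤ m → N ℕ.≤ n → ∣ ys m * ys n ∣ ≤ B * B
    ys-product-bound m n N≤m N≤n = begin
      ∣ ys m * ys n ∣      ≡⟨ ℚ.∣p*q∣≡∣p∣*∣q∣ (ys m) (ys n) ⟩
      ∣ ys m ∣ * ∣ ys n ∣  ≤⟨ ℚ.*-monoʳ-≤-nonNeg ∣ ys n ∣ (ys-bound m N≤m) ⟩
      B * ∣ ys n ∣         ≤⟨ ℚ.*-monoˡ-≤-nonNeg B (ys-bound n N≤n) ⟩
      B * B                ∎
      where
      open ℚ.≤-Reasoning
      instance
        B-nonneg : ℚ.NonNegative B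
        B-nonneg = ℚ.nonNegative (ℚ.<⇒≤ 0<B)
        y-nonneg : ℚ.NonNegative ∣ ys n ∣
        y-nonneg = ℚ.∣-∣-nonNeg (ys n)

    -- Carries the Cauchy property from `x` to its reciprocals at the cost of the factor `B * B`.
    difference : ∀ m n → N ℕ.≤ m → N ℕ.≤ n → (seq x n - seq x m) * (ys m * ys n) ≡ ys m - ys n
    difference m n N≤m N≤n = begin
      (seq x n - seq x m) * (ys m * ys n)
        ≡⟨ expand (seq x m) (seq x n) (ys m) (ys n) ⟩
      seq x n * ys n * ys m - seq x m * ys m * ys n
        ≡⟨ ≡.cong₂ (λ p q → p * ys m - q * ys n) (xy≡1 n N≤n) (xy≡1 m N≤m) ⟩
      1ℚ * ys m - 1ℚ * ys n
        ≡⟨ ≡.cong₂ _-_ (ℚ.*-identityˡ (ys m)) (ℚ.*-identityˡ (ys n)) ⟩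
      ys m - ys n ∎
      where open ≡.≡-Reasoning

    y : ℝ
    seq    y = ys
    cauchy y ε 0<ε =
      let η , 0<η , ηBB = quotient ε (B * B) 0<ε 0<B*B
          M , lt        = cauchy x η 0<η
      in  M ℕ.⊔ N , λ m n a b →
          let N≤m = ℕ.m⊔n≤o⇒n≤o M N a
              N≤n = ℕ.m⊔n≤o⇒n≤o M N b
          in  ≡.subst (λ r → ∣ r ∣ < ε) (difference m n N≤m N≤n)
                (∣*∣-< (seq x n - seq x m) (ys m * ys n) 0<B*B ηBB
                  (lt n m (ℕ.m⊔n≤o⇒m≤o M N b) (ℕ.m⊔n≤o⇒m≤o M N a)) (ys-product-bound m n N≤m N≤n))

    x*y≈1 : x *ᵣ y ≈ᵣ 1ᵣ
    x*y≈1 = mk≈ λ ε 0<ε → N , λ n N≤n →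
      ≡.subst (λ r → ∣ r - 1ℚ ∣ < ε) (≡.sym (xy≡1 n N≤n)) (close-refl 1ℚ 0<ε)

  apart⇒invertible : ∀ x {δ N} → 0ℚ < δ → (∀ n → N ℕ.≤ n → δ < ∣ seq x n ∣) → ∃[ y ] x *ᵣ y ≈ᵣ 1ᵣ
  apart⇒invertible x {δ} 0<δ apart with quotient 1ℚ δ (ℚ.positive⁻¹ 1ℚ) 0<δ
  ... | B , 0<B , Bδ≡1 = Inverse.y x 0<δ 0<B Bδ≡1 apart , Inverse.x*y≈1 x 0<δ 0<B Bδ≡1 apart

  -- A gap between `x` and zero on either side would give an inverse. If that is excluded,
  -- `sign-split` applied to `x` and to its negative bounds the absolute value by every `ε`.
  invertibleᵣ : ∀ x → ¬ ¬ (x ≈ᵣ 0ᵣ ⊎ ∃[ y ] x *ᵣ y ≈ᵣ 1ᵣ)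
  invertibleᵣ x k = k (inj₁ (mk≈ go))
    where
    go : ∀ ε → 0ℚ < ε → Eventually (λ n → ∣ seq x n - 0ℚ ∣ < ε)
    go ε 0<ε = both (sign-split (seq x) (cauchy x) ε 0<ε)
                    (sign-split (λ n → - seq x n) (neg-cauchy (seq x) (cauchy x)) ε 0<ε)
      where
      both : Eventually (λ n → seq x n < ε) ⊎ (∃[ δ ] (0ℚ < δ × Eventually (λ n → δ < seq x n))) →
             Eventually (λ n → - seq x n < ε) ⊎ (∃[ δ ] (0ℚ < δ × Eventually (λ n → δ < - seq x n))) →
             Eventually (λ n → ∣ seq x n - 0ℚ ∣ < ε)
      both (inj₁ x<ε) (inj₁ -x<ε) = (x<ε , -x<ε) ⊔≤ λ n p q →
        ≡.subst (λ r → ∣ r ∣ < ε) (≡.sym (ℚ.+-identityʳ (seq x n))) (∣p∣<q (seq x n) p q)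
      both (inj₂ (δ , 0<δ , N , lt)) _ =
        contradiction (inj₂ (apart⇒invertible x 0<δ λ n N≤n → ℚ.<-≤-trans (lt n N≤n) (p≤∣p∣ (seq x n)))) k
      both (inj₁ _) (inj₂ (δ , 0<δ , N , lt)) =
        contradiction (inj₂ (apart⇒invertible x 0<δ λ n N≤n →
          ≡.subst (δ <_) (ℚ.∣-p∣≡∣p∣ (seq x n)) (ℚ.<-≤-trans (lt n N≤n) (p≤∣p∣ (- seq x n))))) k

  1ᵣ≉0ᵣ : ¬ 1ᵣ ≈ᵣ 0ᵣ
  1ᵣ≉0ᵣ 1≈0 with close 1≈0 1ℚ (ℚ.positive⁻¹ 1ℚ)
  ... | N , lt = ℚ.<-irrefl ≡.refl (lt N ℕ.≤-refl)

  ℝ-isWeakOrderedField : IsWeakOrderedField ℝ-commutativeRing _≤ᵣ_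
  ℝ-isWeakOrderedField = record
    { ≤-reflexive = ≤ᵣ-reflexive
    ; ≤-trans     = ≤ᵣ-trans
    ; ≤-antisym   = ≤ᵣ-antisym
    ; ≤-stable    = ≤ᵣ-stable
    ; ≤-total     = ≤ᵣ-total
    ; +-mono-≤    = +ᵣ-mono-≤ᵣ
    ; *-nonneg    = *ᵣ-nonneg
    ; invertible  = invertibleᵣ
    ; 1≉0         = 1ᵣ≉0ᵣ
    }

-- The linear programming bound by the smallest terms.

module PartialSums (R : CommutativeRing 0ℓ 0ℓ) (_≤_ : Rel (CommutativeRing.Carrier R) 0ℓ)
                   (F : IsWeakOrderedField R _≤_) where
  open OrderedField R _≤_ F
  open import Relation.Binary.Reasoning.Setoid setoid

  partial-sum-≤ : ∀ {q n} (q≤n : q ℕ.≤ n) {f h : Vector Carrier n} →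
                  (∀ i → toℕ i ℕ.< q → f i ≤ h i) → (∀ i → q ℕ.≤ toℕ i → 0# ≤ h i) →
                  (∑[ i ] f (inject≤ i q≤n)) ≤ ∑ h
  partial-sum-≤ {zero} q≤n f≤h 0≤h = ≤-resp (sym (∑-empty _)) refl (∑-nonneg λ i → 0≤h i ℕ.z≤n)
  partial-sum-≤ {suc q} {suc n} q≤n f≤h 0≤h = ≤-resp (sym (∑-suc _)) (sym (∑-suc _))
    (+-mono-≤ (f≤h zero (ℕ.s≤s ℕ.z≤n))
      (partial-sum-≤ (s≤s⁻¹ q≤n) (λ i i<q → f≤h (suc i) (ℕ.s≤s i<q)) (λ i q≤i → 0≤h (suc i) (ℕ.s≤s q≤i))))

  *-mono-nonpos : ∀ {x b e} → x ≤ 0# → b ≤ e → (e * x) ≤ (x * b)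
  *-mono-nonpos {x} {b} {e} x≤0 b≤e = 0≤y-x⇒x≤y
    (≤-resp refl (solve 3 (λ x b e → (con ℤ.0ℤ :- x) :* (e :- b) := x :* b :- e :* x) refl x b e)
      (*-nonneg (x≤y⇒0≤y-x x≤0) (x≤y⇒0≤y-x b≤e)))

  -- Linear programming: over weights β ∈ [0, e] of total mass at most c e,
  -- ∑ ν β is minimised by putting mass e on the q smallest ν, for some q ≤ c.
  -- The alternative in the hypothesis covers the descent on c: once ν c ≥ 0 the
  -- bound on the total mass is irrelevant.
  smallest-terms : ∀ {n c e} {ν β : Vector Carrier n} → (∀ i j → i Fin.≤ j → ν i ≤ ν j) →
    (∀ i → 0# ≤ β i) → (∀ i → β i ≤ e) → c ℕ.≤ n →
    (∑ β ≤ (∑[ i ] Vector.replicate c e i)) ⊎ (Σ[ c<n ∈ c ℕ.< n ] 0# ≤ ν (fromℕ< c<n)) →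
    ¬ ¬ (Σ[ q ∈ ℕ ] q ℕ.≤ c × Σ[ q≤n ∈ q ℕ.≤ n ] (∑[ i ] (e * ν (inject≤ i q≤n))) ≤ (∑[ i ] (ν i * β i)))
  smallest-terms {c = zero} {e} {ν} {β} ν↗ 0≤β β≤e c≤n hyp =
    pure (0 , ℕ.z≤n , ℕ.z≤n , partial-sum-≤ ℕ.z≤n {λ i → e * ν i} (λ _ ()) λ i _ → nonneg hyp i)
    where
    nonneg : (∑ β ≤ (∑[ i ] Vector.replicate 0 e i)) ⊎ (Σ[ c<n ∈ 0 ℕ.< _ ] 0# ≤ ν (fromℕ< c<n)) → ∀ i → 0# ≤ (ν i * β i)
    nonneg (inj₁ ∑β≤0) i = ≤-reflexive (sym (trans (*-congˡ
      (∑-zero-terms 0≤β (≤-trans ∑β≤0 (≤-reflexive (∑-empty _))) i)) (zeroʳ _)))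
    nonneg (inj₂ (c<n , 0≤ν)) i = *-nonneg
      (≤-trans 0≤ν (ν↗ _ i (≡.subst (ℕ._≤ toℕ i) (≡.sym (Fin.toℕ-fromℕ< c<n)) ℕ.z≤n))) (0≤β i)
  smallest-terms {c = suc c} {e} {ν} {β} ν↗ 0≤β β≤e c<n hyp = ≤-total 0# t >>= λ
    { (inj₁ 0≤t) → smallest-terms ν↗ 0≤β β≤e (ℕ.<⇒≤ c<n) (inj₂ (c<n , 0≤t)) >>= λ
        { (q , q≤c , rest) → pure (q , ℕ.m≤n⇒m≤1+n q≤c , rest) }
    ; (inj₂ t≤0) → pure (suc c , ℕ.≤-refl , c<n , [ bounded-mass t≤0 , nonneg-tail t≤0 ]′ hyp) }
    where
    t : Carrier
    t = ν (fromℕ< c<n)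
    ν≤t : ∀ i → toℕ i ℕ.< suc c → ν i ≤ t
    ν≤t i i≤c = ν↗ i _ (≡.subst (toℕ i ℕ.≤_) (≡.sym (Fin.toℕ-fromℕ< c<n)) (s≤s⁻¹ i≤c))
    t≤ν : ∀ i → suc c ℕ.≤ toℕ i → t ≤ ν i
    t≤ν i c<i = ν↗ _ i (≡.subst (ℕ._≤ toℕ i) (≡.sym (Fin.toℕ-fromℕ< c<n)) (ℕ.<⇒≤ c<i))
    nonneg-tail : t ≤ 0# → Σ[ c<n ∈ suc c ℕ.< _ ] 0# ≤ ν (fromℕ< c<n) →
                  (∑[ i ] (e * ν (inject≤ i c<n))) ≤ (∑[ i ] (ν i * β i))
    nonneg-tail t≤0 (1+c<n , 0≤ν) = partial-sum-≤ c<n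
      (λ i i≤c → *-mono-nonpos (≤-trans (ν≤t i i≤c) t≤0) (β≤e i))
      (λ i c<i → *-nonneg (≤-trans 0≤ν (ν↗ _ i (≡.subst (ℕ._≤ toℕ i) (≡.sym (Fin.toℕ-fromℕ< 1+c<n)) c<i))) (0≤β i))
    -- A Lagrange multiplier argument with multiplier `t`. The shifted terms `ν i - t` are
    -- nonpositive up to index `c` and nonnegative beyond, so full weight on the former is optimal.
    -- Undoing the shift is safe because `t ≤ 0` and `∑ β` is at most `mass`.
    bounded-mass : t ≤ 0# → ∑ β ≤ (∑[ i ] Vector.replicate (suc c) e i) →
                   (∑[ i ] (e * ν (inject≤ i c<n))) ≤ (∑[ i ] (ν i * β i))
    bounded-mass t≤0 ∑β≤ = ≤-trans (≤-resp shifted refl (+-mono-≤ below-t (≤-refl {x = t * mass})))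
      (≤-resp refl (solve 2 (λ x y → x :- y :+ y := x) refl _ _)
        (+-mono-≤ (≤-refl {x = ∑[ i ] (ν i * β i) - t * ∑ β})
          (0≤y-x⇒x≤y (≤-resp refl
            (solve 3 (λ t m b → (con ℤ.0ℤ :- t) :* (m :- b) := t :* b :- t :* m) refl t mass (∑ β))
            (*-nonneg (x≤y⇒0≤y-x t≤0) (x≤y⇒0≤y-x ∑β≤))))))
      where
      mass : Carrier
      mass = ∑[ i ] Vector.replicate (suc c) e i
      below-t : (∑[ i ] (e * (ν (inject≤ i c<n) - t))) ≤ (∑[ i ] (ν i * β i) - t * ∑ β)
      below-t = ≤-resp refl
        (trans (∑-cong λ i → solve 3 (λ v t b → (v :- t) :* b := v :* b :- t :* b) refl (ν i) t (β i))
          (trans ∑-- (+-congˡ (-‿cong ∑-*ˡ))))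
        (partial-sum-≤ c<n {λ i → e * (ν i - t)} {λ i → (ν i - t) * β i}
          (λ i i≤c → *-mono-nonpos
            (≤-resp refl (-‿inverseʳ t) (+-mono-≤ (ν≤t i i≤c) (≤-refl {x = - t}))) (β≤e i))
          (λ i c<i → *-nonneg (x≤y⇒0≤y-x (t≤ν i c<i)) (0≤β i)))
      shifted : ∑[ i ] (e * (ν (inject≤ i c<n) - t)) + t * mass ≈ ∑[ i ] (e * ν (inject≤ i c<n))
      shifted = begin
        ∑[ i ] (e * (ν (inject≤ i c<n) - t)) + t * mass
          ≈⟨ +-congˡ ∑-*ˡ ⟨
        ∑[ i ] (e * (ν (inject≤ i c<n) - t)) + ∑[ i ] (t * Vector.replicate (suc c) e i)
          ≈⟨ ∑-+ ⟨
        ∑[ i ] (e * (ν (inject≤ i c<n) - t) + t * e)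
          ≈⟨ ∑-cong (λ i → solve 3 (λ e v t → e :* (v :- t) :+ t :* e := e :* v) refl e _ t) ⟩
        ∑[ i ] (e * ν (inject≤ i c<n)) ∎

-- The trace inequality for a real coloring.

module ColoringBound (R : CommutativeRing 0ℓ 0ℓ) (_≤_ : Rel (CommutativeRing.Carrier R) 0ℓ)
                     (F : IsWeakOrderedField R _≤_) where
  open OrderedField R _≤_ F
  open SpectralTheorem R _≤_ F using (Eigenbasis; ones; ones-positive; eigenbasis; _·_; ·-∑)
  open PartialSums R _≤_ F using (smallest-terms)
  open import Relation.Binary.Reasoning.Setoid setoid

  tensor : ∀ {n e} → InnerProduct (Fin n × Fin e)
  tensor = record
    { ⟨_,_⟩       = λ X Y → ∑[ v ] ∑[ a ] (X (v , a) * Y (v , a))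
    ; ip-cong     = λ X≈Y Z≈W → ∑-cong λ v → ∑-cong λ a → *-cong (X≈Y (v , a)) (Z≈W (v , a))
    ; ip-comm     = λ X Y → ∑-cong λ v → ∑-cong λ a → *-comm _ _
    ; ip-linear   = λ c X Y Z → trans
        (∑-cong λ v → trans (∑-cong λ a → trans (distribʳ _ _ _) (+-congʳ (*-assoc _ _ _))) (trans ∑-+ (+-congʳ ∑-*ˡ)))
        (trans ∑-+ (+-congʳ ∑-*ˡ))
    ; ip-nonneg   = λ X → ∑-nonneg (rows-nonneg X)
    ; ip-definite = λ {X} XX≈0 (v , a) → square-zero (∑-zero-terms (λ a → square-nonneg (X (v , a)))
        (≤-reflexive (∑-zero-terms (rows-nonneg X) (≤-reflexive XX≈0) v)) a)
    }
    where
    rows-nonneg : ∀ X v → 0# ≤ (∑[ a ] (X (v , a) * X (v , a)))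
    rows-nonneg X v = ∑-nonneg λ a → square-nonneg (X (v , a))

  -- The graph enters through the factor `A v w` in `orthogonal`: it is zero at a non-edge, and at
  -- an edge the product of projectors is zero.
  record RealColoring {n} (A : Matrix n n) (c e : ℕ) : Set where
    field
      P          : Fin n → Fin c → Matrix e e
      symmetric  : ∀ v k a b → P v k a b ≈ P v k b a
      idempotent : ∀ v k a b → ∑[ j ] (P v k a j * P v k j b) ≈ P v k a b
      complete   : ∀ v a b → ∑[ k ] P v k a b ≈ 1ₘ a b
      orthogonal : ∀ v w k a b → A v w * ∑[ j ] (P v k a j * P w k j b) ≈ 0#

  module Trace {m c e} {A : Matrix (suc m) (suc m)} (Q : RealColoring A c e)
               {μ : Vector Carrier (suc m)} (E : Eigenbasis ones ones-positive A μ) where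
    open RealColoring Q
    private module E = Eigenbasis E
    open E using (z; σ)
    open InnerProduct (tensor {suc m} {e})
    open Orthogonalization (tensor {suc m} {e})

    Tensor : Set
    Tensor = Fin (suc m) × Fin e → Carrier

    D : Fin c → Tensor → Tensor
    D k X (v , a) = ∑[ b ] (P v k a b * X (v , b))

    D-self-adjoint : ∀ k X Y → ⟨ D k X , Y ⟩ ≈ ⟨ X , D k Y ⟩
    D-self-adjoint k X Y = ∑-cong λ v → begin
      ∑[ a ] (∑[ b ] (P v k a b * X (v , b)) * Y (v , a))    ≈⟨ ∑-cong (λ a → sym ∑-*ʳ) ⟩
      ∑[ a ] ∑[ b ] (P v k a b * X (v , b) * Y (v , a))      ≈⟨ ∑-swap ⟩
      ∑[ b ] ∑[ a ] (P v k a b * X (v , b) * Y (v , a))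
        ≈⟨ ∑-cong (λ b → trans (∑-cong λ a → trans (*-congʳ (*-congʳ (symmetric v k a b)))
             (solve 3 (λ p x y → p :* x :* y := x :* (p :* y)) refl _ _ _)) ∑-*ˡ) ⟩
      ∑[ b ] (X (v , b) * ∑[ a ] (P v k b a * Y (v , a)))    ∎

    D-idempotent : ∀ k X va → D k (D k X) va ≈ D k X va
    D-idempotent k X (v , a) = begin
      ∑[ b ] (P v k a b * ∑[ a′ ] (P v k b a′ * X (v , a′)))   ≈⟨ ∑-cong (λ b → sym ∑-*ˡ) ⟩
      ∑[ b ] ∑[ a′ ] (P v k a b * (P v k b a′ * X (v , a′)))   ≈⟨ ∑-swap ⟩
      ∑[ a′ ] ∑[ b ] (P v k a b * (P v k b a′ * X (v , a′)))
        ≈⟨ ∑-cong (λ a′ → trans (∑-cong λ b → sym (*-assoc _ _ _)) (trans ∑-*ʳ (*-congʳ (idempotent v k a a′)))) ⟩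
      ∑[ a′ ] (P v k a a′ * X (v , a′))                        ∎

    D-complete : ∀ X va → ∑[ k ] D k X va ≈ X va
    D-complete X (v , a) = begin
      ∑[ k ] ∑[ b ] (P v k a b * X (v , b))    ≈⟨ ∑-swap ⟩
      ∑[ b ] ∑[ k ] (P v k a b * X (v , b))    ≈⟨ ∑-cong (λ b → trans ∑-*ʳ (*-congʳ (complete v a b))) ⟩
      ∑[ b ] (1ₘ a b * X (v , b))              ≈⟨ ∑-1ₘˡ ⟩
      X (v , a)                                ∎

    -- Each term equals `⟨ X , D k X ⟩`, and the `D k` sum to the identity.
    ∥D∥² : ∀ X → ∑[ k ] ⟨ D k X , D k X ⟩ ≈ ⟨ X , X ⟩
    ∥D∥² X = begin
      ∑[ k ] ⟨ D k X , D k X ⟩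
        ≈⟨ ∑-cong (λ k → trans (D-self-adjoint k X (D k X)) (ip-congʳ X (D-idempotent k X))) ⟩
      ∑[ k ] ⟨ X , D k X ⟩
        ≈⟨ ∑-cong (λ k → *-identityˡ _) ⟨
      ∑[ k ] (1# * ⟨ X , D k X ⟩)
        ≈⟨ ip-∑ʳ (λ _ → 1#) (λ k → D k X) X ⟨
      ⟨ X , (λ va → ∑[ k ] (1# * D k X va)) ⟩
        ≈⟨ ip-congʳ X (λ va → trans (∑-cong λ k → *-identityˡ _) (D-complete X va)) ⟩
      ⟨ X , X ⟩ ∎

    z⊗ : Fin (suc m) → Fin e → Tensor
    z⊗ i b (v , a) = z i v * 1ₘ a b

    ip-z⊗ : ∀ i b Y → ⟨ z⊗ i b , Y ⟩ ≈ E.⟨ (λ v → Y (v , b)) , z i ⟩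
    ip-z⊗ i b Y = ∑-cong λ v → begin
      ∑[ a ] (z i v * 1ₘ a b * Y (v , a))
        ≈⟨ ∑-cong (λ a → solve 3 (λ z d y → z :* d :* y := z :* y :* d) refl _ _ _) ⟩
      ∑[ a ] (z i v * Y (v , a) * 1ₘ a b)    ≈⟨ ∑-1ₘʳ ⟩
      z i v * Y (v , b)                      ≈⟨ trans (*-comm _ _) (sym (*-identityˡ _)) ⟩
      1# * (Y (v , b) * z i v)               ∎

    ∥z⊗∥² : ∀ i b → ⟨ z⊗ i b , z⊗ i b ⟩ ≈ E.⟨ z i , z i ⟩
    ∥z⊗∥² i b = trans (ip-z⊗ i b (z⊗ i b))
      (E.ip-congˡ (z i) λ v → trans (*-congˡ (1ₘ-diagonal b)) (*-identityʳ _))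

    -- The vectors `D k (z⊗ zero b)` with `D k` written out. There are `e` of them for each of the
    -- `c` colors, which is where the bound on the dimension of W comes from.
    generators : Fin c → Fin e → Tensor
    generators k b (v , a) = z zero v * P v k a b

    D-z⊗ : ∀ k b va → D k (z⊗ zero b) va ≈ generators k b va
    D-z⊗ k b (v , a) = begin
      ∑[ a′ ] (P v k a a′ * (z zero v * 1ₘ a′ b))
        ≈⟨ ∑-cong (λ a′ → solve 3 (λ p z d → p :* (z :* d) := z :* p :* d) refl _ _ _) ⟩
      ∑[ a′ ] (z zero v * P v k a a′ * 1ₘ a′ b)      ≈⟨ ∑-1ₘʳ {f = λ a′ → z zero v * P v k a a′} ⟩
      z zero v * P v k a b                           ∎

    D-generators : ∀ k b va → D k (generators k b) va ≈ generators k b va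
    D-generators k b (v , a) = begin
      ∑[ a′ ] (P v k a a′ * (z zero v * P v k a′ b))
        ≈⟨ trans (∑-cong λ a′ → solve 3 (λ p z q → p :* (z :* q) := z :* (p :* q)) refl _ _ _) ∑-*ˡ ⟩
      z zero v * ∑[ a′ ] (P v k a a′ * P v k a′ b)   ≈⟨ *-congˡ (idempotent v k a b) ⟩
      z zero v * P v k a b                           ∎

    -- The factor `1#` gives this the shape of `∑φα` at `φ = ones`, just as `quadratic-A` has its
    -- shape at `φ = μ`.
    quadratic : ∀ y → ∑[ i ] (1# * σ i * (E.⟨ y , z i ⟩ * E.⟨ y , z i ⟩)) ≈ E.⟨ y , y ⟩
    quadratic y = sym (trans (E.ip-congʳ y (E.complete y)) (trans (E.ip-∑ʳ _ z y)
      (∑-cong λ i → solve 2 (λ s x → s :* x :* x := con ℤ.1ℤ :* s :* (x :* x)) refl _ _)))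

    quadratic-A : ∀ y → ∑[ i ] (μ i * σ i * (E.⟨ y , z i ⟩ * E.⟨ y , z i ⟩)) ≈ E.⟨ y , A · y ⟩
    quadratic-A y = sym (begin
      E.⟨ y , A · y ⟩
        ≈⟨ E.ip-congʳ y (λ a → trans (∑-cong λ b → *-congˡ (E.complete y b)) (·-∑ A _ z a)) ⟩
      E.⟨ y , (λ a → ∑[ i ] (σ i * E.⟨ y , z i ⟩ * (A · z i) a)) ⟩
        ≈⟨ E.ip-∑ʳ _ (λ i → A · z i) y ⟩
      ∑[ i ] (σ i * E.⟨ y , z i ⟩ * E.⟨ y , A · z i ⟩)
        ≈⟨ ∑-cong (λ i → trans (*-congˡ (ip-eigen i)) (solve 3 (λ s x m → s :* x :* (m :* x) := m :* s :* (x :* x)) refl _ _ _)) ⟩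
      ∑[ i ] (μ i * σ i * (E.⟨ y , z i ⟩ * E.⟨ y , z i ⟩)) ∎)
      where
      ip-eigen : ∀ i → E.⟨ y , A · z i ⟩ ≈ μ i * E.⟨ y , z i ⟩
      ip-eigen i = trans (E.ip-congʳ y (E.eigen i))
        (trans (∑-cong λ a → solve 3 (λ y m z → con ℤ.1ℤ :* (y :* (m :* z)) := m :* (con ℤ.1ℤ :* (y :* z))) refl _ _ _) ∑-*ˡ)

    module _ (S : ∀ k → OrthogonalSystem (generators k)) where
      private module S k = OrthogonalSystem (S k)

      u : Fin c → Fin e → Tensor
      u k j = S.u k j

      D-u : ∀ k j va → D k (u k j) va ≈ u k j va
      D-u k j (v , a) = begin
        ∑[ b ] (P v k a b * u k j (v , b))
          ≈⟨ ∑-cong (λ b → *-congˡ (S.combination k j (v , b))) ⟩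
        ∑[ b ] (P v k a b * ∑[ l ] (S.coefficients k j l * generators k l (v , b)))
          ≈⟨ ∑-cong (λ b → sym ∑-*ˡ) ⟩
        ∑[ b ] ∑[ l ] (P v k a b * (S.coefficients k j l * generators k l (v , b)))
          ≈⟨ ∑-swap ⟩
        ∑[ l ] ∑[ b ] (P v k a b * (S.coefficients k j l * generators k l (v , b)))
          ≈⟨ ∑-cong (λ l → trans (∑-cong λ b → solve 3 (λ p s g → p :* (s :* g) := s :* (p :* g)) refl _ _ _)
               (trans ∑-*ˡ (*-congˡ (D-generators k l (v , a))))) ⟩
        ∑[ l ] (S.coefficients k j l * generators k l (v , a))
          ≈⟨ S.combination k j (v , a) ⟨
        u k j (v , a) ∎

      column : Fin c → Fin e → Fin e → Vector Carrier (suc m)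
      column k j b v = u k j (v , b)

      -- By `ip-z⊗` this is the inner product of `z⊗ i b` with `u k j`.
      amplitude : Fin (suc m) → Fin e → Fin c → Fin e → Carrier
      amplitude i b k j = E.⟨ column k j b , z i ⟩

      -- The trace of the projection onto ⊕ₖ span (generators k) restricted to
      -- the block z i ⊗ Rᵉ.
      α : Vector Carrier (suc m)
      α i = ∑[ b ] ∑[ k ] (σ i * S.bessel-sum k (z⊗ i b))

      bessel-D : ∀ k X → S.bessel-sum k X ≈ S.bessel-sum k (D k X)
      bessel-D k X = ∑-cong λ j → *-congˡ (*-cong (moved j) (moved j))
        where
        moved : ∀ j → ⟨ X , u k j ⟩ ≈ ⟨ D k X , u k j ⟩
        moved j = trans (ip-congʳ X λ va → sym (D-u k j va)) (sym (D-self-adjoint k X (u k j)))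

      bessel-cong : ∀ k {X Y} → (∀ va → X va ≈ Y va) → S.bessel-sum k X ≈ S.bessel-sum k Y
      bessel-cong k X≈Y = ∑-cong λ j → *-congˡ (*-cong (ip-congˡ _ X≈Y) (ip-congˡ _ X≈Y))

      σ-nonneg : ∀ i → 0# ≤ σ i
      σ-nonneg i = inverse-nonneg (E.normalized i) (E.ip-nonneg (z i))

      σ∥z⊗∥² : ∀ i b → σ i * ⟨ z⊗ i b , z⊗ i b ⟩ ≈ 1#
      σ∥z⊗∥² i b = trans (*-congˡ (∥z⊗∥² i b)) (E.normalized i)

      α-nonneg : ∀ i → 0# ≤ α i
      α-nonneg i = ∑-nonneg λ b → ∑-nonneg λ k → *-nonneg (σ-nonneg i)
        (∑-nonneg λ j → *-nonneg (S.τ-nonneg k j) (square-nonneg _))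

      -- Bessel's inequality in color `k` bounds the term by the squared norm of `D k (z⊗ i b)`.
      -- Over all colors these add up to that of `z⊗ i b`, which `σ i` scales to one for each of the
      -- `e` values of `b`.
      α≤e : ∀ i → α i ≤ (∑[ b ] Vector.replicate e 1# b)
      α≤e i = ∑-mono-≤ λ b → ≤-resp (sym ∑-*ˡ) (trans (*-congˡ (∥D∥² (z⊗ i b))) (σ∥z⊗∥² i b))
        (*-monoˡ-≤ (σ-nonneg i) (∑-mono-≤ λ k →
          ≤-resp (sym (bessel-D k (z⊗ i b))) refl (S.bessel k (D k (z⊗ i b)))))

      -- The bound of `α≤e` is attained, since `D k (z⊗ zero b)` is a generator and Bessel's
      -- inequality is an equality on the span.
      α₀≈e : α zero ≈ ∑[ b ] Vector.replicate e 1# b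
      α₀≈e = ∑-cong λ b → begin
        ∑[ k ] (σ zero * S.bessel-sum k (z⊗ zero b))
          ≈⟨ ∑-*ˡ ⟩
        σ zero * ∑[ k ] S.bessel-sum k (z⊗ zero b)
          ≈⟨ *-congˡ (∑-cong λ k → begin
               S.bessel-sum k (z⊗ zero b)                    ≈⟨ bessel-D k (z⊗ zero b) ⟩
               S.bessel-sum k (D k (z⊗ zero b))              ≈⟨ bessel-cong k (D-z⊗ k b) ⟩
               S.bessel-sum k (generators k b)               ≈⟨ S.parseval k (generators k b) (S.expansion k b) ⟩
               ⟨ generators k b , generators k b ⟩           ≈⟨ ip-cong (D-z⊗ k b) (D-z⊗ k b) ⟨
               ⟨ D k (z⊗ zero b) , D k (z⊗ zero b) ⟩         ∎) ⟩
        σ zero * ∑[ k ] ⟨ D k (z⊗ zero b) , D k (z⊗ zero b) ⟩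
          ≈⟨ *-congˡ (∥D∥² (z⊗ zero b)) ⟩
        σ zero * ⟨ z⊗ zero b , z⊗ zero b ⟩
          ≈⟨ σ∥z⊗∥² zero b ⟩
        1# ∎

      -- The same trace computed in the basis `u` of W instead of the basis `z⊗`. Taking `φ = ones`
      -- gives the total mass of `α`, and `φ = μ` gives the trace of `A ⊗ I` on W.
      ∑φα : ∀ (φ : Vector Carrier (suc m)) → ∑[ i ] (φ i * α i) ≈
            ∑[ k ] ∑[ j ] (S.τ k j * ∑[ b ] ∑[ i ] (φ i * σ i * (amplitude i b k j * amplitude i b k j)))
      ∑φα φ = begin
        ∑[ i ] (φ i * α i)
          ≈⟨ ∑-cong (λ i → trans (sym ∑-*ˡ) (∑-cong λ b → trans (sym ∑-*ˡ) (∑-cong λ k → push i b k))) ⟩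
        ∑[ i ] ∑[ b ] ∑[ k ] ∑[ j ] term i b k j
          ≈⟨ ∑-swap ⟩
        ∑[ b ] ∑[ i ] ∑[ k ] ∑[ j ] term i b k j
          ≈⟨ ∑-cong (λ b → trans ∑-swap (∑-cong λ k → ∑-swap)) ⟩
        ∑[ b ] ∑[ k ] ∑[ j ] ∑[ i ] term i b k j
          ≈⟨ trans ∑-swap (∑-cong λ k → ∑-swap) ⟩
        ∑[ k ] ∑[ j ] ∑[ b ] ∑[ i ] term i b k j
          ≈⟨ ∑-cong (λ k → ∑-cong λ j → trans (∑-cong λ b → ∑-*ˡ) ∑-*ˡ) ⟩
        ∑[ k ] ∑[ j ] (S.τ k j * ∑[ b ] ∑[ i ] (φ i * σ i * (amplitude i b k j * amplitude i b k j))) ∎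
        where
        term : Fin (suc m) → Fin e → Fin c → Fin e → Carrier
        term i b k j = S.τ k j * (φ i * σ i * (amplitude i b k j * amplitude i b k j))
        push : ∀ i b k → φ i * (σ i * S.bessel-sum k (z⊗ i b)) ≈ ∑[ j ] term i b k j
        push i b k = begin
          φ i * (σ i * S.bessel-sum k (z⊗ i b))
            ≈⟨ *-assoc _ _ _ ⟨
          φ i * σ i * S.bessel-sum k (z⊗ i b)
            ≈⟨ ∑-*ˡ ⟨
          ∑[ j ] (φ i * σ i * (S.τ k j * (⟨ z⊗ i b , u k j ⟩ * ⟨ z⊗ i b , u k j ⟩)))
            ≈⟨ ∑-cong (λ j → trans (*-congˡ (*-congˡ (*-cong (ip-z⊗ i b (u k j)) (ip-z⊗ i b (u k j)))))
                 (solve 3 (λ p t x → p :* (t :* x) := t :* (p :* x)) refl _ _ _)) ⟩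
          ∑[ j ] term i b k j ∎

      -- At `φ = ones` the inner sums are the squared norms of the `u k j`, and each of these `c e`
      -- vectors contributes at most one after weighting.
      ∑α≤ : ∑ α ≤ (∑[ k ] Vector.replicate c (∑[ b ] Vector.replicate e 1# b) k)
      ∑α≤ = ≤-resp
        (trans (∑-cong λ k → ∑-cong λ j → *-congˡ (norm k j)) (trans (sym (∑φα ones)) (∑-cong λ i → *-identityˡ _))) refl
        (∑-mono-≤ λ k → ∑-mono-≤ λ j → S.τ∥u∥²≤1 k j)
        where
        norm : ∀ k j → ⟨ u k j , u k j ⟩ ≈ ∑[ b ] ∑[ i ] (1# * σ i * (amplitude i b k j * amplitude i b k j))
        norm k j = trans ∑-swap (∑-cong λ b → trans (∑-cong λ v → sym (*-identityˡ _)) (sym (quadratic (column k j b))))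

      -- The compression of A ⊗ I to each colour vanishes.
      ∑μα≈0 : ∑[ i ] (μ i * α i) ≈ 0#
      ∑μα≈0 = trans (∑φα μ) (∑-0 λ k → ∑-0 λ j → trans (*-congˡ (begin
        ∑[ b ] ∑[ i ] (μ i * σ i * (amplitude i b k j * amplitude i b k j))
          ≈⟨ ∑-cong (λ b → quadratic-A (column k j b)) ⟩
        ∑[ b ] ∑[ v ] (1# * (u k j (v , b) * ∑[ w ] (A v w * u k j (w , b))))
          ≈⟨ ∑-swap ⟩
        ∑[ v ] ∑[ b ] (1# * (u k j (v , b) * ∑[ w ] (A v w * u k j (w , b))))
          ≈⟨ ∑-cong (λ v → trans (∑-cong λ b → trans (*-identityˡ _) (sym ∑-*ˡ)) ∑-swap) ⟩
        ∑[ v ] ∑[ w ] ∑[ b ] (u k j (v , b) * (A v w * u k j (w , b)))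
          ≈⟨ ∑-0 (λ v → ∑-0 λ w → block k j v w) ⟩
        0# ∎)) (zeroʳ _))
        where
        -- Replacing both columns by their images under `D k` exposes the product of `P v k` and
        -- `P w k`, which vanishes together with the factor `A v w`.
        block : ∀ k j v w → ∑[ b ] (u k j (v , b) * (A v w * u k j (w , b))) ≈ 0#
        block k j v w = begin
          ∑[ b ] (u k j (v , b) * (A v w * u k j (w , b)))
            ≈⟨ ∑-cong (λ b → *-cong (D-u k j (v , b)) (*-congˡ (D-u k j (w , b)))) ⟨
          ∑[ b ] (∑[ a ] (P v k b a * u k j (v , a)) * (A v w * ∑[ a′ ] (P w k b a′ * u k j (w , a′))))
            ≈⟨ ∑-cong (λ b → trans (sym ∑-*ʳ) (∑-cong λ a → trans (*-congˡ (sym ∑-*ˡ)) (sym ∑-*ˡ))) ⟩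
          ∑[ b ] ∑[ a ] ∑[ a′ ] (P v k b a * u k j (v , a) * (A v w * (P w k b a′ * u k j (w , a′))))
            ≈⟨ trans ∑-swap (∑-cong λ a → ∑-swap) ⟩
          ∑[ a ] ∑[ a′ ] ∑[ b ] (P v k b a * u k j (v , a) * (A v w * (P w k b a′ * u k j (w , a′))))
            ≈⟨ ∑-0 (λ a → ∑-0 λ a′ → begin
                 ∑[ b ] (P v k b a * u k j (v , a) * (A v w * (P w k b a′ * u k j (w , a′))))
                   ≈⟨ ∑-cong (λ b → trans (*-congʳ (*-congʳ (symmetric v k b a)))
                        (solve 5 (λ p x m q y → p :* x :* (m :* (q :* y)) := x :* y :* m :* (p :* q)) refl _ _ _ _ _)) ⟩
                 ∑[ b ] (u k j (v , a) * u k j (w , a′) * A v w * (P v k a b * P w k b a′))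
                   ≈⟨ ∑-*ˡ ⟩
                 u k j (v , a) * u k j (w , a′) * A v w * ∑[ b ] (P v k a b * P w k b a′)
                   ≈⟨ *-assoc _ _ _ ⟩
                 u k j (v , a) * u k j (w , a′) * (A v w * ∑[ b ] (P v k a b * P w k b a′))
                   ≈⟨ trans (*-congˡ (orthogonal v w k a a′)) (zeroʳ _) ⟩
                 0# ∎) ⟩
          0# ∎

  module _ {m c e} {A : Matrix (suc m) (suc m)} (A-sym : ∀ v w → A v w ≈ A w v)
           {μ : Vector Carrier (suc m)} (spectrum : IsEigenvalueList A μ)
           (μ↘ : ∀ i j → i Fin.≤ j → μ j ≤ μ i) (Q : RealColoring A (suc c) (suc e)) (c≤n : c ℕ.≤ suc m) where

    private
      ē : Carrier
      ē = ∑[ b ] Vector.replicate (suc e) 1# b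

      1≤ē : 1# ≤ ē
      1≤ē = term≤∑ {f = Vector.replicate (suc e) 1#} (λ _ → 0≤1) zero

      cancel-ē : ∀ {x} → (ē * x) ≤ 0# → x ≤ 0#
      cancel-ē {x} ēx≤0 = ≤-stable (invertible ē >>= λ
        { (inj₁ ē≈0) → contradiction (≤-antisym (≤-resp refl ē≈0 1≤ē) 0≤1) 1≉0
        ; (inj₂ (t , ēt≈1)) → pure (≤-resp
            (trans (sym (*-assoc _ _ _)) (trans (*-congʳ (trans (*-comm _ _) ēt≈1)) (*-identityˡ x)))
            (zeroʳ t)
            (*-monoˡ-≤ (inverse-nonneg (trans (*-comm _ _) ēt≈1) (≤-trans 0≤1 1≤ē)) ēx≤0)) })

      opposite-antitone : ∀ {i j : Fin (suc m)} → i Fin.≤ j → opposite j Fin.≤ opposite i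
      opposite-antitone {i} {j} i≤j =
        ≡.subst₂ ℕ._≤_ (≡.sym (Fin.opposite-prop j)) (≡.sym (Fin.opposite-prop i)) (ℕ.∸-monoʳ-≤ (suc m) (ℕ.s≤s i≤j))

    coloring-bound :
      ¬ ¬ (Σ[ q ∈ ℕ ] q ℕ.≤ c × Σ[ q≤n ∈ q ℕ.≤ suc m ] (μ zero + ∑[ i ] μ (opposite (inject≤ i q≤n))) ≤ 0#)
    coloring-bound = do
      E ← eigenbasis ones-positive (λ a b → *-congˡ (A-sym a b)) spectrum
      S ← ¬¬-∀ λ k → Orthogonalization.gram-schmidt tensor (Trace.generators Q E k)
      q , q≤c , q≤n , lower ← weights E S
      pure (q , q≤c , q≤n , cancel-ē (≤-resp (finish q≤n) (-‿inverseʳ _)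
        (+-mono-≤ lower (≤-refl {x = - (- (μ zero * ē))}))))
      where
      finish : ∀ {q} (q≤n : q ℕ.≤ suc m) →
        ∑[ i ] (ē * μ (opposite (inject≤ i q≤n))) - - (μ zero * ē) ≈ ē * (μ zero + ∑[ i ] μ (opposite (inject≤ i q≤n)))
      finish q≤n = trans (+-congʳ ∑-*ˡ)
        (solve 3 (λ e s x → e :* s :- (:- (x :* e)) := e :* (x :+ s)) refl ē _ (μ zero))

      weights : (E : Eigenbasis ones ones-positive A μ) →
        (∀ k → Orthogonalization.OrthogonalSystem tensor (Trace.generators Q E k)) →
        ¬ ¬ (Σ[ q ∈ ℕ ] q ℕ.≤ c × Σ[ q≤n ∈ q ℕ.≤ suc m ]
               (∑[ i ] (ē * μ (opposite (inject≤ i q≤n)))) ≤ (- (μ zero * ē)))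
      weights E S = smallest-terms {ν = μ ∘ opposite} {β = β ∘ opposite} (λ i j i≤j → μ↘ _ _ (opposite-antitone i≤j))
        (β-nonneg ∘ opposite) (β≤ē ∘ opposite) c≤n (inj₁ (≤-resp (sym (∑-opposite {f = β})) refl mass)) >>= λ
        { (q , q≤c , q≤n , lower) → pure (q , q≤c , q≤n , ≤-resp refl (trans (∑-opposite {f = λ i → μ i * β i}) value) lower) }
        where
        open Trace Q E using (α; α-nonneg; α≤e; α₀≈e; ∑α≤; ∑μα≈0)
        -- The weight of `μ zero` is set to zero instead of dropping the index, so that the
        -- minimisation runs over all eigenvalues in ascending order. This removes exactly `ē` from
        -- the mass and `μ zero * ē` from the trace.
        β : Vector Carrier (suc m)
        β = 0# Vector.∷ α S ∘ suc
        β-nonneg : ∀ i → 0# ≤ β i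
        β-nonneg zero    = ≤-refl
        β-nonneg (suc i) = α-nonneg S (suc i)
        β≤ē : ∀ i → β i ≤ ē
        β≤ē zero    = ≤-trans 0≤1 1≤ē
        β≤ē (suc i) = α≤e S (suc i)
        ∑β : ∑ β ≈ ∑ (α S) - ē
        ∑β = begin
          ∑ β                                          ≈⟨ trans (∑-suc β) (+-identityˡ _) ⟩
          ∑[ i ] α S (suc i)                           ≈⟨ solve 2 (λ a s → s := a :+ s :- a) refl ē _ ⟩
          ē + ∑[ i ] α S (suc i) - ē                   ≈⟨ +-congʳ (trans (∑-suc (α S)) (+-congʳ (α₀≈e S))) ⟨
          ∑ (α S) - ē                                  ∎
        mass : ∑ β ≤ (∑[ k ] Vector.replicate c ē k)
        mass = ≤-resp (sym ∑β)
          (trans (+-congʳ (∑-suc (Vector.replicate (suc c) ē))) (solve 2 (λ e s → e :+ s :- e := s) refl ē _))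
          (+-mono-≤ (∑α≤ S) (≤-refl {x = - ē}))
        value : ∑[ i ] (μ i * β i) ≈ - (μ zero * ē)
        value = begin
          ∑[ i ] (μ i * β i)
            ≈⟨ trans (∑-suc _) (trans (+-congʳ (zeroʳ _)) (+-identityˡ _)) ⟩
          ∑[ i ] (μ (suc i) * α S (suc i))
            ≈⟨ solve 2 (λ a s → s := :- a :+ (a :+ s)) refl (μ zero * ē) _ ⟩
          - (μ zero * ē) + (μ zero * ē + ∑[ i ] (μ (suc i) * α S (suc i)))
            ≈⟨ +-congˡ (trans (∑-suc (λ i → μ i * α S i)) (+-congʳ (*-congˡ (α₀≈e S)))) ⟨
          - (μ zero * ē) + ∑[ i ] (μ i * α S i)
            ≈⟨ trans (+-congˡ (∑μα≈0 S)) (+-identityʳ _) ⟩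
          - (μ zero * ē) ∎

-- From complex projectors to real ones.

module Realification where
  open OrderedField ℝ-commutativeRing _≤ᵣ_ RealOrderedField.ℝ-isWeakOrderedField
  open ColoringBound ℝ-commutativeRing _≤ᵣ_ RealOrderedField.ℝ-isWeakOrderedField using (RealColoring)
  open Complexification ℝ-commutativeRing using (re; im)
  open import Relation.Binary.Reasoning.Setoid setoid
  private module Σℂ = Sums ℂ-commutativeRing

  re-sum : ∀ {n} (f : Vector ℂ n) → re (Σℂ.sum f) ≈ ∑[ i ] re (f i)
  re-sum {zero}  f = sym (∑-empty _)
  re-sum {suc n} f = trans (+-congˡ (re-sum (f ∘ suc))) (sym (∑-suc _))

  im-sum : ∀ {n} (f : Vector ℂ n) → im (Σℂ.sum f) ≈ ∑[ i ] im (f i)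
  im-sum {zero}  f = sym (∑-empty _)
  im-sum {suc n} f = trans (+-congˡ (im-sum (f ∘ suc))) (sym (∑-suc _))

  -- X + iY as the real block matrix (X  −Y ; Y  X).
  block : ∀ {d} → ℂ-Matrices.Matrix d d → Fin d ⊎ Fin d → Fin d ⊎ Fin d → Carrier
  block M (inj₁ i) (inj₁ j) = re (M i j)
  block M (inj₁ i) (inj₂ j) = - im (M i j)
  block M (inj₂ i) (inj₁ j) = im (M i j)
  block M (inj₂ i) (inj₂ j) = re (M i j)

  -- The embedding respects products and sums and turns hermitian matrices into symmetric ones. The
  -- doubled dimension disappears when `ē` is cancelled.
  realify : ∀ {d} → ℂ-Matrices.Matrix d d → Matrix (d ℕ.+ d) (d ℕ.+ d)
  realify {d} M a b = block M (splitAt d a) (splitAt d b)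

  ∑-splitAt : ∀ m {n} (g : Fin m ⊎ Fin n → Carrier) →
              ∑[ i ] g (splitAt m i) ≈ ∑[ i ] g (inj₁ i) + ∑[ j ] g (inj₂ j)
  ∑-splitAt zero    g = sym (trans (+-congʳ (∑-empty _)) (+-identityˡ _))
  ∑-splitAt (suc m) g = begin
    ∑[ i ] g (splitAt (suc m) i)
      ≈⟨ ∑-suc _ ⟩
    g (inj₁ zero) + ∑[ i ] g (Sum.map₁ suc (splitAt m i))
      ≈⟨ +-congˡ (∑-splitAt m (g ∘ Sum.map₁ suc)) ⟩
    g (inj₁ zero) + (∑[ i ] g (inj₁ (suc i)) + ∑[ j ] g (inj₂ j))
      ≈⟨ +-assoc _ _ _ ⟨
    g (inj₁ zero) + ∑[ i ] g (inj₁ (suc i)) + ∑[ j ] g (inj₂ j)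
      ≈⟨ +-congʳ (∑-suc _) ⟨
    ∑[ i ] g (inj₁ i) + ∑[ j ] g (inj₂ j) ∎

  block-cong : ∀ {d} {M N : ℂ-Matrices.Matrix d d} → M ℂ-Matrices.≈ₘ N → ∀ s t → block M s t ≈ block N s t
  block-cong M≈N (inj₁ i) (inj₁ j) = proj₁ (M≈N i j)
  block-cong M≈N (inj₁ i) (inj₂ j) = -‿cong (proj₂ (M≈N i j))
  block-cong M≈N (inj₂ i) (inj₁ j) = proj₂ (M≈N i j)
  block-cong M≈N (inj₂ i) (inj₂ j) = proj₁ (M≈N i j)

  block-* : ∀ {d} (M N : ℂ-Matrices.Matrix d d) s t →
            ∑[ k ] (block M s (inj₁ k) * block N (inj₁ k) t) + ∑[ k ] (block M s (inj₂ k) * block N (inj₂ k) t) ≈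
            block (M ℂ-Matrices.*ₘ N) s t
  block-* M N (inj₁ i) (inj₁ j) = trans (sym ∑-+) (trans
    (∑-cong λ k → solve 4 (λ a b c d → a :* c :+ :- b :* d := a :* c :- b :* d) refl _ _ _ _)
    (sym (re-sum _)))
  block-* M N (inj₁ i) (inj₂ j) = trans (sym ∑-+) (trans
    (∑-cong λ k → solve 4 (λ a b c d → a :* :- d :+ :- b :* c := :- (a :* d :+ b :* c)) refl _ _ _ _)
    (trans ∑-neg (-‿cong (sym (im-sum _)))))
  block-* M N (inj₂ i) (inj₁ j) = trans (sym ∑-+) (trans
    (∑-cong λ k → +-comm _ _)
    (sym (im-sum _)))
  block-* M N (inj₂ i) (inj₂ j) = trans (sym ∑-+) (trans
    (∑-cong λ k → solve 4 (λ a b c d → b :* :- d :+ a :* c := a :* c :- b :* d) refl _ _ _ _)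
    (sym (re-sum _)))

  block-sum : ∀ {c d} (Ms : Vector (ℂ-Matrices.Matrix d d) c) s t →
              ∑[ k ] block (Ms k) s t ≈ block (ℂ-Matrices.sumₘ Ms) s t
  block-sum Ms (inj₁ i) (inj₁ j) = sym (re-sum _)
  block-sum Ms (inj₁ i) (inj₂ j) = trans ∑-neg (-‿cong (sym (im-sum _)))
  block-sum Ms (inj₂ i) (inj₁ j) = sym (im-sum _)
  block-sum Ms (inj₂ i) (inj₂ j) = sym (re-sum _)

  re-1ₘ : ∀ {d} (i j : Fin d) → re (ℂ-Matrices.1ₘ i j) ≈ 1ₘ i j
  re-1ₘ i j with i Fin.≟ j
  ... | yes _ = refl
  ... | no  _ = refl

  im-1ₘ : ∀ {d} (i j : Fin d) → im (ℂ-Matrices.1ₘ i j) ≈ 0#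
  im-1ₘ i j with i Fin.≟ j
  ... | yes _ = refl
  ... | no  _ = refl

  1ₘ-injective : ∀ {m n} (f : Fin m → Fin n) → (∀ {i j} → f i ≡ f j → i ≡ j) → ∀ i j → 1ₘ i j ≈ 1ₘ (f i) (f j)
  1ₘ-injective f inj i j with i Fin.≟ j
  ... | yes ≡.refl = sym (1ₘ-diagonal (f i))
  ... | no  i≢j    = sym (1ₘ-off-diagonal (i≢j ∘ inj))

  ↑ˡ≢↑ʳ : ∀ {m n} (i : Fin m) (j : Fin n) → i ↑ˡ n ≢ m ↑ʳ j
  ↑ˡ≢↑ʳ {m} {n} i j eq with ≡.trans (≡.sym (Fin.splitAt-↑ˡ m i n)) (≡.trans (≡.cong (splitAt m) eq) (Fin.splitAt-↑ʳ m n j))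
  ... | ()

  block-1ₘ : ∀ {d} (s t : Fin d ⊎ Fin d) → block ℂ-Matrices.1ₘ s t ≈ 1ₘ (join d d s) (join d d t)
  block-1ₘ {d} (inj₁ i) (inj₁ j) = trans (re-1ₘ i j) (1ₘ-injective (_↑ˡ d) (Fin.↑ˡ-injective d _ _) i j)
  block-1ₘ {d} (inj₁ i) (inj₂ j) = trans (-‿cong (im-1ₘ i j)) (trans -0≈0 (sym (1ₘ-off-diagonal (↑ˡ≢↑ʳ i j))))
    where
    -0≈0 : - 0# ≈ 0#
    -0≈0 = trans (sym (+-identityˡ _)) (-‿inverseʳ 0#)
  block-1ₘ {d} (inj₂ i) (inj₁ j) = trans (im-1ₘ i j) (sym (1ₘ-off-diagonal (↑ˡ≢↑ʳ j i ∘ ≡.sym)))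
  block-1ₘ {d} (inj₂ i) (inj₂ j) = trans (re-1ₘ i j) (1ₘ-injective (d ↑ʳ_) (Fin.↑ʳ-injective d _ _) i j)

  realify-* : ∀ {d} (M N : ℂ-Matrices.Matrix d d) a b →
              ∑[ k ] (realify M a k * realify N k b) ≈ realify (M ℂ-Matrices.*ₘ N) a b
  realify-* {d} M N a b = trans
    (∑-splitAt d (λ k → block M (splitAt d a) k * block N k (splitAt d b))) (block-* M N (splitAt d a) (splitAt d b))

  block-hermitian : ∀ {d} {M : ℂ-Matrices.Matrix d d} → (M †) ℂ-Matrices.≈ₘ M → ∀ s t → block M s t ≈ block M t s
  block-hermitian M†≈M (inj₁ i) (inj₁ j) = sym (proj₁ (M†≈M i j))
  block-hermitian M†≈M (inj₁ i) (inj₂ j) = trans (-‿cong (sym (proj₂ (M†≈M i j)))) (solve 1 (λ x → :- :- x := x) refl _)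
  block-hermitian M†≈M (inj₂ i) (inj₁ j) = sym (proj₂ (M†≈M i j))
  block-hermitian M†≈M (inj₂ i) (inj₂ j) = sym (proj₁ (M†≈M i j))

  module _ {n c d} {G : SimpleGraph n} (Q : QuantumColoring G c d) where
    open QuantumColoring Q
    open SimpleGraph G

    realColoring : RealColoring (adjacencyMatrix G) c (d ℕ.+ d)
    realColoring = record
      { P          = λ v k → realify (P v k)
      ; symmetric  = λ v k a b → block-hermitian (IsOrthogonalProjector.hermitian (projector v k)) (splitAt d a) (splitAt d b)
      ; idempotent = λ v k a b → trans (realify-* (P v k) (P v k) a b)
          (block-cong (IsOrthogonalProjector.idempotent (projector v k)) (splitAt d a) (splitAt d b))
      ; complete   = λ v a b → begin
          ∑[ k ] realify (P v k) a b
            ≈⟨ trans (block-sum (P v) (splitAt d a) (splitAt d b)) (block-cong (complete v) (splitAt d a) (splitAt d b)) ⟩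
          block ℂ-Matrices.1ₘ (splitAt d a) (splitAt d b)
            ≈⟨ block-1ₘ (splitAt d a) (splitAt d b) ⟩
          1ₘ (join d d (splitAt d a)) (join d d (splitAt d b))
            ≡⟨ ≡.cong₂ 1ₘ (Fin.join-splitAt d d a) (Fin.join-splitAt d d b) ⟩
          1ₘ a b ∎
      ; orthogonal = edges
      }
      where
      block-0ₘ : ∀ (s t : Fin d ⊎ Fin d) → block ℂ-Matrices.0ₘ s t ≈ 0#
      block-0ₘ (inj₁ i) (inj₁ j) = refl
      block-0ₘ (inj₁ i) (inj₂ j) = trans (sym (+-identityˡ _)) (-‿inverseʳ 0#)
      block-0ₘ (inj₂ i) (inj₁ j) = refl
      block-0ₘ (inj₂ i) (inj₂ j) = refl
      edges : ∀ v w k a b →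
              adjacencyMatrix G v w * ∑[ j ] (realify (P v k) a j * realify (P w k) j b) ≈ 0#
      edges v w k a b with adj? v w
      ... | no  _   = zeroˡ _
      ... | yes v~w = trans (*-congˡ (trans (realify-* (P v k) (P w k) a b)
              (trans (block-cong (orthogonal v~w k) (splitAt d a) (splitAt d b)) (block-0ₘ (splitAt d a) (splitAt d b)))))
            (zeroʳ _)

  adjacencyMatrix-symmetric : ∀ {n} (G : SimpleGraph n) v w → adjacencyMatrix G v w ≈ adjacencyMatrix G w v
  adjacencyMatrix-symmetric G v w with SimpleGraph.adj? G v w | SimpleGraph.adj? G w v
  ... | yes _   | yes _   = refl
  ... | no  _   | no  _   = refl
  ... | yes v~w | no  w≁v = contradiction (SimpleGraph.symmetric G v~w) w≁v
  ... | no  v≁w | yes w~v = contradiction (SimpleGraph.symmetric G w~v) v≁w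

  -- At the first vertex an empty sum would have to be the identity matrix, which has an entry 1
  -- because the dimension is positive.
  not-0-colorable : ∀ {n} (G : SimpleGraph (suc n)) → ¬ QuantumColorable G 0
  not-0-colorable G (suc d , _ , Q) = 1≉0 (sym (proj₁ (QuantumColoring.complete Q zero zero zero)))

  spectralCondition : ∀ {m c} (G : SimpleGraph (suc m)) {μ : Vector ℝ (suc m)} → IsSpectrum (adjacencyMatrix G) μ →
                      QuantumColorable G (suc c) → c ℕ.≤ suc m → ¬ ¬ (Σ[ q ∈ ℕ ] q ℕ.≤ c × SpectralCondition μ q)
  spectralCondition G {μ} (spectrum , μ↘) (suc d , _ , Q) c≤n =
    coloring-bound (adjacencyMatrix-symmetric G) spectrum μ↘ (realColoring Q) c≤n >>= λ
      { (q , q≤c , q≤n , bound) → pure (q , q≤c , q≤n ,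
          -- Passes from the opaque sum to the one in which `SpectralCondition` is stated.
          ≡.subst (λ s → (μ zero +ᵣ s) ≤ᵣ 0#) (∑≡sum (λ i → μ (opposite (inject≤ i q≤n)))) bound) }
    where
    open ColoringBound ℝ-commutativeRing _≤ᵣ_ RealOrderedField.ℝ-isWeakOrderedField using (coloring-bound)
    open Real using (_+ᵣ_)

-- The bound on the quantum chromatic number.

open import Data.Nat.Base using (_+_; _≤_)

theorem2 : ∀ {m : ℕ} (G : SimpleGraph (suc m)) → Connected G →
    (μ : Vector ℝ (suc m)) → IsSpectrum (adjacencyMatrix G) μ →
    (κ : ℕ) → IsLeast (SpectralCondition μ) κ →
    (χ : ℕ) → IsQuantumChromaticNumber G χ →
    1 + κ ≤ χ
theorem2 G _ μ spectrum κ _ zero (colorable , _) = contradiction colorable (Realification.not-0-colorable G)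
theorem2 {m} G _ μ spectrum κ ((κ≤n , _) , κ-least) (suc c) (colorable , _) with c ℕ.≤? suc m
-- Here `c` is one less than the number of colors. If it exceeds the number of eigenvalues, the
-- bound on `κ` contained in `SpectralCondition` suffices.
... | no  c≰n = ℕ.s≤s (ℕ.≤-trans κ≤n (ℕ.<⇒≤ (ℕ.≰⇒> c≰n)))
... | yes c≤n = ℕ.s≤s (decidable-stable (κ ℕ.≤? c) λ κ≰c →
  Realification.spectralCondition G spectrum colorable c≤n λ (q , q≤c , cond) →
    κ≰c (ℕ.≤-trans (κ-least q cond) q≤c))
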